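{- Let $p$ be an odd prime and let $s$ be an integer with $0\le s\le \frac{p-1}{2}$. Then, modulo $[p]^2$, $$\sum_{k=0}^{\frac{p-1}{2}} \begin{bmatrix}2k\\k\end{bmatrix}_{q^2}^2 \begin{bmatrix}2k\\k+s\end{bmatrix}_{q^2} \frac{q^{2k}}{(-q^2;q^2)_k^2\,(-q;q)_{2k}^2} \equiv \begin{cases} (-1)^s q^{\frac{p-1}{2}-s^2} \begin{bmatrix}\frac{p-1}{2}\\ \frac{p-2s-1}{4}\end{bmatrix}_{q^4}^2 \dfrac{(q^2;q^2)_{\frac{p-2s-1}{2}}\,(q^2;q^2)_{\frac{p+2s-1}{2}}}{(q^4;q^4)_{\frac{p-1}{2}}^2}, & \text{if } s\equiv \frac{p-1}{2}\pmod 2,\\[2mm] 0, & \text{otherwise.}\end{cases}$$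
   Context: For an indeterminate $q$ and an integer $n\ge 0$: $(a;q)_0=1$ and $(a;q)_n=(1-a)(1-aq)\cdots(1-aq^{n-1})$. The $q$-binomial coefficient is $\begin{bmatrix}n\\k\end{bmatrix}_q=\frac{(q^{n-k+1};q)_k}{(q;q)_k}$ if $0\le k\le n$ and $0$ otherwise; if no base is indicated, the base is $q$. For a positive integer $p$, $[p]=\frac{1-q^p}{1-q}=1+q+\cdots+q^{p-1}$. For a prime $p$, $[p]$ is irreducible in $\mathbb{Q}[q]$; for rational functions $A,B$ of $q$ whose denominators are coprime to $[p]$, $A\equiv B\pmod{[p]^r}$ means that $A-B$, written in lowest terms, has numerator divisible by $[p]^r$ in $\mathbb{Q}[q]$. -}

module Defs where

open import Algebra.Bundles.Raw using (RawRing)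
import Algebra.Definitions.RawSemiring as RawSemiringDefs
open import Data.Bool.Base using (if_then_else_)
open import Data.Fin.Base using (toℕ)
open import Data.Integer.Base using (ℤ; +_; -[1+_])
open import Data.List.Base using (List; []; _∷_; map)
open import Data.Nat.Base as ℕ using (ℕ; zero; suc; _∸_; _≤ᵇ_)
open import Data.Rational.Base as ℚ using (ℚ; 0ℚ; 1ℚ)
import Data.Rational.Properties as ℚ
open import Level using (0ℓ)
open import Relation.Binary.PropositionalEquality
  using (_≡_; refl; sym; trans; cong; module ≡-Reasoning)
open import Relation.Nullary using (¬_; Dec; yes; no)

-- a₀ ∷ a₁ ∷ … represents a₀ + a₁q + ⋯. Trailing zeros are allowed, so
-- equality is equality of all coefficients.

Poly : Set
Poly = List ℚ

coeff : Poly → ℕ → ℚ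
coeff []      _       = 0ℚ
coeff (a ∷ f) zero    = a
coeff (a ∷ f) (suc n) = coeff f n

infix 4 _≈ₚ_
record _≈ₚ_ (f g : Poly) : Set where
  constructor coeffwise
  field
    at : ∀ n → coeff f n ≡ coeff g n
open _≈ₚ_ public

infixl 6 _+ₚ_
_+ₚ_ : Poly → Poly → Poly
[]      +ₚ g       = g
(a ∷ f) +ₚ []      = a ∷ f
(a ∷ f) +ₚ (b ∷ g) = (a ℚ.+ b) ∷ (f +ₚ g)

infix 8 -ₚ_
-ₚ_ : Poly → Poly
-ₚ_ = map (λ a → ℚ.- a)

infixl 7 _*ₚ_
_*ₚ_ : Poly → Poly → Poly
[]      *ₚ g = []
(a ∷ f) *ₚ g = map (a ℚ.*_) g +ₚ (0ℚ ∷ (f *ₚ g))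

0ₚ 1ₚ X : Poly
0ₚ = []
1ₚ = 1ℚ ∷ []
X  = 0ℚ ∷ 1ℚ ∷ []

ℚ[q] : RawRing 0ℓ 0ℓ
ℚ[q] = record
  { Carrier = Poly
  ; _≈_ = _≈ₚ_
  ; _+_ = _+ₚ_
  ; _*_ = _*ₚ_
  ; -_  = -ₚ_
  ; 0#  = 0ₚ
  ; 1#  = 1ₚ
  }

open RawSemiringDefs (RawRing.rawSemiring ℚ[q]) public
  using ()
  renaming (_^_ to _^ₚ_; _∣_ to _∣ₚ_; Coprime to Coprimeₚ; sum to sumₚ)

[_]ₚ : ℕ → Poly
[ p ]ₚ = sumₚ {p} (λ i → X ^ₚ toℕ i)

zero? : ∀ f → Dec (f ≈ₚ 0ₚ)
zero? [] = yes (coeffwise λ _ → refl)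
zero? (a ∷ f) with a ℚ.≟ 0ℚ | zero? f
... | yes a≡0 | yes f≈0 = yes (coeffwise λ { zero → a≡0 ; (suc n) → at f≈0 n })
... | yes _   | no  f≉0 = no λ af≈0 → f≉0 (coeffwise λ n → at af≈0 (suc n))
... | no  a≢0 | _       = no λ af≈0 → a≢0 (at af≈0 zero)

1≉0 : ¬ (1ₚ ≈ₚ 0ₚ)
1≉0 1≈0 with at 1≈0 zero
... | ()

coeff-+ : ∀ f g n → coeff (f +ₚ g) n ≡ coeff f n ℚ.+ coeff g n
coeff-+ []      g       n       = sym (ℚ.+-identityˡ (coeff g n))
coeff-+ (a ∷ f) []      n       = sym (ℚ.+-identityʳ (coeff (a ∷ f) n))
coeff-+ (a ∷ f) (b ∷ g) zero    = refl
coeff-+ (a ∷ f) (b ∷ g) (suc n) = coeff-+ f g n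

coeff-scale : ∀ a g n → coeff (map (a ℚ.*_) g) n ≡ a ℚ.* coeff g n
coeff-scale a []      n       = sym (ℚ.*-zeroʳ a)
coeff-scale a (b ∷ g) zero    = refl
coeff-scale a (b ∷ g) (suc n) = coeff-scale a g n

coeff-∷* : ∀ a f g n →
           coeff ((a ∷ f) *ₚ g) n ≡ a ℚ.* coeff g n ℚ.+ coeff (0ℚ ∷ (f *ₚ g)) n
coeff-∷* a f g n =
  trans (coeff-+ (map (a ℚ.*_) g) _ n)
        (cong (ℚ._+ coeff (0ℚ ∷ (f *ₚ g)) n) (coeff-scale a g n))

no-zero-divisors-ℚ : ∀ {a b} → a ℚ.* b ≡ 0ℚ → ¬ (b ≡ 0ℚ) → a ≡ 0ℚ
no-zero-divisors-ℚ {a} {b} ab≡0 b≢0 = begin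
  a                        ≡⟨ ℚ.*-identityʳ a ⟨
  a ℚ.* 1ℚ                 ≡⟨ cong (a ℚ.*_) (ℚ.*-inverseʳ b) ⟨
  a ℚ.* (b ℚ.* (ℚ.1/ b))   ≡⟨ ℚ.*-assoc a b (ℚ.1/ b) ⟨
  a ℚ.* b ℚ.* (ℚ.1/ b)     ≡⟨ cong (ℚ._* (ℚ.1/ b)) ab≡0 ⟩
  0ℚ ℚ.* (ℚ.1/ b)          ≡⟨ ℚ.*-zeroˡ (ℚ.1/ b) ⟩
  0ℚ                       ∎
  where
  open ≡-Reasoning
  instance _ = ℚ.≢-nonZero b≢0

coeff-0∷* : ∀ f g n → coeff ((0ℚ ∷ f) *ₚ g) n ≡ coeff (0ℚ ∷ (f *ₚ g)) n
coeff-0∷* f g n =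
  trans (coeff-∷* 0ℚ f g n)
        (trans (cong (ℚ._+ c) (ℚ.*-zeroˡ (coeff g n))) (ℚ.+-identityˡ c))
  where c = coeff (0ℚ ∷ (f *ₚ g)) n

coeff-*0∷ : ∀ f g n → coeff (f *ₚ (0ℚ ∷ g)) n ≡ coeff (0ℚ ∷ (f *ₚ g)) n
coeff-*0∷ []      g zero    = refl
coeff-*0∷ []      g (suc n) = refl
coeff-*0∷ (a ∷ f) g zero    = trans (ℚ.+-identityʳ _) (ℚ.*-zeroʳ a)
coeff-*0∷ (a ∷ f) g (suc n) =
  trans (coeff-∷* a f (0ℚ ∷ g) (suc n))
        (trans (cong (a ℚ.* coeff g n ℚ.+_) (coeff-*0∷ f g n))
               (sym (coeff-∷* a f g n)))

*-cancelʳ-nonzeroConst : ∀ f {b} g → ¬ (b ≡ 0ℚ) → f *ₚ (b ∷ g) ≈ₚ 0ₚ → f ≈ₚ 0ₚ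
*-cancelʳ-nonzeroConst []      g b≢0 fg≈0 = coeffwise λ _ → refl
*-cancelʳ-nonzeroConst (a ∷ f) {b} g b≢0 fg≈0
  with no-zero-divisors-ℚ {a} {b} (trans (sym (ℚ.+-identityʳ _)) (at fg≈0 zero)) b≢0
... | refl = coeffwise λ { zero → refl ; (suc n) → at f≈0 n }
  where
  f≈0 : f ≈ₚ 0ₚ
  f≈0 = *-cancelʳ-nonzeroConst f g b≢0
          (coeffwise λ n → trans (sym (coeff-0∷* f _ (suc n))) (at fg≈0 (suc n)))

*-≉0 : ∀ f g → ¬ (f ≈ₚ 0ₚ) → ¬ (g ≈ₚ 0ₚ) → ¬ (f *ₚ g ≈ₚ 0ₚ)
*-≉0 f []      f≉0 g≉0 _    = g≉0 (coeffwise λ _ → refl)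
*-≉0 f (b ∷ g) f≉0 g≉0 fg≈0 with b ℚ.≟ 0ℚ
... | no b≢0   = f≉0 (*-cancelʳ-nonzeroConst f g b≢0 fg≈0)
... | yes refl = *-≉0 f g f≉0
  (λ g≈0 → g≉0 (coeffwise λ { zero → refl ; (suc n) → at g≈0 n }))
  (coeffwise λ n → trans (sym (coeff-*0∷ f g (suc n))) (at fg≈0 (suc n)))

record RatFun : Set where
  constructor frac
  field
    num   : Poly
    den   : Poly
    den≉0 : ¬ (den ≈ₚ 0ₚ)
open RatFun public

infix 4 _≃_
_≃_ : RatFun → RatFun → Set
A ≃ B = num A *ₚ den B ≈ₚ num B *ₚ den A

fromPoly : Poly → RatFun
fromPoly f = frac f 1ₚ 1≉0

0ᶠ 1ᶠ q : RatFun
0ᶠ = fromPoly 0ₚ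
1ᶠ = fromPoly 1ₚ
q  = fromPoly X

infixl 6 _+ᶠ_ _-ᶠ_
infixl 7 _*ᶠ_ _/ᶠ_
infix  8 -ᶠ_
infix  9 _⁻¹

_+ᶠ_ : RatFun → RatFun → RatFun
A +ᶠ B = frac (num A *ₚ den B +ₚ num B *ₚ den A) (den A *ₚ den B)
              (*-≉0 (den A) (den B) (den≉0 A) (den≉0 B))

_*ᶠ_ : RatFun → RatFun → RatFun
A *ᶠ B = frac (num A *ₚ num B) (den A *ₚ den B)
              (*-≉0 (den A) (den B) (den≉0 A) (den≉0 B))

-ᶠ_ : RatFun → RatFun
-ᶠ_ A = frac (-ₚ num A) (den A) (den≉0 A)

_-ᶠ_ : RatFun → RatFun → RatFun
A -ᶠ B = A +ᶠ (-ᶠ B)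

-- Totalised by 0⁻¹ = 0; only inverses of nonzero elements matter below.
_⁻¹ : RatFun → RatFun
A ⁻¹ with zero? (num A)
... | yes _     = 0ᶠ
... | no  num≉0 = frac (den A) (num A) num≉0

_/ᶠ_ : RatFun → RatFun → RatFun
A /ᶠ B = A *ᶠ B ⁻¹

ℚ⟨q⟩ : RawRing 0ℓ 0ℓ
ℚ⟨q⟩ = record
  { Carrier = RatFun
  ; _≈_ = _≃_
  ; _+_ = _+ᶠ_
  ; _*_ = _*ᶠ_
  ; -_  = -ᶠ_
  ; 0#  = 0ᶠ
  ; 1#  = 1ᶠ
  }

open RawSemiringDefs (RawRing.rawSemiring ℚ⟨q⟩) public
  using ()
  renaming (_^_ to infixr 9 _^ᶠ_; sum to sumᶠ; product to productᶠ)

infixr 9 _^ᶻ_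
_^ᶻ_ : RatFun → ℤ → RatFun
A ^ᶻ (+ n)    = A ^ᶠ n
A ^ᶻ -[1+ n ] = (A ^ᶠ suc n) ⁻¹

∑≤ : ℕ → (ℕ → RatFun) → RatFun
∑≤ n t = sumᶠ {suc n} (λ k → t (toℕ k))

infix 5 ∑≤
syntax ∑≤ n (λ k → t) = ∑[ k ≤ n ] t

-- ⟨ a ⨾ b ⟩[ n ] is (a;b)ₙ; the base b is an argument since bases q, q²
-- and q⁴ all occur.
⟨_⨾_⟩[_] : RatFun → RatFun → ℕ → RatFun
⟨ a ⨾ b ⟩[ n ] = productᶠ {n} (λ i → 1ᶠ -ᶠ a *ᶠ b ^ᶠ toℕ i)

[_choose_]⟨_⟩ : ℕ → ℕ → RatFun → RatFun
[ n choose k ]⟨ b ⟩ =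
  if k ≤ᵇ n then ⟨ b ^ᶠ (n ∸ k ℕ.+ 1) ⨾ b ⟩[ k ] /ᶠ ⟨ b ⨾ b ⟩[ k ] else 0ᶠ

-- Lowest terms are unique up to a common scalar factor, which affects
-- neither coprimality nor divisibility in ℚ[q].
record LowestTerms (A : RatFun) : Set where
  field
    reduced : RatFun
    A≃      : A ≃ reduced
    coprime : Coprimeₚ (num reduced) (den reduced)

  numerator denominator : Poly
  numerator   = num reduced
  denominator = den reduced
open LowestTerms public using (numerator; denominator)

infix 4 _≋_mod[_]^_
record _≋_mod[_]^_ (A B : RatFun) (p r : ℕ) : Set where
  field
    lowestA     : LowestTerms A
    lowestB     : LowestTerms B
    lowestA-B   : LowestTerms (A -ᶠ B)
    coprimeA    : Coprimeₚ (denominator lowestA) [ p ]ₚ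
    coprimeB    : Coprimeₚ (denominator lowestB) [ p ]ₚ
    [p]ʳ∣A-B    : ([ p ]ₚ ^ₚ r) ∣ₚ numerator lowestA-B

{- Put b = q² and n = (p − 1)/2. The k-th summand equals
     (q;q²)_k² / (b²;b²)_k² · bᵏ · [2k choose k+s]_b,
   and modulo [p]² the factor (q;q²)_k² may be replaced by (b⁻ⁿ;b)_k (bⁿ⁺¹;b)_k,
   because (1 − c)² ≡ (1 − cq⁻ᵖ)(1 − cqᵖ). The new sum S_n(s) is evaluated exactly: it is
   the coefficient in the Askey–Wilson type (₄φ₃) expansion of Rogers' continuous
   q-ultraspherical polynomials C_n(x; b | b²), and both S_n(s) and the known coefficients
   T_n(s) satisfy the three-term recurrence in n
     (1 − b²ⁿ⁺²) S_{n+1}(s) + (1 − b²ⁿ) b S_{n−1}(s)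
       = − (1 − b²ⁿ⁺¹) (b^{1−s} S_n(s−1) + b^{1+s} S_n(s+1)).
   For S this follows from a contiguity relation of the factors (b⁻ⁿ;b)_k (bⁿ⁺¹;b)_k and the
   recurrence in k of [2k choose k+s]_b. Integrality at [p] needs no irreducibility: 1 − qʲ is
   comaximal with [p] for p ∤ j by Bézout, and lowest terms come from Euclid's algorithm. -}

module Submission where

import Algebra.Definitions.RawMagma as RawMagmaDefinitions
import Algebra.Definitions.RawSemiring as RawSemiringDefinitions
import Algebra.Properties.AbelianGroup as AbelianGroupProperties
import Algebra.Properties.CommutativeSemiring.Exp as CommutativeExp
import Algebra.Properties.Ring as RingProperties
import Algebra.Properties.Semiring.Exp as Exp
import Algebra.Properties.Semiring.Mult.TCOptimised as Mult
import Algebra.Properties.Semiring.Sum as Sum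
import Algebra.Solver.Ring as RingSolver
import Data.Integer.Properties as ℤ
import Data.Nat.Properties as ℕ
import Data.Rational.Properties as ℚ
import Relation.Binary.Reasoning.Setoid as SetoidReasoning
open import Algebra.Bundles using (CommutativeRing; Semiring)
open import Algebra.Solver.Ring.AlmostCommutativeRing using (fromCommutativeRing; _-Raw-AlmostCommutative⟶_)
open import Data.Bool.Base using (true; false; if_then_else_)
open import Data.Empty using (⊥-elim)
open import Data.Fin.Base using (toℕ)
open import Data.Integer.Base as ℤ using (ℤ; -[1+_]; _⊖_)
open import Data.List.Base using ([]; _∷_; map; length)
open import Data.Maybe.Base using (Maybe; just; nothing)
open import Data.Nat.Base as ℕ using (ℕ; zero; suc; _≤ᵇ_; _∸_; _≤_; _<_; z≤n; s≤s)
open import Data.Nat.GCD using (module Bézout)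
open import Data.Nat.Solver using (module +-*-Solver)
open import Data.Product.Base using (∃; _×_; _,_; proj₁; proj₂)
open import Data.Rational.Base as ℚ using (ℚ; 0ℚ; 1ℚ)
open import Data.Sum.Base using (_⊎_; inj₁; inj₂)
open import Level using (0ℓ; _⊔_)
open import Relation.Binary.PropositionalEquality as ≡ using (_≡_; _≢_)
open import Relation.Nullary using (¬_; Dec; yes; no; contradiction)
open Bézout using (Identity; +-; -+)

-- The recurrence is the one of the Rogers polynomials in disguise. Let c_n(s) be the coefficient of
-- z^s in C_n(x; b | b²), where 2x = z + 1/z. Putting S_n(s) = (-1)^s b^{(n-s²)/2} c_n(s) turns (1 -
-- b^{2n+2}) c_{n+1}(s) + (1 - b^{2n}) c_{n-1}(s) = (1 - b^{2n+1}) (c_n(s-1) + c_n(s+1)) into the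
-- recurrence for S. With b = q² this twist is the factor (-1)^s q^{n-s²} of the theorem, and the
-- case with value 0 is the parity of C_n as a Laurent polynomial in z. The obstacle is division and
-- negative exponents. The q-series are therefore treated over an arbitrary commutative ring in
-- which every unit comes with a named inverse, and identities in s are multiplied by b^s; each then
-- becomes a polynomial identity modulo relations such as b b̄ = 1. The contiguity relation is
-- proved for a free unit y, because y ↦ by and y ↦ y/b are the shifts n ↦ n ± 1; y = bⁿ is needed
-- only to make the sum terminate.

-- Ring identities with integer coefficients

module ℤ-Solver {c ℓ} (R : CommutativeRing c ℓ) where
  open CommutativeRing R
  open AbelianGroupProperties +-abelianGroup using (⁻¹-∙-comm; ⁻¹-involutive)
  open RingProperties ring using (-‿distribˡ-*; -‿distribʳ-*; -0#≈0#)
  open Mult semiring using (1+×; ×-homo-+; ×1-homo-*) renaming (_×_ to _·_)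
  open import Data.Integer.Base using (+_)
  open SetoidReasoning setoid

  private
    ⟦_⟧ : ℤ → Carrier
    ⟦ + n ⟧      = n · 1#
    ⟦ -[1+ n ] ⟧ = - (suc n · 1#)

    -‿homo : ∀ i → ⟦ ℤ.- i ⟧ ≈ - ⟦ i ⟧
    -‿homo (+ zero)   = sym -0#≈0#
    -‿homo (+ suc n)  = refl
    -‿homo (-[1+ n ]) = sym (⁻¹-involutive _)

    cancel-head : ∀ x y z → (x + y) + - (x + z) ≈ y + - z
    cancel-head x y z = begin
      (x + y) + - (x + z)     ≈⟨ +-cong (+-comm x y) (sym (⁻¹-∙-comm x z)) ⟩
      (y + x) + (- x + - z)   ≈⟨ +-assoc y x _ ⟩
      y + (x + (- x + - z))   ≈⟨ +-congˡ (sym (+-assoc x (- x) (- z))) ⟩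
      y + ((x + - x) + - z)   ≈⟨ +-congˡ (+-congʳ (-‿inverseʳ x)) ⟩
      y + (0# + - z)          ≈⟨ +-congˡ (+-identityˡ _) ⟩
      y + - z                 ∎

    ⊖-homo : ∀ m n → ⟦ m ⊖ n ⟧ ≈ m · 1# + - (n · 1#)
    ⊖-homo zero    zero    = sym (-‿inverseʳ 0#)
    ⊖-homo zero    (suc n) = sym (+-identityˡ _)
    ⊖-homo (suc m) zero    = sym (trans (+-congˡ -0#≈0#) (+-identityʳ _))
    ⊖-homo (suc m) (suc n) = begin
      ⟦ suc m ⊖ suc n ⟧                   ≡⟨ ≡.cong ⟦_⟧ (ℤ.[1+m]⊖[1+n]≡m⊖n m n) ⟩
      ⟦ m ⊖ n ⟧                           ≈⟨ ⊖-homo m n ⟩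
      m · 1# + - (n · 1#)                 ≈⟨ cancel-head 1# _ _ ⟨
      (1# + m · 1#) + - (1# + n · 1#)     ≈⟨ +-cong (1+× m 1#) (-‿cong (1+× n 1#)) ⟨
      suc m · 1# + - (suc n · 1#)         ∎

    +-homo : ∀ i j → ⟦ i ℤ.+ j ⟧ ≈ ⟦ i ⟧ + ⟦ j ⟧
    +-homo (+ m)    (+ n)    = ×-homo-+ 1# m n
    +-homo (+ m)    -[1+ n ] = ⊖-homo m (suc n)
    +-homo -[1+ m ] (+ n)    = trans (⊖-homo n (suc m)) (+-comm _ _)
    +-homo -[1+ m ] -[1+ n ] = begin
      - ((2 ℕ.+ (m ℕ.+ n)) · 1#)        ≡⟨ ≡.cong (λ k → - (k · 1#)) (ℕ-+-suc m n) ⟨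
      - ((suc m ℕ.+ suc n) · 1#)        ≈⟨ -‿cong (×-homo-+ 1# (suc m) (suc n)) ⟩
      - (suc m · 1# + suc n · 1#)       ≈⟨ ⁻¹-∙-comm _ _ ⟨
      - (suc m · 1#) + - (suc n · 1#)   ∎
      where
      ℕ-+-suc : ∀ m n → suc m ℕ.+ suc n ≡ 2 ℕ.+ (m ℕ.+ n)
      ℕ-+-suc zero    n = ≡.refl
      ℕ-+-suc (suc m) n = ≡.cong suc (ℕ-+-suc m n)

    *-homo : ∀ i j → ⟦ i ℤ.* j ⟧ ≈ ⟦ i ⟧ * ⟦ j ⟧
    *-homo (+ m) (+ n) = begin
      ⟦ (+ m) ℤ.* (+ n) ⟧ ≡⟨ ≡.cong ⟦_⟧ (ℤ.+◃n≡+n (m ℕ.* n)) ⟩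
      (m ℕ.* n) · 1#      ≈⟨ ×1-homo-* m n ⟩
      m · 1# * (n · 1#)   ∎
    *-homo (+ m) -[1+ n ] = begin
      ⟦ (+ m) ℤ.* -[1+ n ] ⟧    ≡⟨ ≡.cong ⟦_⟧ (ℤ.-◃n≡-n (m ℕ.* suc n)) ⟩
      ⟦ ℤ.- (+ (m ℕ.* suc n)) ⟧ ≈⟨ -‿homo (+ (m ℕ.* suc n)) ⟩
      - ((m ℕ.* suc n) · 1#)    ≈⟨ -‿cong (×1-homo-* m (suc n)) ⟩
      - (m · 1# * (suc n · 1#)) ≈⟨ -‿distribʳ-* _ _ ⟩
      m · 1# * - (suc n · 1#)   ∎
    *-homo -[1+ m ] (+ n) = begin
      ⟦ -[1+ m ] ℤ.* (+ n) ⟧    ≡⟨ ≡.cong ⟦_⟧ (ℤ.-◃n≡-n (suc m ℕ.* n)) ⟩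
      ⟦ ℤ.- (+ (suc m ℕ.* n)) ⟧ ≈⟨ -‿homo (+ (suc m ℕ.* n)) ⟩
      - ((suc m ℕ.* n) · 1#)    ≈⟨ -‿cong (×1-homo-* (suc m) n) ⟩
      - (suc m · 1# * (n · 1#)) ≈⟨ -‿distribˡ-* _ _ ⟩
      - (suc m · 1#) * (n · 1#) ∎
    *-homo -[1+ m ] -[1+ n ] = begin
      (suc m ℕ.* suc n) · 1#            ≈⟨ ×1-homo-* (suc m) (suc n) ⟩
      suc m · 1# * (suc n · 1#)         ≈⟨ ⁻¹-involutive _ ⟨
      - - (suc m · 1# * (suc n · 1#))   ≈⟨ -‿cong (-‿distribˡ-* _ _) ⟩
      - (- (suc m · 1#) * (suc n · 1#)) ≈⟨ -‿distribʳ-* _ _ ⟩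
      - (suc m · 1#) * - (suc n · 1#)   ∎

    -- The solver's coefficients are integers because normalisation has to decide their equality,
    -- which is impossible for elements of an abstract ring.
    morphism : ℤ.+-*-rawRing -Raw-AlmostCommutative⟶ fromCommutativeRing R
    morphism = record
      { ⟦_⟧    = ⟦_⟧
      ; +-homo = +-homo
      ; *-homo = *-homo
      ; -‿homo = -‿homo
      ; 0-homo = refl
      ; 1-homo = refl
      }

    coeff≟ : ∀ i j → Maybe (⟦ i ⟧ ≈ ⟦ j ⟧)
    coeff≟ i j with i ℤ.≟ j
    ... | yes i≡j = just (reflexive (≡.cong ⟦_⟧ i≡j))
    ... | no  _   = nothing

  open RingSolver ℤ.+-*-rawRing (fromCommutativeRing R) morphism coeff≟ public
    using (solve; Polynomial; con; _:=_; _:+_; _:*_; _:-_; :-_; _:^_)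

  :1 : ∀ {n} → Polynomial n
  :1 = con (+ 1)

  :0 : ∀ {n} → Polynomial n
  :0 = con (+ 0)

  private
    move : ∀ {x y u v} c → u ≈ v → x + c * v ≈ y + c * u → x ≈ y
    move {x} {y} {u} {v} c u≈v eq = begin
      x                      ≈⟨ solve 2 (λ x w → x := x :+ w :- w) refl x (c * v) ⟩
      x + c * v + - (c * v)  ≈⟨ +-congʳ eq ⟩
      y + c * u + - (c * v)  ≈⟨ +-congˡ (-‿cong (*-congˡ u≈v)) ⟨
      y + c * u + - (c * u)  ≈⟨ solve 2 (λ x w → x :+ w :- w := x) refl y (c * u) ⟩
      y                      ∎

  -- To prove x ≈ y from equations uᵢ ≈ vᵢ it suffices that
  -- x − y = Σ cᵢ (uᵢ − vᵢ) is a ring identity.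
  linear₁ : ∀ {x y u₁ v₁} c₁ → u₁ ≈ v₁ → x + c₁ * v₁ ≈ y + c₁ * u₁ → x ≈ y
  linear₁ = move

  linear₂ : ∀ {x y u₁ v₁ u₂ v₂} c₁ → u₁ ≈ v₁ → ∀ c₂ → u₂ ≈ v₂ →
            x + c₁ * v₁ + c₂ * v₂ ≈ y + c₁ * u₁ + c₂ * u₂ → x ≈ y
  linear₂ c₁ e₁ c₂ e₂ eq = move c₁ e₁ (move c₂ e₂ eq)

  linear₃ : ∀ {x y u₁ v₁ u₂ v₂ u₃ v₃} c₁ → u₁ ≈ v₁ → ∀ c₂ → u₂ ≈ v₂ → ∀ c₃ → u₃ ≈ v₃ →
            x + c₁ * v₁ + c₂ * v₂ + c₃ * v₃ ≈ y + c₁ * u₁ + c₂ * u₂ + c₃ * u₃ → x ≈ y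
  linear₃ c₁ e₁ c₂ e₂ c₃ e₃ eq = move c₁ e₁ (move c₂ e₂ (move c₃ e₃ eq))

  linear₄ : ∀ {x y u₁ v₁ u₂ v₂ u₃ v₃ u₄ v₄} c₁ → u₁ ≈ v₁ → ∀ c₂ → u₂ ≈ v₂ →
            ∀ c₃ → u₃ ≈ v₃ → ∀ c₄ → u₄ ≈ v₄ →
            x + c₁ * v₁ + c₂ * v₂ + c₃ * v₃ + c₄ * v₄ ≈
            y + c₁ * u₁ + c₂ * u₂ + c₃ * u₃ + c₄ * u₄ → x ≈ y
  linear₄ c₁ e₁ c₂ e₂ c₃ e₃ c₄ e₄ eq = move c₁ e₁ (move c₂ e₂ (move c₃ e₃ (move c₄ e₄ eq)))

-- Doubling and comparison of natural numbers

-- Recursion by two successors lets a product of length `double (suc k)` unfold to two new factors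
-- by computation.
double : ℕ → ℕ
double zero    = zero
double (suc n) = suc (suc (double n))

≤⇒≤ᵇ≡true : ∀ {m n} → m ≤ n → (m ≤ᵇ n) ≡ true
≤⇒≤ᵇ≡true {m} {n} m≤n with m ≤ᵇ n | ℕ.≤⇒≤ᵇ m≤n
... | true | _ = ≡.refl

≰⇒≤ᵇ≡false : ∀ {m n} → ¬ (m ≤ n) → (m ≤ᵇ n) ≡ false
≰⇒≤ᵇ≡false {m} {n} m≰n with m ≤ᵇ n | ℕ.≤ᵇ⇒≤ m n
... | true  | f = ⊥-elim (m≰n (f _))
... | false | _ = ≡.refl

double≡+ : ∀ k → double k ≡ k ℕ.+ k
double≡+ zero    = ≡.refl
double≡+ (suc k) = ≡.cong suc (≡.trans (≡.cong suc (double≡+ k)) (≡.sym (ℕ.+-suc k k)))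

double≡2* : ∀ k → double k ≡ 2 ℕ.* k
double≡2* k = ≡.trans (double≡+ k) (≡.cong (k ℕ.+_) (≡.sym (ℕ.+-identityʳ k)))

double-mono : ∀ {m n} → m ≤ n → double m ≤ double n
double-mono z≤n       = z≤n
double-mono (s≤s m≤n) = s≤s (s≤s (double-mono m≤n))

-- q-series over a commutative ring

module QSeries {c ℓ} (R : CommutativeRing c ℓ) where
  open CommutativeRing R
  open RawSemiringDefinitions (Semiring.rawSemiring semiring) using (_^_; sum; product)
  open Exp semiring using (^-homo-*; ^-assocʳ; ^-congˡ)
  open CommutativeExp commutativeSemiring using (^-distrib-*)
  open ℤ-Solver R
  open SetoidReasoning setoid

  -- Splits off the last term, whereas `sum` peels the first one; telescoping is an induction on the
  -- upper bound.
  ∑< : ℕ → (ℕ → Carrier) → Carrier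
  ∑< zero    f = 0#
  ∑< (suc n) f = ∑< n f + f n

  ∑<-cong : ∀ n {f g : ℕ → Carrier} → (∀ k → f k ≈ g k) → ∑< n f ≈ ∑< n g
  ∑<-cong zero    f≈g = refl
  ∑<-cong (suc n) f≈g = +-cong (∑<-cong n f≈g) (f≈g n)

  sum-∑< : ∀ n (f : ℕ → Carrier) → sum {n} (λ i → f (toℕ i)) ≈ ∑< n f
  sum-∑< zero    f = refl
  sum-∑< (suc n) f = trans (+-congˡ (sum-∑< n (λ k → f (suc k)))) (∑<-head n f)
    where
    ∑<-head : ∀ n (f : ℕ → Carrier) → f 0 + ∑< n (λ k → f (suc k)) ≈ ∑< (suc n) f
    ∑<-head zero    f = +-comm (f 0) 0#
    ∑<-head (suc n) f = trans (sym (+-assoc _ _ _)) (+-congʳ (∑<-head n f))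

  pochhammer : Carrier → Carrier → ℕ → Carrier
  pochhammer a b zero    = 1#
  pochhammer a b (suc k) = pochhammer a b k * (1# + - (a * b ^ k))

  product-pochhammer : ∀ a b n →
    product {n} (λ i → 1# + - (a * b ^ toℕ i)) ≈ pochhammer a b n
  product-pochhammer a b n = product-∏< n
    where
    f : ℕ → Carrier
    f k = 1# + - (a * b ^ k)
    ∏< : ℕ → (ℕ → Carrier) → Carrier
    ∏< zero    f = 1#
    ∏< (suc n) f = ∏< n f * f n
    ∏<-head : ∀ n (f : ℕ → Carrier) → f 0 * ∏< n (λ k → f (suc k)) ≈ ∏< (suc n) f
    ∏<-head zero    f = *-comm (f 0) 1#
    ∏<-head (suc n) f = trans (sym (*-assoc _ _ _)) (*-congʳ (∏<-head n f))
    to-∏< : ∀ n (f : ℕ → Carrier) → product {n} (λ i → f (toℕ i)) ≈ ∏< n f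
    to-∏< zero    f = refl
    to-∏< (suc n) f = trans (*-congˡ (to-∏< n (λ k → f (suc k)))) (∏<-head n f)
    ∏<-pochhammer : ∀ n → ∏< n f ≈ pochhammer a b n
    ∏<-pochhammer zero    = refl
    ∏<-pochhammer (suc n) = *-congʳ (∏<-pochhammer n)
    product-∏< : ∀ n → product {n} (λ i → f (toℕ i)) ≈ pochhammer a b n
    product-∏< n = trans (to-∏< n f) (∏<-pochhammer n)

  -- shift f k s is f (k − s), read as 0 when s > k.
  shift : (ℕ → Carrier) → ℕ → ℕ → Carrier
  shift f k       zero    = f k
  shift f zero    (suc s) = 0#
  shift f (suc k) (suc s) = shift f k s

  -- The inverses of 1 - b^{i+1} are supplied as data, so that the same development serves for the
  -- bases q² and q⁴.
  module QFactorial
    (b : Carrier) (w : ℕ → Carrier)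
    (w-inverse : ∀ i → (1# + - (b ^ suc i)) * w i ≈ 1#)
    where

    -- π k = (b;b)_k and e k = 1/(b;b)_k.
    π e : ℕ → Carrier
    π = pochhammer b b
    e zero    = 1#
    e (suc k) = w k * e k

    π-inverse : ∀ k → π k * e k ≈ 1#
    π-inverse zero    = *-identityˡ 1#
    π-inverse (suc k) = linear₂ ((1# + - (b ^ suc k)) * w k) (π-inverse k) 1# (w-inverse k)
      (solve 4 (λ P u w e →
        P :* u :* (w :* e) :+ u :* w :* :1 :+ :1 :* :1
          := :1 :+ u :* w :* (P :* e) :+ :1 :* (u :* w))
        refl (π k) (1# + - (b ^ suc k)) (w k) (e k))

    e-pred : ∀ k → e k ≈ (1# + - (b * b ^ k)) * e (suc k)
    e-pred k = linear₁ (- e k) (w-inverse k)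
      (solve 3 (λ e u w → e :+ (:- e) :* :1 := u :* (w :* e) :+ (:- e) :* (u :* w))
        refl (e k) (1# + - (b ^ suc k)) (w k))

    π-from : ∀ j m → pochhammer (b ^ suc j) b m * π j ≈ π (j ℕ.+ m)
    π-from j zero    rewrite ℕ.+-identityʳ j = *-identityˡ _
    π-from j (suc m) rewrite ℕ.+-suc j m = begin
      pochhammer (b ^ suc j) b m * (1# + - (b * b ^ j * b ^ m)) * π j
        ≈⟨ solve 3 (λ p u v → p :* u :* v := p :* v :* u) refl _ _ _ ⟩
      pochhammer (b ^ suc j) b m * π j * (1# + - (b * b ^ j * b ^ m))
        ≈⟨ *-cong (π-from j m)
             (+-congˡ (-‿cong (trans (*-assoc _ _ _) (*-congˡ (sym (^-homo-* b j m)))))) ⟩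
      π (j ℕ.+ m) * (1# + - (b * b ^ (j ℕ.+ m))) ∎

  module QWatson
    (b b̄ : Carrier) (bb̄≈1 : b * b̄ ≈ 1#)
    (w : ℕ → Carrier) (w-inverse : ∀ i → (1# + - (b ^ suc i)) * w i ≈ 1#)
    where

    open QFactorial b w w-inverse public

    pow-double : ∀ k → b ^ double k ≈ b ^ k * b ^ k
    pow-double zero    = sym (*-identityˡ 1#)
    pow-double (suc k) = trans (*-congˡ (*-congˡ (pow-double k)))
      (solve 2 (λ b x → b :* (b :* (x :* x)) := (b :* x) :* (b :* x)) refl b (b ^ k))

    poch : Carrier → ℕ → Carrier
    poch a = pochhammer a b

    poch-cong : ∀ {a a′} k → a ≈ a′ → poch a k ≈ poch a′ k
    poch-cong zero    a≈a′ = refl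
    poch-cong (suc k) a≈a′ =
      *-cong (poch-cong k a≈a′) (+-congˡ (-‿cong (*-congʳ a≈a′)))

    poch-head : ∀ a k → poch a (suc k) ≈ (1# + - a) * poch (b * a) k
    poch-head a zero    = solve 1 (λ a → :1 :* (:1 :- a :* :1) := (:1 :- a) :* :1) refl a
    poch-head a (suc k) = linear₁ (1# + - (a * (b * b ^ k))) (poch-head a k)
      (solve 5 (λ a b x P Q →
         P :* (:1 :- a :* (b :* x)) :+ (:1 :- a :* (b :* x)) :* ((:1 :- a) :* Q)
           := (:1 :- a) :* (Q :* (:1 :- (b :* a) :* x)) :+ (:1 :- a :* (b :* x)) :* P)
        refl a b (b ^ k) (poch a (suc k)) (poch (b * a) k))

    -- E k = 1/(b²;b²)_k.
    E : ℕ → Carrier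
    E zero    = 1#
    E (suc k) = w (suc (double k)) * E k

    π-double : ∀ k → π (double (suc k)) ≈
      π (double k) * (1# + - (b * (b ^ k * b ^ k))) * (1# + - (b * (b * (b ^ k * b ^ k))))
    π-double k = *-cong (*-congˡ (+-congˡ (-‿cong (*-congˡ (pow-double k)))))
                        (+-congˡ (-‿cong (*-congˡ (*-congˡ (pow-double k)))))

    E-pred : ∀ k → E k ≈ (1# + - (b ^ suc k * b ^ suc k)) * E (suc k)
    E-pred k = linear₂ (- E k) (w-inverse (suc (double k)))
                       (- E (suc k)) (pow-double (suc k))
      (solve 4 (λ E w u v →
         E :+ (:- E) :* :1 :+ (:- (w :* E)) :* v
           := (:1 :- v) :* (w :* E) :+ (:- E) :* ((:1 :- u) :* w) :+ (:- (w :* E)) :* u)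
        refl (E k) (w (suc (double k))) (b ^ double (suc k)) (b ^ suc k * b ^ suc k))

    -- d k s is the q-binomial coefficient [2k choose k+s] in base b.
    d : ℕ → ℕ → Carrier
    d k s = π (double k) * e (k ℕ.+ s) * shift e k s

    -- f s−1 for a function that is even in s.
    pred-even : (ℕ → Carrier) → ℕ → Carrier
    pred-even f zero    = f 1
    pred-even f (suc t) = f t

    -- The relation e(k-s) = (1 - b^{k+1-s}) e(k+1-s), scaled by b^s to remove the negative
    -- exponent. It persists for all s: at s = k + 1 the factor b^s - b^{k+1} vanishes, and beyond
    -- that both shifted values are 0.
    shift-e : ∀ k s → shift e k s * b ^ s ≈ (b ^ s + - (b * b ^ k)) * shift e (suc k) s
    shift-e k       zero    = trans (*-identityʳ _) (e-pred k)
    shift-e zero    (suc zero)    =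
      solve 1 (λ b → :0 :* (b :* :1) := (b :* :1 :- b :* :1) :* :1) refl b
    shift-e zero    (suc (suc s)) =
      solve 2 (λ x b → :0 :* x := (x :- b :* :1) :* :0) refl (b ^ (suc (suc s))) b
    shift-e (suc k) (suc s) = linear₁ b (shift-e k s)
      (solve 5 (λ b z x U V →
        U :* (b :* z) :+ b :* ((z :- b :* x) :* V)
          := (b :* z :- b :* (b :* x)) :* V :+ b :* (U :* z))
        refl b (b ^ s) (b ^ k) (shift e k s) (shift e (suc k) s))

    -- The two forms of the q-Pascal rule applied in succession, scaled by b^s; at s = 0 the value
    -- d(k,-1) is d(k,1) by symmetry. In the proof all reciprocals are reduced to e(k+1+s) and
    -- e(k+1-s), after which an identity in powers of b remains.
    d-recurrence : ∀ k s →
      b ^ s * d (suc k) s ≈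
      b ^ s * (1# + b * (b ^ k * b ^ k)) * d k s
        + b * b ^ k * (pred-even (d k) s + b ^ s * b ^ s * d k (suc s))
    d-recurrence k zero rewrite ℕ.+-suc k 0 | ℕ.+-identityʳ k =
      linear₄ (- ((1# + 1#) * x * Π * e₂)) (shift-e k 1)
              (- ((1# + b * (x * x)) * Π * e₁)) (e-pred k)
              (- (((1# + b * (x * x)) * (1# + - (b * x)) + (1# + 1#) * x * (b + - (b * x))) * Π * e₂))
                (e-pred k)
              (e₂ * e₂) (π-double k)
        (solve 7 (λ b x Π e₁ e₂ V Π₂ →
          :1 :* (Π₂ :* e₂ :* e₂)
            :+ (:- ((:1 :+ :1) :* x :* Π :* e₂)) :* ((b :* :1 :- b :* x) :* e₁)
            :+ (:- ((:1 :+ b :* (x :* x)) :* Π :* e₁)) :* ((:1 :- b :* x) :* e₂)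
            :+ (:- (((:1 :+ b :* (x :* x)) :* (:1 :- b :* x) :+ (:1 :+ :1) :* x :* (b :- b :* x)) :* Π :* e₂))
                :* ((:1 :- b :* x) :* e₂)
            :+ e₂ :* e₂ :* (Π :* (:1 :- b :* (x :* x)) :* (:1 :- b :* (b :* (x :* x))))
          := :1 :* (:1 :+ b :* (x :* x)) :* (Π :* e₁ :* e₁)
              :+ b :* x :* (Π :* e₂ :* V :+ :1 :* :1 :* (Π :* e₂ :* V))
            :+ (:- ((:1 :+ :1) :* x :* Π :* e₂)) :* (V :* (b :* :1))
            :+ (:- ((:1 :+ b :* (x :* x)) :* Π :* e₁)) :* e₁
            :+ (:- (((:1 :+ b :* (x :* x)) :* (:1 :- b :* x) :+ (:1 :+ :1) :* x :* (b :- b :* x)) :* Π :* e₂))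
                :* e₁
            :+ e₂ :* e₂ :* Π₂)
          refl b x Π e₁ e₂ V (π (double (suc k))))
      where
      x Π e₁ e₂ V : Carrier
      x  = b ^ k
      Π  = π (double k)
      e₁ = e k
      e₂ = e (suc k)
      V  = shift e k 1
    d-recurrence k (suc t) rewrite ℕ.+-suc k (suc t) | ℕ.+-suc k t =
      trans (*-congˡ (*-congʳ (*-congʳ (π-double k))))
        (linear₄ (- (b * x * Π * U)) e₀-pred
                 (- ((b * z * (1# + b * (x * x)) * V + b * x * U * (1# + - (b * (x * z)))) * Π)) e₁-pred
                 (- (b * x * z * Π * e₂)) (shift-e k (suc (suc t)))
                 (- (((1# + b * (x * x)) * (1# + - (b * (b * (x * z)))) + x * (b * (b * z) + - (b * x)))
                    * Π * e₂)) (shift-e k (suc t))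
          (solve 10 (λ b x z Π e₀ e₁ e₂ U V W →
            b :* z :* (Π :* (:1 :- b :* (x :* x)) :* (:1 :- b :* (b :* (x :* x))) :* e₂ :* U)
              :+ (:- (b :* x :* Π :* U)) :* ((:1 :- b :* (x :* z)) :* e₁)
              :+ (:- ((b :* z :* (:1 :+ b :* (x :* x)) :* V :+ b :* x :* U :* (:1 :- b :* (x :* z))) :* Π))
                  :* ((:1 :- b :* (b :* (x :* z))) :* e₂)
              :+ (:- (b :* x :* z :* Π :* e₂)) :* ((b :* (b :* z) :- b :* x) :* V)
              :+ (:- (((:1 :+ b :* (x :* x)) :* (:1 :- b :* (b :* (x :* z))) :+ x :* (b :* (b :* z) :- b :* x))
                    :* Π :* e₂)) :* ((b :* z :- b :* x) :* U)
            := b :* z :* (:1 :+ b :* (x :* x)) :* (Π :* e₁ :* V)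
                :+ b :* x :* (Π :* e₀ :* U :+ b :* z :* (b :* z) :* (Π :* e₂ :* W))
              :+ (:- (b :* x :* Π :* U)) :* e₀
              :+ (:- ((b :* z :* (:1 :+ b :* (x :* x)) :* V :+ b :* x :* U :* (:1 :- b :* (x :* z))) :* Π))
                  :* e₁
              :+ (:- (b :* x :* z :* Π :* e₂)) :* (W :* (b :* (b :* z)))
              :+ (:- (((:1 :+ b :* (x :* x)) :* (:1 :- b :* (b :* (x :* z))) :+ x :* (b :* (b :* z) :- b :* x))
                    :* Π :* e₂)) :* (V :* (b :* z)))
            refl b x z Π e₀ e₁ e₂ U V W))
      where
      x z Π e₀ e₁ e₂ U V W : Carrier
      x  = b ^ k
      z  = b ^ t
      Π  = π (double k)
      e₀ = e (k ℕ.+ t)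
      e₁ = e (suc (k ℕ.+ t))
      e₂ = e (suc (suc (k ℕ.+ t)))
      U  = shift e k t
      V  = shift e k (suc t)
      W  = shift e k (suc (suc t))
      e₀-pred : e₀ ≈ (1# + - (b * (x * z))) * e₁
      e₀-pred = trans (e-pred (k ℕ.+ t)) (*-congʳ (+-congˡ (-‿cong (*-congˡ (^-homo-* b k t)))))
      e₁-pred : e₁ ≈ (1# + - (b * (b * (x * z)))) * e₂
      e₁-pred = trans (e-pred (suc (k ℕ.+ t)))
        (*-congʳ (+-congˡ (-‿cong (*-congˡ (*-congˡ (^-homo-* b k t))))))

    -- Contiguity in the parameter y

    -- ȳ stands for 1/y; at y = bⁿ this is (b⁻ⁿ;b)_k (bⁿ⁺¹;b)_k.
    P : Carrier → Carrier → ℕ → Carrier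
    P y ȳ k = poch ȳ k * poch (b * y) k

    P-cong : ∀ {y y′ ȳ ȳ′} k → y ≈ y′ → ȳ ≈ ȳ′ → P y ȳ k ≈ P y′ ȳ′ k
    P-cong k y≈y′ ȳ≈ȳ′ = *-cong (poch-cong k ȳ≈ȳ′) (poch-cong k (*-congˡ y≈y′))

    module _ (y ȳ : Carrier) (yȳ≈1 : y * ȳ ≈ 1#) where

      private
        b[b̄ȳ]≈ȳ : b * (b̄ * ȳ) ≈ ȳ
        b[b̄ȳ]≈ȳ = linear₁ ȳ bb̄≈1
          (solve 3 (λ b b̄ ȳ → b :* (b̄ :* ȳ) :+ ȳ :* :1 := ȳ :+ ȳ :* (b :* b̄)) refl b b̄ ȳ)

        b[b̄y]≈y : b * (b̄ * y) ≈ y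
        b[b̄y]≈y = linear₁ y bb̄≈1
          (solve 3 (λ b b̄ y → b :* (b̄ :* y) :+ y :* :1 := y :+ y :* (b :* b̄)) refl b b̄ y)

      -- (1/(by);b)_{m+1} is (1/y;b)_m with the factor 1 - 1/(by) put in front, and (b²y;b)_{m+1} is
      -- (by;b)_{m+2} with 1 - by removed. The quotient of these two factors is -1/(by), so no
      -- division by 1 - by is required.
      P-up : ∀ m → P (b * y) (b̄ * ȳ) (suc m) ≈
        - (b̄ * ȳ) * P y ȳ m * ((1# + - (b * y * b ^ m)) * (1# + - (b * y * (b * b ^ m))))
      P-up m = begin
        poch (b̄ * ȳ) (suc m) * poch (b * (b * y)) (suc m)
          ≈⟨ *-congʳ (trans (poch-head (b̄ * ȳ) m) (*-congˡ (poch-cong m b[b̄ȳ]≈ȳ))) ⟩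
        (1# + - (b̄ * ȳ)) * poch ȳ m * poch (b * (b * y)) (suc m)
          ≈⟨ linear₂ (poch ȳ m * D) b̄by-one
               (b̄ * ȳ * poch ȳ m) (poch-head (b * y) (suc m))
             (solve 8 (λ b b̄ y ȳ A B D X →
               (:1 :- b̄ :* ȳ) :* A :* D
                 :+ A :* D :* (b̄ :* ȳ :* (b :* y))
                 :+ b̄ :* ȳ :* A :* ((:1 :- b :* y) :* D)
               := (:- (b̄ :* ȳ)) :* (A :* B) :* ((:1 :- b :* y :* X) :* (:1 :- b :* y :* (b :* X)))
                 :+ A :* D :* :1
                 :+ b̄ :* ȳ :* A :* (B :* (:1 :- b :* y :* X) :* (:1 :- b :* y :* (b :* X))))
               refl b b̄ y ȳ (poch ȳ m) (poch (b * y) m) D (b ^ m)) ⟩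
        - (b̄ * ȳ) * P y ȳ m * ((1# + - (b * y * b ^ m)) * (1# + - (b * y * (b * b ^ m))))
          ∎
        where
        D = poch (b * (b * y)) (suc m)
        b̄by-one : 1# ≈ b̄ * ȳ * (b * y)
        b̄by-one = linear₂ (- 1#) bb̄≈1 (- (b * b̄)) yȳ≈1
          (solve 4 (λ b b̄ y ȳ →
            :1 :+ (:- :1) :* :1 :+ (:- (b :* b̄)) :* :1
              := b̄ :* ȳ :* (b :* y) :+ (:- :1) :* (b :* b̄) :+ (:- (b :* b̄)) :* (y :* ȳ))
            refl b b̄ y ȳ)

      -- The mirror image of `P-up`: here the first product loses 1 - 1/y and the second gains 1 -
      -- y, with quotient -y.
      P-down : ∀ m → P (b̄ * y) (b * ȳ) (suc m) ≈
        - y * P y ȳ m * ((1# + - (ȳ * b ^ m)) * (1# + - (ȳ * (b * b ^ m))))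
      P-down m = begin
        poch (b * ȳ) (suc m) * poch (b * (b̄ * y)) (suc m)
          ≈⟨ *-congˡ (trans (poch-cong (suc m) b[b̄y]≈y) (poch-head y m)) ⟩
        poch (b * ȳ) (suc m) * ((1# + - y) * poch (b * y) m)
          ≈⟨ linear₂ (- (D * poch (b * y) m)) yȳ≈1
               (y * poch (b * y) m) (poch-head ȳ (suc m))
             (solve 7 (λ b y ȳ A B D X →
               D :* ((:1 :- y) :* B)
                 :+ (:- (D :* B)) :* :1
                 :+ y :* B :* ((:1 :- ȳ) :* D)
               := (:- y) :* (A :* B) :* ((:1 :- ȳ :* X) :* (:1 :- ȳ :* (b :* X)))
                 :+ (:- (D :* B)) :* (y :* ȳ)
                 :+ y :* B :* (A :* (:1 :- ȳ :* X) :* (:1 :- ȳ :* (b :* X))))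
               refl b y ȳ (poch ȳ m) (poch (b * y) m) D (b ^ m)) ⟩
        - y * P y ȳ m * ((1# + - (ȳ * b ^ m)) * (1# + - (ȳ * (b * b ^ m))))
          ∎
        where D = poch (b * ȳ) (suc m)

    H : Carrier → Carrier → ℕ → Carrier
    H y ȳ k = P y ȳ k * (E k * E k)

    H-pred : Carrier → Carrier → ℕ → Carrier
    H-pred y ȳ zero    = 0#
    H-pred y ȳ (suc k) = H y ȳ k

    -- At k = m + 1 the relations `P-up`, `P-down` and `E-pred` make every term a multiple of
    -- P_m(y)/(b²;b²)²_{m+1}, and a polynomial identity modulo b b̄ = 1 and y ȳ = 1 is left. The
    -- factor 1 + b·b^{2k} is exactly the coefficient of d(k,s) in `d-recurrence`, which is why the
    -- two can be combined.
    contiguity : ∀ y ȳ → y * ȳ ≈ 1# → ∀ k →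
      b ^ k * ((1# + - (b * y * (b * y))) * H (b * y) (b̄ * ȳ) k
               + (1# + - (y * y)) * b * H (b̄ * y) (b * ȳ) k)
        + (1# + - (b * (y * y))) * (H-pred y ȳ k + - ((1# + b * (b ^ k * b ^ k)) * H y ȳ k))
      ≈ 0#
    contiguity y ȳ yȳ≈1 zero = solve 2 (λ b y →
      :1 :* ((:1 :- b :* y :* (b :* y)) :* (:1 :* :1 :* (:1 :* :1))
             :+ (:1 :- y :* y) :* b :* (:1 :* :1 :* (:1 :* :1)))
        :+ (:1 :- b :* (y :* y)) :* (:0 :- (:1 :+ b :* (:1 :* :1)) :* (:1 :* :1 :* (:1 :* :1)))
      := :0) refl b y
    contiguity y ȳ yȳ≈1 (suc m) = begin
      b * X * ((1# + - (b * y * (b * y))) * (P (b * y) (b̄ * ȳ) (suc m) * (E′ * E′))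
               + (1# + - (y * y)) * b * (P (b̄ * y) (b * ȳ) (suc m) * (E′ * E′)))
        + (1# + - (b * (y * y)))
          * (P y ȳ m * (E m * E m)
              + - ((1# + b * (b * X * (b * X))) * (P y ȳ (suc m) * (E′ * E′))))
        ≈⟨ +-cong
            (*-congˡ (+-cong (*-congˡ (*-congʳ (P-up y ȳ yȳ≈1 m)))
                             (*-congˡ (*-congʳ (P-down y ȳ yȳ≈1 m)))))
            (*-congˡ (+-congʳ (*-congˡ (*-cong (E-pred m) (E-pred m))))) ⟩
      b * X * ((1# + - (b * y * (b * y)))
                 * (- (b̄ * ȳ) * P y ȳ m * ((1# + - (b * y * X)) * (1# + - (b * y * (b * X)))) * (E′ * E′))
               + (1# + - (y * y)) * b
                 * (- y * P y ȳ m * ((1# + - (ȳ * X)) * (1# + - (ȳ * (b * X)))) * (E′ * E′)))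
        + (1# + - (b * (y * y)))
          * (P y ȳ m * ((1# + - (b * X * (b * X))) * E′ * ((1# + - (b * X * (b * X))) * E′))
              + - ((1# + b * (b * X * (b * X))) * (P y ȳ (suc m) * (E′ * E′))))
        ≈⟨ linear₂
            (- (X * (1# + - (b * y * (b * y))) * ȳ * F) * G) bb̄≈1
            ((X * (b * b) * y * F + X * (b * X * (1# + b) + - (b * b * b * y * (X * X)))
              + - (b * b * X * ((1# + - (y * y)) * (- ((1# + b) * X) + b * (X * X) * ȳ)
                                + - (b * (X * X) * y)))
              + - ((1# + b * b * b * (X * X)) * ((1# + - (b * (y * y))) * (b * (X * X)) + b * X * y)))
             * G) yȳ≈1
          (solve 8 (λ b b̄ y ȳ X A B E →
            let F = (:1 :- b :* y :* X) :* (:1 :- b :* y :* (b :* X))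
                G = A :* B :* (E :* E)
                c₁ = (:- (X :* (:1 :- b :* y :* (b :* y)) :* ȳ :* F)) :* G
                c₂ = (X :* (b :* b) :* y :* F :+ X :* (b :* X :* (:1 :+ b) :- b :* b :* b :* y :* (X :* X))
                      :+ (:- (b :* b :* X :* ((:1 :- y :* y) :* ((:- ((:1 :+ b) :* X)) :+ b :* (X :* X) :* ȳ)
                                :+ (:- (b :* (X :* X) :* y)))))
                      :+ (:- ((:1 :+ b :* b :* b :* (X :* X))
                              :* ((:1 :- b :* (y :* y)) :* (b :* (X :* X)) :+ b :* X :* y))))
                     :* G
            in
            b :* X :* ((:1 :- b :* y :* (b :* y))
                         :* ((:- (b̄ :* ȳ)) :* (A :* B) :* ((:1 :- b :* y :* X) :* (:1 :- b :* y :* (b :* X))) :* (E :* E))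
                       :+ (:1 :- y :* y) :* b
                         :* ((:- y) :* (A :* B) :* ((:1 :- ȳ :* X) :* (:1 :- ȳ :* (b :* X))) :* (E :* E)))
              :+ (:1 :- b :* (y :* y))
                :* (A :* B :* ((:1 :- b :* X :* (b :* X)) :* E :* ((:1 :- b :* X :* (b :* X)) :* E))
                    :- (:1 :+ b :* (b :* X :* (b :* X)))
                       :* (A :* (:1 :- ȳ :* X) :* (B :* (:1 :- b :* y :* X)) :* (E :* E)))
              :+ c₁ :* :1 :+ c₂ :* :1
            := :0 :+ c₁ :* (b :* b̄) :+ c₂ :* (y :* ȳ))
            refl b b̄ y ȳ X (poch ȳ m) (poch (b * y) m) E′) ⟩
      0# ∎
      where
      X E′ F G : Carrier
      X  = b ^ m
      E′ = E (suc m)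
      F  = (1# + - (b * y * X)) * (1# + - (b * y * (b * X)))
      G  = poch ȳ m * poch (b * y) m * (E′ * E′)

    -- The sum and its termination at y = bⁿ

    S Sₚ : Carrier → Carrier → ℕ → ℕ → Carrier
    S  y ȳ N s = ∑< N (λ k → b ^ k * H y ȳ k * d k s)
    Sₚ y ȳ N s = ∑< N (λ k → b ^ k * H y ȳ k * pred-even (d k) s)

    -- The contiguity relation and the recurrence of d make the sum telescope.
    S-telescoped : ∀ y ȳ → y * ȳ ≈ 1# → ∀ s N →
      b ^ s * ((1# + - (b * y * (b * y))) * S (b * y) (b̄ * ȳ) N s
               + (1# + - (y * y)) * b * S (b̄ * y) (b * ȳ) N s)
        + (1# + - (b * (y * y))) * b * (Sₚ y ȳ N s + b ^ s * b ^ s * S y ȳ N (suc s))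
      ≈ (1# + - (b * (y * y))) * b ^ s * H-pred y ȳ N * d N s
    S-telescoped y ȳ yȳ≈1 s zero = solve 6 (λ z α β κ b d →
      z :* (α :* :0 :+ β :* b :* :0) :+ κ :* b :* (:0 :+ z :* z :* :0) := κ :* z :* :0 :* d) refl
      (b ^ s) (1# + - (b * y * (b * y))) (1# + - (y * y)) (1# + - (b * (y * y))) b (d 0 s)
    S-telescoped y ȳ yȳ≈1 s (suc N) =
      linear₃ 1# (S-telescoped y ȳ yȳ≈1 s N)
              (b ^ s * d N s) (contiguity y ȳ yȳ≈1 N)
              (- (κ * H y ȳ N)) (d-recurrence N s)
        (solve 18 (λ z x b α β κ A₁ A₂ A₃ A₄ H₁ H₂ H₀ Hₚ d₀ dₚ d₊ d₁ →
          z :* (α :* (A₁ :+ x :* H₁ :* d₀) :+ β :* b :* (A₂ :+ x :* H₂ :* d₀))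
            :+ κ :* b :* (A₃ :+ x :* H₀ :* dₚ :+ z :* z :* (A₄ :+ x :* H₀ :* d₊))
            :+ :1 :* (κ :* z :* Hₚ :* d₀)
            :+ z :* d₀ :* :0
            :+ (:- (κ :* H₀)) :* (z :* (:1 :+ b :* (x :* x)) :* d₀ :+ b :* x :* (dₚ :+ z :* z :* d₊))
          := κ :* z :* H₀ :* d₁
            :+ :1 :* (z :* (α :* A₁ :+ β :* b :* A₂) :+ κ :* b :* (A₃ :+ z :* z :* A₄))
            :+ z :* d₀ :* (x :* (α :* H₁ :+ β :* b :* H₂) :+ κ :* (Hₚ :- (:1 :+ b :* (x :* x)) :* H₀))
            :+ (:- (κ :* H₀)) :* (z :* d₁))
          refl (b ^ s) (b ^ N) b α β κ
          (S (b * y) (b̄ * ȳ) N s) (S (b̄ * y) (b * ȳ) N s) (Sₚ y ȳ N s) (S y ȳ N (suc s))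
          (H (b * y) (b̄ * ȳ) N) (H (b̄ * y) (b * ȳ) N) (H y ȳ N) (H-pred y ȳ N)
          (d N s) (pred-even (d N) s) (d N (suc s)) (d (suc N) s))
      where
      α β κ : Carrier
      α = 1# + - (b * y * (b * y))
      β = 1# + - (y * y)
      κ = 1# + - (b * (y * y))

    pow-inverse : ∀ n → b ^ n * b̄ ^ n ≈ 1#
    pow-inverse zero    = *-identityˡ 1#
    pow-inverse (suc n) = linear₂ (b ^ n * b̄ ^ n) bb̄≈1 1# (pow-inverse n)
      (solve 4 (λ b b̄ x x̄ →
        b :* x :* (b̄ :* x̄) :+ x :* x̄ :* :1 :+ :1 :* :1
          := :1 :+ x :* x̄ :* (b :* b̄) :+ :1 :* (x :* x̄)) refl b b̄ (b ^ n) (b̄ ^ n))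

    -- The factor of index n is 1 - b⁻ⁿ bⁿ.
    poch-vanish : ∀ n j → poch (b̄ ^ n) (suc (j ℕ.+ n)) ≈ 0#
    poch-vanish n zero    = linear₁ (- poch (b̄ ^ n) n) (pow-inverse n)
      (solve 3 (λ p x x̄ → p :* (:1 :- x̄ :* x) :+ (:- p) :* :1 := :0 :+ (:- p) :* (x :* x̄))
        refl (poch (b̄ ^ n) n) (b ^ n) (b̄ ^ n))
    poch-vanish n (suc j) = trans (*-congʳ (poch-vanish n j)) (zeroˡ _)

    H-vanish : ∀ n j → H (b ^ n) (b̄ ^ n) (suc (j ℕ.+ n)) ≈ 0#
    H-vanish n j = trans (*-congʳ (*-congʳ (poch-vanish n j)))
      (solve 2 (λ u v → :0 :* u :* v := :0) refl _ _)

    -- The terms with k > n vanish, so the sum may be taken up to any N > n.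
    S-stable : ∀ n j (f : ℕ → Carrier) →
      ∑< (suc (j ℕ.+ n)) (λ k → b ^ k * H (b ^ n) (b̄ ^ n) k * f k) ≈
      ∑< (suc n) (λ k → b ^ k * H (b ^ n) (b̄ ^ n) k * f k)
    S-stable n zero    f = refl
    S-stable n (suc j) f = begin
      ∑< (suc (j ℕ.+ n)) t + x * H (b ^ n) (b̄ ^ n) (suc (j ℕ.+ n)) * f (suc (j ℕ.+ n))
        ≈⟨ +-congˡ (*-congʳ (*-congˡ (H-vanish n j))) ⟩
      ∑< (suc (j ℕ.+ n)) t + x * 0# * f (suc (j ℕ.+ n))
        ≈⟨ solve 3 (λ a x f → a :+ x :* :0 :* f := a) refl _ _ _ ⟩
      ∑< (suc (j ℕ.+ n)) t
        ≈⟨ S-stable n j f ⟩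
      ∑< (suc n) t ∎
      where
      t : ℕ → Carrier
      t k = b ^ k * H (b ^ n) (b̄ ^ n) k * f k
      x = b ^ suc (j ℕ.+ n)

    S-cong : ∀ {y y′ ȳ ȳ′} N s → y ≈ y′ → ȳ ≈ ȳ′ → S y ȳ N s ≈ S y′ ȳ′ N s
    S-cong N s y≈ ȳ≈ = ∑<-cong N (λ k → *-congʳ (*-congˡ (*-congʳ (P-cong k y≈ ȳ≈))))

    -- The three-term recurrence and its uniqueness

    -- The recurrence is scaled by b^s. Its instance at n = 0 is a separate field because the term
    -- of index -1 drops out: its coefficient 1 - y² is 0 at y = 1.
    record Recurrence (F : ℕ → ℕ → Carrier) : Set (c ⊔ ℓ) where
      field
        first : ∀ s →
          b ^ s * ((1# + - (b * b)) * F 1 s)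
            + (1# + - b) * b * (pred-even (F 0) s + b ^ s * b ^ s * F 0 (suc s)) ≈ 0#
        next : ∀ n s → let y = b ^ suc n in
          b ^ s * ((1# + - (b * y * (b * y))) * F (suc (suc n)) s
                   + (1# + - (y * y)) * b * F n s)
            + (1# + - (b * (y * y))) * b
              * (pred-even (F (suc n)) s + b ^ s * b ^ s * F (suc n) (suc s)) ≈ 0#

    pred-even-cong : ∀ {f g : ℕ → Carrier} → (∀ s → f s ≈ g s) →
                     ∀ s → pred-even f s ≈ pred-even g s
    pred-even-cong f≈g zero    = f≈g 1
    pred-even-cong f≈g (suc s) = f≈g s

    cancel-unit : ∀ {u ū x y} → u * ū ≈ 1# → u * x ≈ u * y → x ≈ y
    cancel-unit {u} {ū} {x} {y} uū≈1 ux≈uy =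
      linear₃ ū ux≈uy (- x) uū≈1 y uū≈1
        (solve 4 (λ u ū x y →
          x :+ ū :* (u :* y) :+ (:- x) :* :1 :+ y :* :1
            := y :+ ū :* (u :* x) :+ (:- x) :* (u :* ū) :+ y :* (u :* ū)) refl u ū x y)

    module _ {F G : ℕ → ℕ → Carrier} (F-rec : Recurrence F) (G-rec : Recurrence G)
             (F₀≈G₀ : ∀ s → F 0 s ≈ G 0 s) where
      private
        module F = Recurrence F-rec
        module G = Recurrence G-rec

        solve-head : ∀ s {u ū f g r r′} → u * ū ≈ 1# → r ≈ r′ →
                     b ^ s * (u * f) + r ≈ 0# → b ^ s * (u * g) + r′ ≈ 0# → f ≈ g
        solve-head s {u} {ū} {f} {g} {r} {r′} uū≈1 r≈r′ ef eg =
          cancel-unit uū≈1 (cancel-unit (pow-inverse s)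
            (linear₃ 1# ef (- 1#) eg (- 1#) r≈r′
              (solve 4 (λ f g r r′ →
                f :+ :1 :* :0 :+ (:- :1) :* :0 :+ (:- :1) :* r′
                  := g :+ :1 :* (f :+ r) :+ (:- :1) :* (g :+ r′) :+ (:- :1) :* r)
                refl (b ^ s * (u * f)) (b ^ s * (u * g)) r r′)))

        1-b²-unit : (1# + - (b * b)) * w 1 ≈ 1#
        1-b²-unit = trans
          (*-congʳ (+-congˡ (-‿cong (*-congˡ (sym (*-identityʳ b)))))) (w-inverse 1)

        y²-unit : ∀ n → let y = b ^ suc n in
                  (1# + - (b * y * (b * y))) * w (suc (double (suc n))) ≈ 1#
        y²-unit n = trans
          (*-congʳ (+-congˡ (-‿cong (sym (pow-double (suc (suc n)))))))
          (w-inverse (suc (double (suc n))))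

      -- The value of index n + 1 enters with the coefficient b^s (1 - b^{2n+2}), a unit, so it is
      -- determined by the values of the two preceding indices at all s.
      unique : ∀ n s → F n s ≈ G n s
      unique zero                s = F₀≈G₀ s
      unique (suc zero)          s = solve-head s 1-b²-unit
        (*-congˡ (+-cong (pred-even-cong (unique 0) s) (*-congˡ (unique 0 (suc s)))))
        (F.first s) (G.first s)
      unique (suc (suc n))       s = solve-head s (y²-unit n)
        (+-cong (*-congˡ (*-congˡ (unique n s)))
          (*-congˡ (+-cong (pred-even-cong (unique (suc n)) s) (*-congˡ (unique (suc n) (suc s))))))
        (trans (rearrange _ _ _ _) (F.next n s)) (trans (rearrange _ _ _ _) (G.next n s))
        where
        rearrange : ∀ z u v r → z * u + (z * v + r) ≈ z * (u + v) + r
        rearrange = solve 4 (λ z u v r → z :* u :+ (z :* v :+ r) := z :* (u :+ v) :+ r) refl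

    Sₙ : ℕ → ℕ → Carrier
    Sₙ n s = S (b ^ n) (b̄ ^ n) (suc n) s

    Sₙ-pred-even : ∀ n s → Sₚ (b ^ n) (b̄ ^ n) (suc n) s ≈ pred-even (Sₙ n) s
    Sₙ-pred-even n zero    = refl
    Sₙ-pred-even n (suc s) = refl

    Sₙ-recurrence : Recurrence Sₙ
    Sₙ-recurrence = record { first = first ; next = next }
      where
      first : ∀ s →
          b ^ s * ((1# + - (b * b)) * Sₙ 1 s)
            + (1# + - b) * b * (pred-even (Sₙ 0) s + b ^ s * b ^ s * Sₙ 0 (suc s)) ≈ 0#
      first s = begin
        z * ((1# + - (b * b)) * Sₙ 1 s) + (1# + - b) * b * (A + z * z * B)
          -- The coefficient 1 - 1·1 is 0, so the sum at y = 1/b, which stands for index -1, may be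
          -- inserted to match the general shape.
          ≈⟨ solve 6 (λ z b X Q A B →
               z :* ((:1 :- b :* b) :* X) :+ (:1 :- b) :* b :* (A :+ z :* z :* B)
                 := z :* ((:1 :- b :* :1 :* (b :* :1)) :* X :+ (:1 :- :1 :* :1) :* b :* Q)
                    :+ (:1 :- b :* (:1 :* :1)) :* b :* (A :+ z :* z :* B))
               refl z b (Sₙ 1 s) (S (b̄ * 1#) (b * 1#) 2 s) A B ⟩
        z * ((1# + - (b * 1# * (b * 1#))) * Sₙ 1 s + (1# + - (1# * 1#)) * b * S (b̄ * 1#) (b * 1#) 2 s)
          + (1# + - (b * (1# * 1#))) * b * (A + z * z * B)
          ≈⟨ +-congˡ (*-congˡ (+-cong
               (trans (sym (Sₙ-pred-even 0 s)) (sym (S-stable 0 1 (λ k → pred-even (d k) s))))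
               (*-congˡ (sym (S-stable 0 1 (λ k → d k (suc s))))))) ⟩
        z * ((1# + - (b * 1# * (b * 1#))) * Sₙ 1 s + (1# + - (1# * 1#)) * b * S (b̄ * 1#) (b * 1#) 2 s)
          + (1# + - (b * (1# * 1#))) * b * (Sₚ 1# 1# 2 s + z * z * S 1# 1# 2 (suc s))
          ≈⟨ S-telescoped 1# 1# (*-identityˡ 1#) s 2 ⟩
        (1# + - (b * (1# * 1#))) * z * H 1# 1# 1 * d 2 s
          ≈⟨ *-congʳ (*-congˡ (H-vanish 0 0)) ⟩
        (1# + - (b * (1# * 1#))) * z * 0# * d 2 s
          ≈⟨ solve 3 (λ u v x → u :* v :* :0 :* x := :0) refl _ _ _ ⟩
        0# ∎
        where
        z A B : Carrier
        z = b ^ s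
        A = pred-even (Sₙ 0) s
        B = Sₙ 0 (suc s)
      next : ∀ n s → let y = b ^ suc n in
          b ^ s * ((1# + - (b * y * (b * y))) * Sₙ (suc (suc n)) s
                   + (1# + - (y * y)) * b * Sₙ n s)
            + (1# + - (b * (y * y))) * b
              * (pred-even (Sₙ (suc n)) s + b ^ s * b ^ s * Sₙ (suc n) (suc s)) ≈ 0#
      next n s = begin
        b ^ s * ((1# + - (b * y * (b * y))) * Sₙ (suc (suc n)) s + (1# + - (y * y)) * b * Sₙ n s)
            + (1# + - (b * (y * y))) * b
              * (pred-even (Sₙ (suc n)) s + b ^ s * b ^ s * Sₙ (suc n) (suc s))
          -- The natural ranges of the sums of index n, n + 1 and n + 2 differ; all are extended to
          -- n + 3 terms. The boundary term then contains H at n + 2, which vanishes for y =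
          -- b^{n+1}.
          ≈⟨ +-cong
               (*-congˡ (+-congˡ (*-congˡ (trans (sym (S-stable n 2 (λ k → d k s)))
                 (S-cong (suc (2 ℕ.+ n)) s (unwind bb̄≈1′) (unwind bb̄≈1))))))
               (*-congˡ (+-cong
                 (trans (sym (Sₙ-pred-even (suc n) s)) (sym (S-stable (suc n) 1 (λ k → pred-even (d k) s))))
                 (*-congˡ (sym (S-stable (suc n) 1 (λ k → d k (suc s))))))) ⟩
        b ^ s * ((1# + - (b * y * (b * y))) * S (b * y) (b̄ * ȳ) (suc (2 ℕ.+ n)) s
                 + (1# + - (y * y)) * b * S (b̄ * y) (b * ȳ) (suc (2 ℕ.+ n)) s)
            + (1# + - (b * (y * y))) * b
              * (Sₚ y ȳ (suc (2 ℕ.+ n)) s + b ^ s * b ^ s * S y ȳ (suc (2 ℕ.+ n)) (suc s))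
          ≈⟨ S-telescoped y ȳ (pow-inverse (suc n)) s (suc (2 ℕ.+ n)) ⟩
        (1# + - (b * (y * y))) * b ^ s * H y ȳ (2 ℕ.+ n) * d (suc (2 ℕ.+ n)) s
          ≈⟨ *-congʳ (*-congˡ (H-vanish (suc n) 0)) ⟩
        (1# + - (b * (y * y))) * b ^ s * 0# * d (suc (2 ℕ.+ n)) s
          ≈⟨ solve 3 (λ u v x → u :* v :* :0 :* x := :0) refl _ _ _ ⟩
        0# ∎
        where
        y ȳ : Carrier
        y = b ^ suc n
        ȳ = b̄ ^ suc n
        bb̄≈1′ : b̄ * b ≈ 1#
        bb̄≈1′ = trans (*-comm b̄ b) bb̄≈1
        unwind : ∀ {u ū x} → ū * u ≈ 1# → x ≈ ū * (u * x)
        unwind ūu≈1 = sym (trans (sym (*-assoc _ _ _)) (trans (*-congʳ ūu≈1) (*-identityˡ _)))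

    -- Coefficients of the Rogers polynomials

    δ γ σ : ℕ → Carrier
    δ zero          = 1#
    δ (suc zero)    = 0#
    δ (suc (suc m)) = δ m * ((1# + - (b * b ^ m)) * w (suc m))
    γ zero          = 1#
    γ (suc zero)    = 0#
    γ (suc (suc m)) = b * γ m * ((1# + - (b * b ^ m)) * w (suc m))
    σ zero    = 1#
    σ (suc s) = - (b̄ ^ s) * σ s

    -- The coefficients of Rogers' continuous q-ultraspherical polynomials
    -- C_n(x; b | b²), up to the power of b produced by z ↦ b^½ z.
    T : ℕ → ℕ → Carrier
    T n s = σ s * shift γ n s * δ (n ℕ.+ s)

    σ-suc : ∀ s → b ^ s * σ (suc s) ≈ - σ s
    σ-suc s = linear₁ (- σ s) (pow-inverse s)
      (solve 3 (λ x x̄ σ → x :* ((:- x̄) :* σ) :+ (:- σ) :* :1 := (:- σ) :+ (:- σ) :* (x :* x̄))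
        refl (b ^ s) (b̄ ^ s) (σ s))

    δ-step : ∀ m → δ (suc (suc m)) * (1# + - (b * (b * b ^ m))) ≈ δ m * (1# + - (b * b ^ m))
    δ-step m = linear₁ (δ m * (1# + - (b * b ^ m))) (w-inverse (suc m))
      (solve 4 (λ δ c w u →
        δ :* (c :* w) :* u :+ δ :* c :* :1 := δ :* c :+ δ :* c :* (u :* w))
        refl (δ m) (1# + - (b * b ^ m)) (w (suc m)) (1# + - (b * (b * b ^ m))))

    -- The ratio γ(m+2)/γ(m) = b (1 - b^{m+1})/(1 - b^{m+2}) at m = n - s, cleared of denominators
    -- and scaled by b^s. It extends past s = n: at s = n + 1 the left value is γ(1) = 0, at s = n +
    -- 2 the factor on the left vanishes, and on the right the shifted value is 0.
    shift-γ : ∀ n s → shift γ (suc (suc n)) s * (b ^ s + - (b * (b * b ^ n))) ≈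
                      b * shift γ n s * (b ^ s + - (b * b ^ n))
    shift-γ n zero = linear₁ (b * γ n * (1# + - (b * b ^ n))) (w-inverse (suc n))
      (solve 5 (λ b γ c w u →
        b :* γ :* (c :* w) :* u :+ b :* γ :* c :* :1 := b :* γ :* c :+ b :* γ :* c :* (u :* w))
        refl b (γ n) (1# + - (b * b ^ n)) (w (suc n)) (1# + - (b * (b * b ^ n))))
    shift-γ zero (suc zero)          = solve 2 (λ b u → :0 :* u := b :* :0 :* (b :* :1 :- b :* :1))
      refl b _
    shift-γ zero (suc (suc zero))    = solve 2 (λ b v →
      :1 :* (b :* (b :* :1) :- b :* (b :* :1)) := b :* :0 :* v) refl b _
    shift-γ zero (suc (suc (suc s))) = solve 3 (λ b u v → :0 :* u := b :* :0 :* v) refl b _ _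
    shift-γ (suc n) (suc s) = linear₁ b (shift-γ n s)
      (solve 5 (λ b x z u v →
        u :* (b :* z :- b :* (b :* (b :* x))) :+ b :* (b :* v :* (z :- b :* x))
          := b :* v :* (b :* z :- b :* (b :* x)) :+ b :* (u :* (z :- b :* (b :* x))))
        refl b (b ^ n) (b ^ s) (shift γ (suc (suc n)) s) (shift γ n s))

    T-recurrence : Recurrence T
    T-recurrence = record { first = first ; next = next }
      where
      first : ∀ s →
          b ^ s * ((1# + - (b * b)) * T 1 s)
            + (1# + - b) * b * (pred-even (T 0) s + b ^ s * b ^ s * T 0 (suc s)) ≈ 0#
      first zero = solve 3 (λ b u v →
        :1 :* ((:1 :- b :* b) :* (:1 :* :0 :* :0))
          :+ (:1 :- b) :* b :* (u :* :0 :* v :+ :1 :* :1 :* (u :* :0 :* v)) := :0)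
        refl b (σ 1) (δ 1)
      first (suc zero) = linear₁ (- ((1# + - b) * b)) (w-inverse 1)
        (solve 4 (λ b w u v →
          b :* :1 :* ((:1 :- b :* b) :* ((:- :1) :* :1 :* :1 :* (:1 :* ((:1 :- b :* :1) :* w))))
            :+ (:1 :- b) :* b :* (:1 :* :1 :* :1 :+ b :* :1 :* (b :* :1) :* (u :* :0 :* v))
            :+ (:- ((:1 :- b) :* b)) :* :1
          := :0 :+ (:- ((:1 :- b) :* b)) :* ((:1 :- b :* (b :* :1)) :* w))
          refl b (w 1) (σ 2) (δ 2))
      first (suc (suc s)) =
        solve 8 (λ b z u₁ u₂ u₃ v₁ v₂ v₃ →
          z :* ((:1 :- b :* b) :* (u₁ :* :0 :* v₁))
            :+ (:1 :- b) :* b :* (u₂ :* :0 :* v₂ :+ z :* z :* (u₃ :* :0 :* v₃)) := :0)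
          refl b _ _ _ _ _ _ _
      next : ∀ n s → let y = b ^ suc n in
          b ^ s * ((1# + - (b * y * (b * y))) * T (suc (suc n)) s
                   + (1# + - (y * y)) * b * T n s)
            + (1# + - (b * (y * y))) * b
              * (pred-even (T (suc n)) s + b ^ s * b ^ s * T (suc n) (suc s)) ≈ 0#
      next m zero rewrite ℕ.+-suc m 0 | ℕ.+-identityʳ m =
        linear₁ (b * γ m * δ m * ((1# + b * y) * (1# + - y) * (1# + - y) * w (suc m)
                                  + - ((1# + y) * (1# + - y)))) (w-inverse (suc m))
          (solve 5 (λ b x w γ δ →
            let y  = b :* x
                c  = (:1 :- b :* x) :* w
                c₁ = b :* γ :* δ :* ((:1 :+ b :* y) :* (:1 :- y) :* (:1 :- y) :* w
                                      :- (:1 :+ y) :* (:1 :- y))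
                T₁ = (:- :1) :* :1 :* γ :* (δ :* c)
            in
            :1 :* ((:1 :- b :* y :* (b :* y)) :* (:1 :* (b :* γ :* c) :* (δ :* c))
                   :+ (:1 :- y :* y) :* b :* (:1 :* γ :* δ))
              :+ (:1 :- b :* (y :* y)) :* b :* (T₁ :+ :1 :* :1 :* T₁)
              :+ c₁ :* :1
            := :0 :+ c₁ :* ((:1 :- b :* (b :* x)) :* w))
            refl b (b ^ m) (w (suc m)) (γ m) (δ m))
        where
        y : Carrier
        y = b ^ suc m
      next m (suc t) rewrite ℕ.+-suc m (suc t) | ℕ.+-suc m t =
        -- Put s = t + 1. The entries at (m+2, s), (m, s), (m+1, s-1) and (m+1, s+1) use just two
        -- values of γ and two of δ, since the difference and the sum of the indices each take two
        -- values; each of the four products occurs once.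
        linear₄
          (Z * σ (suc t) * (b * Y * Δ + - (Y * Δ₀))) (shift-γ m (suc t))
          (Z * σ (suc t) * (Γ + - (b * Γ₀))) Δ-step
          ((1# + - (b * (Y * Y))) * b * Γ * Δ₀) (σ-suc t)
          ((1# + - (b * (Y * Y))) * b * Z * Γ₀ * Δ) (σ-suc (suc t))
          (solve 10 (λ b x z Γ Γ₀ Δ Δ₀ σ σ₁ σ₂ →
            let Y  = b :* x
                Z  = b :* z
                κ  = :1 :- b :* (Y :* Y)
                c₁ = Z :* σ₁ :* (b :* Y :* Δ :- Y :* Δ₀)
                c₂ = Z :* σ₁ :* (Γ :- b :* Γ₀)
                c₃ = κ :* b :* Γ :* Δ₀
                c₄ = κ :* b :* Z :* Γ₀ :* Δ
            in
            Z :* ((:1 :- b :* Y :* (b :* Y)) :* (σ₁ :* Γ :* Δ) :+ (:1 :- Y :* Y) :* b :* (σ₁ :* Γ₀ :* Δ₀))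
              :+ κ :* b :* (σ :* Γ :* Δ₀ :+ Z :* Z :* (σ₂ :* Γ₀ :* Δ))
              :+ c₁ :* (b :* Γ₀ :* (b :* z :- b :* x))
              :+ c₂ :* (Δ₀ :* (:1 :- b :* (b :* (x :* z))))
              :+ c₃ :* (:- σ)
              :+ c₄ :* (:- σ₁)
            := :0
              :+ c₁ :* (Γ :* (b :* z :- b :* (b :* x)))
              :+ c₂ :* (Δ :* (:1 :- b :* (b :* (b :* (x :* z)))))
              :+ c₃ :* (z :* σ₁)
              :+ c₄ :* (b :* z :* σ₂))
            refl b (b ^ m) (b ^ t) Γ Γ₀ Δ Δ₀ (σ t) (σ (suc t)) (σ (suc (suc t))))
        where
        Y Z Γ Γ₀ Δ Δ₀ : Carrier
        Y  = b ^ suc m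
        Z  = b ^ suc t
        Γ  = shift γ (suc m) t
        Γ₀ = shift γ m (suc t)
        Δ  = δ (suc (suc (suc (m ℕ.+ t))))
        Δ₀ = δ (suc (m ℕ.+ t))
        Δ-step : Δ * (1# + - (b * (b * (b * (b ^ m * b ^ t))))) ≈
                 Δ₀ * (1# + - (b * (b * (b ^ m * b ^ t))))
        Δ-step = trans (*-congˡ (+-congˡ (-‿cong (*-congˡ (*-congˡ (*-congˡ (sym (^-homo-* b m t))))))))
          (trans (δ-step (suc (m ℕ.+ t)))
            (*-congˡ (+-congˡ (-‿cong (*-congˡ (*-congˡ (^-homo-* b m t)))))))

    Sₙ≈T : ∀ n s → Sₙ n s ≈ T n s
    Sₙ≈T = unique Sₙ-recurrence T-recurrence λ where
      -- At n = 0 only the term k = 0 is present; both sides are 1 at s = 0 and 0 for s > 0.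
      zero    → solve 0 (:0 :+ :1 :* (:1 :* :1 :* (:1 :* :1)) :* (:1 :* :1 :* :1) := :1 :* :1 :* :1) refl
      (suc s) → solve 3 (λ e u v →
        :0 :+ :1 :* (:1 :* :1 :* (:1 :* :1)) :* (:1 :* e :* :0) := u :* :0 :* v) refl _ _ _

    -- From (b;b²)_i (b²;b²)_i = (b;b)_{2i}. This is the shape in which the factors (q²;q²) of the
    -- closed form appear.
    δ-double : ∀ i → δ (double i) ≈ π (double i) * (E i * E i)
    δ-double zero    = solve 0 (:1 := :1 :* (:1 :* :1)) refl
    δ-double (suc i) = linear₂ (u * W) (δ-double i) (- (π (double i) * u * (E i * E i) * W))
                               (w-inverse (suc (double i)))
      (solve 6 (λ δ u v W Π E →
        δ :* (u :* W) :+ u :* W :* (Π :* (E :* E)) :+ (:- (Π :* u :* (E :* E) :* W)) :* :1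
          := Π :* u :* v :* (W :* E :* (W :* E)) :+ u :* W :* δ :+ (:- (Π :* u :* (E :* E) :* W)) :* (v :* W))
        refl (δ (double i)) u (1# + - (b ^ double (suc i))) W (π (double i)) (E i))
      where
      u W : Carrier
      u = 1# + - (b * b ^ double i)
      W = w (suc (double i))

    γ-double : ∀ i → γ (double i) ≈ b ^ i * δ (double i)
    γ-double zero    = sym (*-identityˡ 1#)
    γ-double (suc i) = trans (*-congʳ (*-congˡ (γ-double i)))
      (solve 4 (λ b x δ c → b :* (x :* δ) :* c := b :* x :* (δ :* c)) refl _ _ _ _)

    γ-odd : ∀ i → γ (suc (double i)) ≈ 0#
    γ-odd zero    = refl
    γ-odd (suc i) = trans (*-congʳ (trans (*-congˡ (γ-odd i)) (zeroʳ b))) (zeroˡ _)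

  -- Specialisation to b = q²

  -- The inverse is assumed correct on units only, so a total operation with 0⁻¹ = 0 qualifies.
  module Supercongruence
    (q : Carrier) (_⁻¹ : Carrier → Carrier)
    (inverse : ∀ x y → x * y ≈ 1# → x * (x ⁻¹) ≈ 1#)
    (q-unit : q * (q ⁻¹) ≈ 1#)
    (1-qⁱ-unit : ∀ i → (1# + - (q ^ suc i)) * ((1# + - (q ^ suc i)) ⁻¹) ≈ 1#)
    where

    -- `qPoch`, `qChoose` and `summand` repeat the expressions of the theorem over an abstract ring;
    -- at the field of rational functions they agree with them by computation.
    qPoch : Carrier → Carrier → ℕ → Carrier
    qPoch a b n = product {n} (λ i → 1# + - (a * b ^ toℕ i))

    qChoose : ℕ → ℕ → Carrier → Carrier
    qChoose n k b =
      if k ≤ᵇ n then qPoch (b ^ (n ∸ k ℕ.+ 1)) b k * (qPoch b b k ⁻¹) else 0#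

    zpow : Carrier → ℤ → Carrier
    zpow x (ℤ.+ n)    = x ^ n
    zpow x -[1+ n ] = (x ^ suc n) ⁻¹

    ⁻¹-unique : ∀ {x y} → x * y ≈ 1# → x ⁻¹ ≈ y
    ⁻¹-unique {x} {y} xy≈1 = linear₂ (y) (inverse x y xy≈1) (- (x ⁻¹)) xy≈1
      (solve 3 (λ x x̄ y → x̄ :+ y :* :1 :+ (:- x̄) :* :1 := y :+ y :* (x :* x̄) :+ (:- x̄) :* (x :* y))
        refl x (x ⁻¹) y)

    qPoch≈ : ∀ a b n → qPoch a b n ≈ pochhammer a b n
    qPoch≈ = product-pochhammer

    module _ (b : Carrier) (w : ℕ → Carrier)
             (w-inverse : ∀ i → (1# + - (b ^ suc i)) * w i ≈ 1#) where
      open QFactorial b w w-inverse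

      qChoose-closed : ∀ j m → qChoose (j ℕ.+ m) m b ≈ π (j ℕ.+ m) * (e m * e j)
      qChoose-closed j m
        rewrite ≤⇒≤ᵇ≡true (ℕ.m≤n+m m j) | ℕ.m+n∸n≡m j m | ℕ.+-comm j 1 = begin
        qPoch (b ^ suc j) b m * (qPoch b b m ⁻¹)
          ≈⟨ *-cong (qPoch≈ (b ^ suc j) b m)
                    (⁻¹-unique (trans (*-congʳ (qPoch≈ b b m)) (π-inverse m))) ⟩
        pochhammer (b ^ suc j) b m * e m
          ≈⟨ linear₂ (- (pochhammer (b ^ suc j) b m * e m)) (π-inverse j) (e m * e j) (π-from j m)
             (solve 5 (λ p e π eⱼ Π →
               p :* e :+ (:- (p :* e)) :* :1 :+ e :* eⱼ :* Π
                 := Π :* (e :* eⱼ) :+ (:- (p :* e)) :* (π :* eⱼ) :+ e :* eⱼ :* (p :* π))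
               refl (pochhammer (b ^ suc j) b m) (e m) (π j) (e j) (π (j ℕ.+ m))) ⟩
        π (j ℕ.+ m) * (e m * e j) ∎

    q² q⁻² q⁴ : Carrier
    q²  = q ^ 2
    q⁻² = q ⁻¹ * q ⁻¹
    q⁴  = q ^ 4

    q²-unit : q² * q⁻² ≈ 1#
    q²-unit = linear₂ (q * q ⁻¹) q-unit 1# q-unit
      (solve 2 (λ q q̄ →
        q :* (q :* :1) :* (q̄ :* q̄) :+ q :* q̄ :* :1 :+ :1 :* :1
          := :1 :+ q :* q̄ :* (q :* q̄) :+ :1 :* (q :* q̄)) refl q (q ⁻¹))

    power-unit : ∀ j {x} → x ≈ q ^ suc j → (1# + - x) * ((1# + - x) ⁻¹) ≈ 1#
    power-unit j x≈ = inverse _ _ (trans (*-congʳ (+-congˡ (-‿cong x≈))) (1-qⁱ-unit j))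

    w w₄ : ℕ → Carrier
    w  i = (1# + - (q² ^ suc i)) ⁻¹
    w₄ i = (1# + - (q⁴ ^ suc i)) ⁻¹

    w-inverse : ∀ i → (1# + - (q² ^ suc i)) * w i ≈ 1#
    w-inverse i = power-unit (i ℕ.+ 1 ℕ.* suc i) (^-assocʳ q 2 (suc i))

    w₄-inverse : ∀ i → (1# + - (q⁴ ^ suc i)) * w₄ i ≈ 1#
    w₄-inverse i = power-unit (i ℕ.+ 3 ℕ.* suc i) (^-assocʳ q 4 (suc i))

    open QWatson q² q⁻² q²-unit w w-inverse public
    module Q⁴ = QFactorial q⁴ w₄ w₄-inverse

    q⁴≈q²q² : ∀ k → q⁴ ^ k ≈ q² ^ double k
    q⁴≈q²q² zero    = refl
    q⁴≈q²q² (suc k) = trans (*-congˡ (q⁴≈q²q² k))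
      (solve 2 (λ q x → q :* (q :* (q :* (q :* :1))) :* x
                          := q :* (q :* :1) :* (q :* (q :* :1) :* x)) refl q _)

    w₄≈w : ∀ k → w₄ k ≈ w (suc (double k))
    w₄≈w k = ⁻¹-unique (trans (*-congʳ (+-congˡ (-‿cong (q⁴≈q²q² (suc k))))) (w-inverse (suc (double k))))

    e₄≈E : ∀ k → Q⁴.e k ≈ E k
    e₄≈E zero    = refl
    e₄≈E (suc k) = *-cong (w₄≈w k) (e₄≈E k)

    q-double : ∀ k → q ^ double k ≈ q² ^ k
    q-double zero    = refl
    q-double (suc k) = trans (*-congˡ (*-congˡ (q-double k)))
      (solve 2 (λ q x → q :* (q :* x) := q :* (q :* :1) :* x) refl q _)

    odd : ℕ → Carrier
    odd = pochhammer q q²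

    -- (-q;q)_{2k} (q;q)_{2k} = (q²;q²)_{2k}, and (q;q)_{2k} splits by parity of the exponent into
    -- (q;q²)_k (q²;q²)_k.
    pochhammer-neg-q : ∀ k →
      pochhammer (- q) q (double k) * (odd k * π k * e (double k)) ≈ 1#
    pochhammer-neg-q k = trans
      (solve 4 (λ p o π e → p :* (o :* π :* e) := p :* (o :* π) :* e) refl _ _ _ _)
      (trans (*-congʳ (go k)) (π-inverse (double k)))
      where
      go : ∀ k → pochhammer (- q) q (double k) * (odd k * π k) ≈ π (double k)
      go zero    = solve 0 (:1 :* (:1 :* :1) := :1) refl
      go (suc k) = begin
        p * (1# + - (- q * q ^ double k)) * (1# + - (- q * (q * q ^ double k)))
          * (odd k * (1# + - (q * x)) * (π k * (1# + - (q² * x))))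
          ≈⟨ *-congʳ (*-cong (*-congˡ (+-congˡ (-‿cong (*-congˡ (q-double k)))))
                             (+-congˡ (-‿cong (*-congˡ (*-congˡ (q-double k)))))) ⟩
        p * (1# + - (- q * x)) * (1# + - (- q * (q * x)))
          * (odd k * (1# + - (q * x)) * (π k * (1# + - (q² * x))))
          ≈⟨ solve 5 (λ q x p o π →
               let b = q :* (q :* :1) in
               p :* (:1 :- (:- q) :* x) :* (:1 :- (:- q) :* (q :* x))
                 :* (o :* (:1 :- q :* x) :* (π :* (:1 :- b :* x)))
               := p :* (o :* π) :* (:1 :- b :* (x :* x)) :* (:1 :- b :* (b :* (x :* x))))
               refl q x p (odd k) (π k) ⟩
        p * (odd k * π k) * (1# + - (q² * (x * x))) * (1# + - (q² * (q² * (x * x))))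
          ≈⟨ *-congʳ (*-congʳ (go k)) ⟩
        π (double k) * (1# + - (q² * (x * x))) * (1# + - (q² * (q² * (x * x))))
          ≈⟨ π-double k ⟨
        π (double (suc k)) ∎
        where
        p x : Carrier
        p = pochhammer (- q) q (double k)
        x = q² ^ k

    -- (-q²;q²)_k (q²;q²)_k = (q⁴;q⁴)_k.
    pochhammer-neg-q² : ∀ k → pochhammer (- q²) q² k * (π k * E k) ≈ 1#
    pochhammer-neg-q² zero    = solve 0 (:1 :* (:1 :* :1) := :1) refl
    pochhammer-neg-q² (suc k) = begin
      p * (1# + - (- q² * x)) * (π k * (1# + - (q² * x)) * (W * E k))
        ≈⟨ solve 6 (λ b x p π E W →
             p :* (:1 :- (:- b) :* x) :* (π :* (:1 :- b :* x) :* (W :* E))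
               := p :* (π :* E) :* ((:1 :- b :* x :* (b :* x)) :* W))
             refl q² x p (π k) (E k) W ⟩
      p * (π k * E k) * ((1# + - (q² * x * (q² * x))) * W)
        ≈⟨ *-cong (pochhammer-neg-q² k)
             (trans (*-congʳ (+-congˡ (-‿cong (sym (pow-double (suc k)))))) (w-inverse (suc (double k)))) ⟩
      1# * 1#
        ≈⟨ *-identityˡ 1# ⟩
      1# ∎
      where
      p x W : Carrier
      p = pochhammer (- q²) q² k
      x = q² ^ k
      W = w (suc (double k))

    summand : ℕ → ℕ → Carrier
    summand s k =
      qChoose (2 ℕ.* k) k (q ^ 2) ^ 2
        * qChoose (2 ℕ.* k) (k ℕ.+ s) (q ^ 2)
        * (q ^ (2 ℕ.* k)
            * ((qPoch (- (q ^ 2)) (q ^ 2) k ^ 2 * qPoch (- q) q (2 ℕ.* k) ^ 2) ⁻¹))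

    shift-+ : ∀ (f : ℕ → Carrier) j s → shift f (j ℕ.+ s) s ≡ f j
    shift-+ f j zero    = ≡.cong f (ℕ.+-identityʳ j)
    shift-+ f j (suc s) rewrite ℕ.+-suc j s = shift-+ f j s

    shift-< : ∀ (f : ℕ → Carrier) {k s} → k < s → shift f k s ≡ 0#
    shift-< f {zero}  {suc s} _         = ≡.refl
    shift-< f {suc k} {suc s} (s≤s k<s) = shift-< f k<s

    choose-d : ∀ k s → qChoose (2 ℕ.* k) (k ℕ.+ s) (q ^ 2) ≈ d k s
    choose-d k s with s ℕ.≤? k
    ... | yes s≤k = begin
      qChoose (2 ℕ.* k) (k ℕ.+ s) q²
        ≡⟨ ≡.cong (λ m → qChoose m (k ℕ.+ s) q²) 2k≡ ⟩
      qChoose (j ℕ.+ (k ℕ.+ s)) (k ℕ.+ s) q²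
        ≈⟨ qChoose-closed q² w w-inverse j (k ℕ.+ s) ⟩
      π (j ℕ.+ (k ℕ.+ s)) * (e (k ℕ.+ s) * e j)
        ≈⟨ *-assoc _ _ _ ⟨
      π (j ℕ.+ (k ℕ.+ s)) * e (k ℕ.+ s) * e j
        ≡⟨ ≡.cong₂ (λ m x → π m * e (k ℕ.+ s) * x)
             (≡.trans (≡.sym 2k≡) (≡.sym (double≡2* k)))
             (≡.trans (≡.sym (shift-+ e j s)) (≡.cong (λ m → shift e m s) (ℕ.m∸n+n≡m s≤k))) ⟩
      d k s ∎
      where
      j : ℕ
      j = k ∸ s
      2k≡ : 2 ℕ.* k ≡ j ℕ.+ (k ℕ.+ s)
      2k≡ = ≡.trans (≡.cong₂ ℕ._+_ (≡.sym (ℕ.m∸n+n≡m s≤k)) (ℕ.+-identityʳ k))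
              (≡.trans (ℕ.+-assoc j s k) (≡.cong (j ℕ.+_) (ℕ.+-comm s k)))
    ... | no s≰k rewrite ≰⇒≤ᵇ≡false {k ℕ.+ s} {2 ℕ.* k}
                           (λ le → s≰k (≡.subst (s ≤_) (ℕ.+-identityʳ k) (ℕ.+-cancelˡ-≤ k _ _ le)))
                       | shift-< e (ℕ.≰⇒> s≰k) = sym (zeroʳ _)

    -- The squared central binomial contributes (b;b)²_{2k}/(b;b)⁴_k and the two negative-argument
    -- products contribute the reciprocal of that, up to (q;q²)²_k/(q⁴;q⁴)²_k.
    summand-closed : ∀ s k → summand s k ≈ q² ^ k * (odd k * odd k * (E k * E k)) * d k s
    summand-closed s k = begin
      qChoose (2 ℕ.* k) k q² ^ 2 * qChoose (2 ℕ.* k) (k ℕ.+ s) q²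
        * (q ^ (2 ℕ.* k) * ((qPoch (- q²) q² k ^ 2 * qPoch (- q) q (2 ℕ.* k) ^ 2) ⁻¹))
        ≈⟨ *-cong (*-cong (^-congˡ 2 central) (choose-d k s))
                  (*-cong (trans (reflexive (≡.cong (q ^_) (≡.sym (double≡2* k)))) (q-double k))
                          (⁻¹-unique denominator)) ⟩
      (Π * (e k * e k)) ^ 2 * d k s * (x * ((π k * E k) ^ 2 * (odd k * π k * e (double k)) ^ 2))
        ≈⟨ solve 8 (λ x d Π e₂ π e E o →
             (Π :* (e :* e)) :^ 2 :* d :* (x :* ((π :* E) :^ 2 :* (o :* π :* e₂) :^ 2))
               := (Π :* e₂) :^ 2 :* (π :* e) :^ 4 :* (x :* (o :* o :* (E :* E)) :* d))
             refl x (d k s) Π (e (double k)) (π k) (e k) (E k) (odd k) ⟩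
      (Π * e (double k)) ^ 2 * (π k * e k) ^ 4 * (x * (odd k * odd k * (E k * E k)) * d k s)
        ≈⟨ *-congʳ (*-cong (^-congˡ 2 (π-inverse (double k))) (^-congˡ 4 (π-inverse k))) ⟩
      1# ^ 2 * 1# ^ 4 * (x * (odd k * odd k * (E k * E k)) * d k s)
        ≈⟨ solve 1 (λ t → :1 :^ 2 :* :1 :^ 4 :* t := t) refl _ ⟩
      x * (odd k * odd k * (E k * E k)) * d k s ∎
      where
      x Π : Carrier
      x = q² ^ k
      Π = π (double k)
      central : qChoose (2 ℕ.* k) k q² ≈ Π * (e k * e k)
      central = trans (reflexive (≡.cong (λ m → qChoose m k q²) (≡.cong (k ℕ.+_) (ℕ.+-identityʳ k))))
        (trans (qChoose-closed q² w w-inverse k k)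
          (*-congʳ (reflexive (≡.cong π (≡.sym (double≡+ k))))))
      denominator :
        qPoch (- q²) q² k ^ 2 * qPoch (- q) q (2 ℕ.* k) ^ 2
          * ((π k * E k) ^ 2 * (odd k * π k * e (double k)) ^ 2) ≈ 1#
      denominator = begin
        qPoch (- q²) q² k ^ 2 * qPoch (- q) q (2 ℕ.* k) ^ 2 * (u ^ 2 * v ^ 2)
          ≈⟨ solve 4 (λ x y u v → x :^ 2 :* y :^ 2 :* (u :^ 2 :* v :^ 2)
                                    := (x :* u) :^ 2 :* (y :* v) :^ 2) refl _ _ u v ⟩
        (qPoch (- q²) q² k * u) ^ 2 * (qPoch (- q) q (2 ℕ.* k) * v) ^ 2
          ≈⟨ *-cong
               (^-congˡ 2 (trans (*-congʳ (qPoch≈ (- q²) q² k)) (pochhammer-neg-q² k)))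
               (^-congˡ 2 (trans
                 (*-congʳ (trans (reflexive (≡.cong (qPoch (- q) q) (≡.sym (double≡2* k))))
                                 (qPoch≈ (- q) q (double k))))
                 (pochhammer-neg-q k))) ⟩
        1# ^ 2 * 1# ^ 2
          ≈⟨ solve 0 (:1 :^ 2 :* :1 :^ 2 := :1) refl ⟩
        1# ∎
        where
        u v : Carrier
        u = π k * E k
        v = odd k * π k * e (double k)

    zpow-⊖ : ∀ m k → zpow q (m ⊖ k) ≈ q ^ m * (q ⁻¹) ^ k
    zpow-⊖ m       zero    = sym (*-identityʳ _)
    zpow-⊖ zero    (suc k) = trans (⁻¹-unique (power-inverse (suc k))) (sym (*-identityˡ _))
      where
      power-inverse : ∀ k → q ^ k * (q ⁻¹) ^ k ≈ 1#
      power-inverse zero    = *-identityˡ 1#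
      power-inverse (suc k) = linear₂ (q ^ k * (q ⁻¹) ^ k) q-unit 1# (power-inverse k)
        (solve 4 (λ b b̄ x x̄ →
          b :* x :* (b̄ :* x̄) :+ x :* x̄ :* :1 :+ :1 :* :1
            := :1 :+ x :* x̄ :* (b :* b̄) :+ :1 :* (x :* x̄)) refl q (q ⁻¹) (q ^ k) ((q ⁻¹) ^ k))
    zpow-⊖ (suc m) (suc k) = begin
      zpow q (suc m ⊖ suc k)           ≡⟨ ≡.cong (zpow q) (ℤ.[1+m]⊖[1+n]≡m⊖n m k) ⟩
      zpow q (m ⊖ k)                   ≈⟨ zpow-⊖ m k ⟩
      q ^ m * (q ⁻¹) ^ k               ≈⟨ linear₁ (- (q ^ m * (q ⁻¹) ^ k)) q-unit
        (solve 4 (λ b b̄ x x̄ →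
          x :* x̄ :+ (:- (x :* x̄)) :* :1 := b :* x :* (b̄ :* x̄) :+ (:- (x :* x̄)) :* (b :* b̄))
          refl q (q ⁻¹) (q ^ m) ((q ⁻¹) ^ k)) ⟩
      q ^ suc m * (q ⁻¹) ^ suc k       ∎

    sign-power : ∀ s → (- 1#) ^ s * (q ^ s * (q ⁻¹) ^ (s ℕ.^ 2)) ≈ σ s
    sign-power zero    = solve 0 (:1 :* (:1 :* :1) := :1) refl
    sign-power (suc s) = begin
      - 1# * (- 1#) ^ s * (q * q ^ s * (q ⁻¹) ^ (suc s ℕ.^ 2))
        ≈⟨ *-congˡ (*-congˡ (trans (reflexive (≡.cong ((q ⁻¹) ^_) square))
             (trans (^-homo-* (q ⁻¹) (s ℕ.^ 2) (suc (s ℕ.+ s)))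
               (*-congˡ (*-congˡ (^-homo-* (q ⁻¹) s s)))))) ⟩
      - 1# * (- 1#) ^ s * (q * q ^ s * ((q ⁻¹) ^ (s ℕ.^ 2) * (q ⁻¹ * ((q ⁻¹) ^ s * (q ⁻¹) ^ s))))
        ≈⟨ linear₁ (- ((- 1#) ^ s * (q ^ s * (q ⁻¹) ^ (s ℕ.^ 2)) * ((q ⁻¹) ^ s * (q ⁻¹) ^ s))) q-unit
           (solve 6 (λ q q̄ ε x u v →
             (:- :1) :* ε :* (q :* x :* (u :* (q̄ :* (v :* v)))) :+ (:- (ε :* (x :* u) :* (v :* v))) :* :1
               := (:- (v :* v)) :* (ε :* (x :* u)) :+ (:- (ε :* (x :* u) :* (v :* v))) :* (q :* q̄))
             refl q (q ⁻¹) ((- 1#) ^ s) (q ^ s) ((q ⁻¹) ^ (s ℕ.^ 2)) ((q ⁻¹) ^ s)) ⟩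
      - ((q ⁻¹) ^ s * (q ⁻¹) ^ s) * ((- 1#) ^ s * (q ^ s * (q ⁻¹) ^ (s ℕ.^ 2)))
        ≈⟨ *-cong (-‿cong (sym (^-distrib-* (q ⁻¹) (q ⁻¹) s))) (sign-power s) ⟩
      - (q⁻² ^ s) * σ s ∎
      where
      square : suc s ℕ.^ 2 ≡ s ℕ.^ 2 ℕ.+ suc (s ℕ.+ s)
      square = +-*-Solver.solve 1
        (λ s → (+-*-Solver.con 1 +-*-Solver.:+ s) +-*-Solver.:^ 2 +-*-Solver.:=
               s +-*-Solver.:^ 2 +-*-Solver.:+ (+-*-Solver.con 1 +-*-Solver.:+ (s +-*-Solver.:+ s)))
        ≡.refl s

    -- Writing n = 2i + s removes every truncated subtraction and quotient. The factorial (q⁴;q⁴)_n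
    -- cancels and leaves δ(2i) δ(2i+2s), while q^{n-s²} = q^{2i} q^{s-s²} supplies the power in γ
    -- and the one in σ. The power enters as a variable `z`, so that a separately defined integer
    -- power may take its place.
    T-even : ∀ i s → let n = double i ℕ.+ s in ∀ {z} → z ≡ zpow q (n ⊖ (s ℕ.^ 2)) →
      (- 1#) ^ s * z * qChoose n i (q ^ 4) ^ 2
        * (qPoch (q ^ 2) (q ^ 2) (double i) * qPoch (q ^ 2) (q ^ 2) (double (i ℕ.+ s))
            * ((qPoch (q ^ 4) (q ^ 4) n ^ 2) ⁻¹))
      ≈ T n s
    T-even i s {z} z≡ = begin
      (- 1#) ^ s * z * qChoose n i (q ^ 4) ^ 2
        * (qPoch (q ^ 2) (q ^ 2) (double i) * qPoch (q ^ 2) (q ^ 2) (double j)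
            * ((qPoch (q ^ 4) (q ^ 4) n ^ 2) ⁻¹))
        ≈⟨ *-cong (*-cong (*-congˡ (trans (reflexive z≡) (trans (zpow-⊖ n (s ℕ.^ 2)) (*-congʳ qⁿ)))) (^-congˡ 2 choose))
                  (*-cong (*-cong (qPoch≈ q² q² (double i)) (qPoch≈ q² q² (double j)))
                          (⁻¹-unique denominator)) ⟩
      (- 1#) ^ s * (x * q ^ s * (q ⁻¹) ^ (s ℕ.^ 2)) * (Q⁴.π n * (E i * E j)) ^ 2
        * (π (double i) * π (double j) * Q⁴.e n ^ 2)
        ≈⟨ solve 10 (λ ε x z u Π Eᵢ Eⱼ πᵢ πⱼ e →
             ε :* (x :* z :* u) :* (Π :* (Eᵢ :* Eⱼ)) :^ 2 :* (πᵢ :* πⱼ :* e :^ 2)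
               := (Π :* e) :^ 2 :* (ε :* (z :* u) :* (x :* (πᵢ :* (Eᵢ :* Eᵢ))) :* (πⱼ :* (Eⱼ :* Eⱼ))))
             refl ((- 1#) ^ s) x (q ^ s) ((q ⁻¹) ^ (s ℕ.^ 2)) (Q⁴.π n) (E i) (E j)
               (π (double i)) (π (double j)) (Q⁴.e n) ⟩
      (Q⁴.π n * Q⁴.e n) ^ 2
        * ((- 1#) ^ s * (q ^ s * (q ⁻¹) ^ (s ℕ.^ 2)) * (x * (π (double i) * (E i * E i)))
           * (π (double j) * (E j * E j)))
        ≈⟨ *-cong (^-congˡ 2 (Q⁴.π-inverse n))
             (*-cong (*-cong (sign-power s) (trans (*-congˡ (sym (δ-double i))) (sym (γ-double i))))
               (sym (δ-double j))) ⟩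
      1# ^ 2 * (σ s * γ (double i) * δ (double j))
        ≈⟨ solve 1 (λ t → :1 :^ 2 :* t := t) refl _ ⟩
      σ s * γ (double i) * δ (double j)
        ≡⟨ ≡.cong₂ (λ g m → σ s * g * δ m) (≡.sym (shift-+ γ (double i) s)) double-j ⟩
      σ s * shift γ n s * δ (n ℕ.+ s) ∎
      where
      n j : ℕ
      n = double i ℕ.+ s
      j = i ℕ.+ s
      x : Carrier
      x = q² ^ i
      n≡j+i : n ≡ j ℕ.+ i
      n≡j+i = ≡.trans (≡.cong (ℕ._+ s) (double≡+ i))
        (≡.trans (ℕ.+-assoc i i s) (≡.trans (≡.cong (i ℕ.+_) (ℕ.+-comm i s)) (≡.sym (ℕ.+-assoc i s i))))
      double-j : double j ≡ n ℕ.+ s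
      double-j = ≡.trans (double≡+ j) (≡.trans (≡.sym (ℕ.+-assoc j i s)) (≡.cong (ℕ._+ s) (≡.sym n≡j+i)))
      qⁿ : q ^ n ≈ x * q ^ s
      qⁿ = trans (^-homo-* q (double i) s) (*-congʳ (q-double i))
      choose : qChoose n i q⁴ ≈ Q⁴.π n * (E i * E j)
      choose = trans (reflexive (≡.cong (λ m → qChoose m i q⁴) n≡j+i))
        (trans (qChoose-closed q⁴ w₄ w₄-inverse j i)
          (*-cong (reflexive (≡.cong Q⁴.π (≡.sym n≡j+i))) (*-cong (e₄≈E i) (e₄≈E j))))
      denominator : qPoch q⁴ q⁴ n ^ 2 * Q⁴.e n ^ 2 ≈ 1#
      denominator = begin
        qPoch q⁴ q⁴ n ^ 2 * Q⁴.e n ^ 2    ≈⟨ ^-distrib-* _ _ 2 ⟨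
        (qPoch q⁴ q⁴ n * Q⁴.e n) ^ 2      ≈⟨ ^-congˡ 2 (trans (*-congʳ (qPoch≈ q⁴ q⁴ n)) (Q⁴.π-inverse n)) ⟩
        1# ^ 2                            ≈⟨ solve 0 (:1 :^ 2 := :1) refl ⟩
        1#                                ∎

    T-odd : ∀ i s → T (suc (double i) ℕ.+ s) s ≈ 0#
    T-odd i s = trans
      (*-congʳ (*-congˡ (trans (reflexive (shift-+ γ (suc (double i)) s)) (γ-odd i))))
      (solve 2 (λ u v → u :* :0 :* v := :0) refl _ _)

    -- To be read with p = 2n + 1, φ = [p] and Int the integrality at [p].
    module Modulo {ℓ′} (n : ℕ) (φ : Carrier) (φ-eq : 1# + - (q ^ suc (double n)) ≈ (1# + - q) * φ)
      (Int : Carrier → Set ℓ′)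
      (Int-resp : ∀ {x y} → x ≈ y → Int x → Int y)
      (Int-1 : Int 1#)
      (Int-+ : ∀ {x y} → Int x → Int y → Int (x + y))
      (Int-* : ∀ {x y} → Int x → Int y → Int (x * y))
      (Int-neg : ∀ {x} → Int x → Int (- x))
      (Int-q : Int q) (Int-q⁻¹ : Int (q ⁻¹))
      (Int-w : ∀ i → suc i ≤ double n → Int (w i))
      where

      infix 4 _~_
      _~_ : Carrier → Carrier → Set (c ⊔ ℓ ⊔ ℓ′)
      x ~ y = ∃ λ z → Int z × x + - y ≈ φ * φ * z

      Int-0 : Int 0#
      Int-0 = Int-resp (-‿inverseʳ 1#) (Int-+ Int-1 (Int-neg Int-1))

      ~-refl : ∀ {x} → x ~ x
      ~-refl {x} = 0# , Int-0 ,
        solve 2 (λ x φ → x :- x := φ :* φ :* :0) refl x φ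

      ~-+ : ∀ {x x′ y y′} → x ~ x′ → y ~ y′ → x + y ~ x′ + y′
      ~-+ {x} {x′} {y} {y′} (z , Iz , e₁) (t , It , e₂) = z + t , Int-+ Iz It , linear₂ 1# e₁ 1# e₂
        (solve 7 (λ x x′ y y′ φ z t →
          x :+ y :- (x′ :+ y′) :+ :1 :* (φ :* φ :* z) :+ :1 :* (φ :* φ :* t)
            := φ :* φ :* (z :+ t) :+ :1 :* (x :- x′) :+ :1 :* (y :- y′)) refl x x′ y y′ φ z t)

      -- From xy - x′y′ = (x - x′) y′ + x (y - y′); hence integrality is asked of one member of each
      -- pair.
      ~-* : ∀ {x x′ y y′} → Int x → Int y′ → x ~ x′ → y ~ y′ → x * y ~ x′ * y′
      ~-* {x} {x′} {y} {y′} Ix Iy′ (z , Iz , e₁) (t , It , e₂) =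
        z * y′ + x * t , Int-+ (Int-* Iz Iy′) (Int-* Ix It) , linear₂ y′ e₁ x e₂
        (solve 7 (λ x x′ y y′ φ z t →
          x :* y :- x′ :* y′ :+ y′ :* (φ :* φ :* z) :+ x :* (φ :* φ :* t)
            := φ :* φ :* (z :* y′ :+ x :* t) :+ y′ :* (x :- x′) :+ x :* (y :- y′))
          refl x x′ y y′ φ z t)

      ~-resp : ∀ {x x′ y y′} → x ≈ x′ → y ≈ y′ → x ~ y → x′ ~ y′
      ~-resp x≈ y≈ (z , Iz , e) = z , Iz , trans (+-cong (sym x≈) (-‿cong (sym y≈))) e

      Int-^ : ∀ {x} k → Int x → Int (x ^ k)
      Int-^ zero    Ix = Int-1
      Int-^ (suc k) Ix = Int-* Ix (Int-^ k Ix)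

      Int-1- : ∀ {x} → Int x → Int (1# + - x)
      Int-1- Ix = Int-+ Int-1 (Int-neg Ix)

      Int-q² : Int q²
      Int-q² = Int-^ 2 Int-q

      Int-pochhammer : ∀ {a b} k → Int a → Int b → Int (pochhammer a b k)
      Int-pochhammer zero    Ia Ib = Int-1
      Int-pochhammer (suc k) Ia Ib =
        Int-* (Int-pochhammer k Ia Ib) (Int-1- (Int-* Ia (Int-^ k Ib)))

      Int-e : ∀ {k} → k ≤ double n → Int (e k)
      Int-e {zero}  _ = Int-1
      Int-e {suc k} le = Int-* (Int-w k le) (Int-e (ℕ.≤-trans (ℕ.n≤1+n k) le))

      Int-E : ∀ {k} → k ≤ n → Int (E k)
      Int-E {zero}  _ = Int-1
      Int-E {suc k} le = Int-* (Int-w (suc (double k)) (double-mono le))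
                               (Int-E (ℕ.≤-trans (ℕ.n≤1+n k) le))

      Int-shift-e : ∀ k s → k ≤ double n → Int (shift e k s)
      Int-shift-e k       zero    le = Int-e le
      Int-shift-e zero    (suc s) le = Int-0
      Int-shift-e (suc k) (suc s) le = Int-shift-e k s (ℕ.≤-trans (ℕ.n≤1+n k) le)

      Int-d : ∀ {k s} → k ≤ n → s ≤ n → Int (d k s)
      Int-d {k} {s} k≤n s≤n =
        -- The bound s ≤ n gives k + s ≤ 2n = p - 1, so the denominator (b;b)_{k+s} stops short of 1
        -- - b^p, the first factor divisible by [p].
        Int-* (Int-* (Int-pochhammer (double k) Int-q² Int-q²) (Int-e (k+≤ s≤n)))
              (Int-shift-e k s (ℕ.≤-trans k≤n (ℕ.≤-trans (ℕ.m≤m+n n n) (ℕ.≤-reflexive (≡.sym (double≡+ n))))))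
        where
        k+≤ : ∀ {s} → s ≤ n → k ℕ.+ s ≤ double n
        k+≤ s≤n = ℕ.≤-trans (ℕ.+-mono-≤ k≤n s≤n) (ℕ.≤-reflexive (≡.sym (double≡+ n)))

      Int-q⁻² : Int q⁻²
      Int-q⁻² = Int-* Int-q⁻¹ Int-q⁻¹

      y ȳ : Carrier
      y = q² ^ n
      ȳ = q⁻² ^ n

      Int-ȳ : Int ȳ
      Int-ȳ = Int-^ n Int-q⁻²

      Int-P : ∀ k → Int (P y ȳ k)
      Int-P k = Int-* (Int-pochhammer k Int-ȳ Int-q²)
                      (Int-pochhammer k (Int-* Int-q² (Int-^ n Int-q²)) Int-q²)

      -- (1 − c/r)(1 − cr) − (1 − c)² = − (c/r)(1 − r)² with r = q^p.
      odd²~P : ∀ k → odd k * odd k ~ P y ȳ k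
      odd²~P zero    = ~-refl
      odd²~P (suc k) = ~-resp
        (solve 2 (λ o f → o :* o :* (f :* f) := o :* f :* (o :* f)) refl _ _)
        (solve 4 (λ a b f g → a :* b :* (f :* g) := a :* f :* (b :* g)) refl _ _ _ _)
        (~-* (Int-* Io Io) (Int-* (Int-1- (Int-* Int-ȳ Ix)) (Int-1- (Int-* (Int-* Int-q² (Int-^ n Int-q²)) Ix)))
          (odd²~P k)
          (x * ȳ * ((1# + - q) * (1# + - q))
            , Int-* (Int-* Ix Int-ȳ) (Int-* (Int-1- Int-q) (Int-1- Int-q))
            , factors))
        where
        x : Carrier
        x = q² ^ k
        Ix : Int x
        Ix = Int-^ k Int-q²
        Io : Int (odd k)
        Io = Int-pochhammer k Int-q Int-q²
        φ-eq′ : 1# + - (q * y) ≈ (1# + - q) * φ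
        φ-eq′ = trans (+-congˡ (-‿cong (*-congˡ (sym (q-double n))))) φ-eq
        factors : (1# + - (q * x)) * (1# + - (q * x))
                    + - ((1# + - (ȳ * x)) * (1# + - (q² * y * x)))
                  ≈ φ * φ * (x * ȳ * ((1# + - q) * (1# + - q)))
        factors = linear₂
          (x * ȳ * (1# + - (q * y) + (1# + - q) * φ)) φ-eq′
          ((1# + 1#) * q * x + - (q * q * x * y) + - (q * q * x * x)) (pow-inverse n)
          (solve 5 (λ q x y ȳ φ →
            let c₁ = x :* ȳ :* (:1 :- q :* y :+ (:1 :- q) :* φ)
                c₂ = (:1 :+ :1) :* q :* x :+ (:- (q :* q :* x :* y)) :+ (:- (q :* q :* x :* x))
            in
            (:1 :- q :* x) :* (:1 :- q :* x) :- (:1 :- ȳ :* x) :* (:1 :- q :* (q :* :1) :* y :* x)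
              :+ c₁ :* ((:1 :- q) :* φ) :+ c₂ :* :1
            := φ :* φ :* (x :* ȳ :* ((:1 :- q) :* (:1 :- q)))
              :+ c₁ :* (:1 :- q :* y) :+ c₂ :* (y :* ȳ))
            refl q x y ȳ φ)

      ∑<-~ : ∀ N {f g : ℕ → Carrier} → (∀ k → k < N → f k ~ g k) → ∑< N f ~ ∑< N g
      ∑<-~ zero    f~g = ~-refl
      ∑<-~ (suc N) f~g = ~-+ (∑<-~ N (λ k k<N → f~g k (ℕ.m≤n⇒m≤1+n k<N))) (f~g N ℕ.≤-refl)

      ∑<-Int : ∀ N {f : ℕ → Carrier} → (∀ k → k < N → Int (f k)) → Int (∑< N f)
      ∑<-Int zero    If = Int-0
      ∑<-Int (suc N) If = Int-+ (∑<-Int N (λ k k<N → If k (ℕ.m≤n⇒m≤1+n k<N))) (If N ℕ.≤-refl)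

      module _ (s : ℕ) where
        truncatedSum : Carrier
        truncatedSum = sum {suc n} (λ i → summand s (toℕ i))

        truncatedSum≈ : truncatedSum ≈ ∑< (suc n) (λ k → q² ^ k * (odd k * odd k * (E k * E k)) * d k s)
        truncatedSum≈ = trans (sum-∑< (suc n) (summand s)) (∑<-cong (suc n) (summand-closed s))

        Int-truncatedSum : s ≤ n → Int truncatedSum
        Int-truncatedSum s≤n = Int-resp (sym truncatedSum≈) (∑<-Int (suc n) λ { k (s≤s k≤n) →
          let Io = Int-pochhammer k Int-q Int-q² in
          Int-* (Int-* (Int-^ k Int-q²) (Int-* (Int-* Io Io) (Int-* (Int-E k≤n) (Int-E k≤n))))
                (Int-d k≤n s≤n) })

        -- Read off the terminating sum equal to T, whose terms have the same denominators as the
        -- original summands.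
        Int-T : s ≤ n → Int (T n s)
        Int-T s≤n = Int-resp (Sₙ≈T n s) (∑<-Int (suc n) λ { k (s≤s k≤n) →
          Int-* (Int-* (Int-^ k Int-q²) (Int-* (Int-P k) (Int-* (Int-E k≤n) (Int-E k≤n))))
                (Int-d k≤n s≤n) })

        truncatedSum~T : s ≤ n → truncatedSum ~ T n s
        truncatedSum~T s≤n = ~-resp (sym truncatedSum≈) (Sₙ≈T n s) (∑<-~ (suc n) λ { k (s≤s k≤n) →
          let Ix = Int-^ k Int-q²
              Io = Int-pochhammer k Int-q Int-q²
              IE = Int-* (Int-E k≤n) (Int-E k≤n)
          in ~-* (Int-* Ix (Int-* (Int-* Io Io) IE)) (Int-d k≤n s≤n)
               (~-* Ix (Int-* (Int-P k) IE) ~-refl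
                 (~-* (Int-* Io Io) IE (odd²~P k) ~-refl))
               ~-refl })

-- Comaximality and greatest common divisors

module Comaximality {c ℓ} (R : CommutativeRing c ℓ) where
  open CommutativeRing R
  open ℤ-Solver R
  open RawSemiringDefinitions (Semiring.rawSemiring semiring)
    using (_^_; _∣_; Coprime) renaming (_×_ to _·_; sum to ∑)
  open Exp semiring using (^-assocʳ; ^-homo-*)

  open RawMagmaDefinitions *-rawMagma using () renaming (_,_ to _∣,_)

  -- An explicit Bézout identity passes to products and to factors by plain algebra, and it implies
  -- coprimality.
  Comaximal : Carrier → Carrier → Set (c ⊔ ℓ)
  Comaximal x y = ∃ λ u → ∃ λ v → u * x + v * y ≈ 1#

  comaximal⇒coprime : ∀ {x y} → Comaximal x y → Coprime x y
  comaximal⇒coprime {x} {y} (u , v , uv≈1) {z} (a ∣, az≈x) (b ∣, bz≈y) = (u * a + v * b) ∣,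
    linear₃ u az≈x v bz≈y 1# uv≈1
      (solve 7 (λ x y z u v a b →
        (u :* a :+ v :* b) :* z :+ u :* x :+ v :* y :+ :1 :* :1
          := :1 :+ u :* (a :* z) :+ v :* (b :* z) :+ :1 :* (u :* x :+ v :* y)) refl x y z u v a b)

  comaximal-resp : ∀ {x x′ y} → x ≈ x′ → Comaximal x y → Comaximal x′ y
  comaximal-resp x≈x′ (u , v , uv≈1) = u , v , trans (+-congʳ (*-congˡ (sym x≈x′))) uv≈1

  comaximal-1 : ∀ {y} → Comaximal 1# y
  comaximal-1 {y} = 1# , 0# , solve 1 (λ y → :1 :* :1 :+ :0 :* y := :1) refl y

  comaximal-* : ∀ {x x′ y} → Comaximal x y → Comaximal x′ y → Comaximal (x * x′) y
  comaximal-* {x} {x′} {y} (u , v , e) (u′ , v′ , e′) =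
    u * u′ , u * x * v′ + v * (u′ * x′ + v′ * y) , linear₂ (u′ * x′ + v′ * y) e 1# e′
      (solve 7 (λ x x′ y u v u′ v′ →
        u :* u′ :* (x :* x′) :+ (u :* x :* v′ :+ v :* (u′ :* x′ :+ v′ :* y)) :* y
          :+ (u′ :* x′ :+ v′ :* y) :* :1 :+ :1 :* :1
        := :1 :+ (u′ :* x′ :+ v′ :* y) :* (u :* x :+ v :* y) :+ :1 :* (u′ :* x′ :+ v′ :* y))
        refl x x′ y u v u′ v′)

  comaximal-factor : ∀ {x z y} → Comaximal (x * z) y → Comaximal x y
  comaximal-factor {x} {z} {y} (u , v , e) = u * z , v , trans
    (solve 5 (λ x z y u v → u :* z :* x :+ v :* y := u :* (x :* z) :+ v :* y) refl x z y u v) e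

  -- x divides y because a/x = b/y and a/x is in lowest terms.
  lowest-den : ∀ {a x b y z} → Comaximal a x → a * y ≈ b * x → Comaximal y z → Comaximal x z
  lowest-den {a} {x} {b} {y} (u , v , e) ay≈bx = λ y⊥z →
    comaximal-factor {z = u * b + v * y} (comaximal-resp (linear₂ (- y) e u ay≈bx
      (solve 6 (λ a x b y u v →
        y :+ (:- y) :* :1 :+ u :* (b :* x)
          := x :* (u :* b :+ v :* y) :+ (:- y) :* (u :* a :+ v :* x) :+ u :* (a :* y)) refl a x b y u v)) y⊥z)

  -- Squaring uy + vz = 1 gives 1 = y·u(uy + 2vz) + v²z²; multiplied by a, both terms on the right
  -- are multiples of z². The factor `1# * 1# * y` is the literal denominator of a product of two
  -- polynomials with a fraction over y.
  square-divides : ∀ {a x b y z} → Comaximal y z →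
    a * (1# * 1# * y) ≈ z * z * b * x → z ^ 2 ∣ a
  square-divides {a} {x} {b} {y} {z} (u , v , e) eq =
    (b * x * (u * (u * y + (1# + 1#) * (v * z))) + a * (v * v)) ∣,
    linear₂ (u * (u * y + (1# + 1#) * (v * z))) (sym eq) (a * (u * y + v * z + 1#)) e
      (solve 7 (λ a x b y z u v →
        let c₁ = u :* (u :* y :+ (:1 :+ :1) :* (v :* z))
            c₂ = a :* (u :* y :+ v :* z :+ :1)
        in (b :* x :* c₁ :+ a :* (v :* v)) :* (z :* (z :* :1))
             :+ c₁ :* (a :* (:1 :* :1 :* y)) :+ c₂ :* :1
           := a :+ c₁ :* (z :* z :* b :* x) :+ c₂ :* (u :* y :+ v :* z)) refl a x b y z u v)

  -- Comaximality of the cofactors takes the place of the universal property: it is what makes x′/y′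
  -- a fraction in lowest terms.
  record GCD (x y : Carrier) : Set (c ⊔ ℓ) where
    constructor mkGCD
    field
      d x′ y′ : Carrier
      x≈ : x ≈ x′ * d
      y≈ : y ≈ y′ * d
      comaximal : Comaximal x′ y′

  gcd-sym : ∀ {x y} → GCD x y → GCD y x
  gcd-sym (mkGCD d x′ y′ x≈ y≈ (u , v , e)) = mkGCD d y′ x′ y≈ x≈ (v , u , trans (+-comm _ _) e)

  gcd-resp : ∀ {x₁ x₂ y} → x₁ ≈ x₂ → GCD x₁ y → GCD x₂ y
  gcd-resp x₁≈x₂ (mkGCD d x′ y′ x≈ y≈ e) = mkGCD d x′ y′ (trans (sym x₁≈x₂) x≈) y≈ e

  gcd-zero : ∀ y → GCD 0# y
  gcd-zero y = mkGCD y 0# 1# (sym (zeroˡ y)) (sym (*-identityˡ y))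
    (0# , 1# , solve 0 (:0 :* :0 :+ :1 :* :1 := :1) refl)

  gcd-scale : ∀ {x y} z → GCD x y → GCD (z * x) (z * y)
  gcd-scale z (mkGCD d x′ y′ x≈ y≈ e) = mkGCD (z * d) x′ y′ (scale′ x≈) (scale′ y≈) e
    where
    scale′ : ∀ {x x′} → x ≈ x′ * d → z * x ≈ x′ * (z * d)
    scale′ {x} {x′} x≈ = trans (*-congˡ x≈)
      (solve 3 (λ z x′ d → z :* (x′ :* d) := x′ :* (z :* d)) refl z x′ d)

  -- An element comaximal with y is comaximal with the divisor y′ of y, so z can be absorbed into
  -- the cofactor of x.
  gcd-strip : ∀ {x y z} → Comaximal z y → GCD x y → GCD (z * x) y
  gcd-strip {x} {y} {z} (u , v , e) (mkGCD d x′ y′ x≈ y≈ coprime) =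
    mkGCD d (z * x′) y′ (trans (*-congˡ x≈) (sym (*-assoc z x′ d))) y≈
      (comaximal-* z⊥y′ coprime)
    where
    z⊥y′ : Comaximal z y′
    z⊥y′ = u , v * d , linear₂ 1# e (- v) y≈
      (solve 6 (λ u v d y y′ z →
        u :* z :+ v :* d :* y′ :+ :1 :* :1 :+ (:- v) :* (y′ :* d)
          := :1 :+ :1 :* (u :* z :+ v :* y) :+ (:- v) :* y) refl u v d y y′ z)

  gcd-add : ∀ {x y} z → GCD x y → GCD (x + z * y) y
  gcd-add {x} {y} z (mkGCD d x′ y′ x≈ y≈ (u , v , e)) = mkGCD d (x′ + z * y′) y′
    (linear₂ 1# x≈ z y≈
      (solve 6 (λ x y z x′ y′ d →
        x :+ z :* y :+ :1 :* (x′ :* d) :+ z :* (y′ :* d)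
          := (x′ :+ z :* y′) :* d :+ :1 :* x :+ z :* y) refl x y z x′ y′ d))
    y≈
    (u , v + - (u * z) , trans
      (solve 5 (λ x′ y′ z u v →
        u :* (x′ :+ z :* y′) :+ (v :- u :* z) :* y′ := u :* x′ :+ v :* y′) refl x′ y′ z u v) e)

  geometric : Carrier → ℕ → Carrier
  geometric x p = ∑ {p} (λ i → x ^ toℕ i)

  geometric-suc : ∀ x p → geometric x (suc p) ≈ 1# + x * geometric x p
  geometric-suc x p = +-congˡ (sym (Sum.*-distribˡ-sum semiring {p} x (λ i → x ^ toℕ i)))

  geometric-factor : ∀ x p → 1# + - (x ^ p) ≈ (1# + - x) * geometric x p
  geometric-factor x zero    = solve 1 (λ x → :1 :- :1 := (:1 :- x) :* :0) refl x
  geometric-factor x (suc p) = linear₂ x (geometric-factor x p) (- (1# + - x)) (geometric-suc x p)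
    (solve 4 (λ x y g g′ →
      :1 :- x :* y :+ x :* ((:1 :- x) :* g) :+ (:- (:1 :- x)) :* (:1 :+ x :* g)
        := (:1 :- x) :* g′ :+ x :* (:1 :- y) :+ (:- (:1 :- x)) :* g′)
      refl x (x ^ p) (geometric x p) (geometric x (suc p)))

  geometric-at-1 : ∀ x p → ∃ λ h → geometric x p ≈ p · 1# + (1# + - x) * h
  geometric-at-1 x zero    = 0# , solve 1 (λ x → :0 := :0 :+ (:1 :- x) :* :0) refl x
  geometric-at-1 x (suc p) with geometric-at-1 x p
  ... | h , e = h + - geometric x p , linear₂ 1# (geometric-suc x p) 1# e
    (solve 5 (λ x g g′ h n →
      g′ :+ :1 :* (:1 :+ x :* g) :+ :1 :* (n :+ (:1 :- x) :* h)
        := :1 :+ n :+ (:1 :- x) :* (h :- g) :+ :1 :* g′ :+ :1 :* g)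
      refl x (geometric x p) (geometric x (suc p)) h (p · 1#))

  module _ (x : Carrier) (p : ℕ) (p̄ : Carrier) (pp̄≈1 : p · 1# * p̄ ≈ 1#) where
    private
      Φ : Carrier
      Φ = geometric x p

    x⊥Φ : ∀ {m} → p ≡ suc m → Comaximal x Φ
    x⊥Φ {m} ≡.refl = - geometric x m , 1# , linear₁ 1# (geometric-suc x m)
      (solve 3 (λ x g g′ → (:- g) :* x :+ :1 :* g′ :+ :1 :* (:1 :+ x :* g) := :1 :+ :1 :* g′)
        refl x (geometric x m) Φ)

    -- Modulo 1 - x the geometric sum becomes p, which is invertible by assumption.
    1-x⊥Φ : Comaximal (1# + - x) Φ
    1-x⊥Φ with geometric-at-1 x p
    ... | h , e = - (p̄ * h) , p̄ , linear₂ p̄ e 1# pp̄≈1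
      (solve 5 (λ x h g n p̄ →
        (:- (p̄ :* h)) :* (:1 :- x) :+ p̄ :* g :+ p̄ :* (n :+ (:1 :- x) :* h) :+ :1 :* :1
          := :1 :+ p̄ :* g :+ :1 :* (n :* p̄)) refl x h Φ (p · 1#) p̄)

    -- 1 − x is a combination of 1 − xʲ and 1 − xᵖ, read off a Bézout identity for j and p.
    1-xʲ⊥Φ : ∀ {j} → Identity 1 j p → Comaximal (1# + - (x ^ j)) Φ
    1-xʲ⊥Φ {j} identity = combine 1-x⊥Φ (split identity)
      where
      multiple : ∀ k i → ∃ λ g → 1# + - (x ^ (i ℕ.* k)) ≈ g * (1# + - (x ^ k))
      multiple k i = geometric (x ^ k) i ,
        trans (+-congˡ (-‿cong (trans (reflexive (≡.cong (x ^_) (ℕ.*-comm i k))) (sym (^-assocʳ x k i)))))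
          (trans (geometric-factor (x ^ k) i) (*-comm _ _))

      Split : Set (c ⊔ ℓ)
      Split = ∃ λ u → ∃ λ v → 1# + - x ≈ u * (1# + - (x ^ j)) + v * (1# + - (x ^ p))

      split : Identity 1 j p → Split
      split (+- a b eq) with multiple j a | multiple p b
      -- 1 - x = (1 - x^{1+bp}) - x (1 - x^{bp}), where 1 + bp = aj.
      ... | g , eg | h , eh = g , - (x * h) , linear₂ 1# eg′ (- x) eh
        (solve 6 (λ x y g h J P →
          :1 :- x :+ :1 :* (g :* J) :+ (:- x) :* (h :* P)
            := g :* J :+ (:- (x :* h)) :* P :+ :1 :* (:1 :- x :* y) :+ (:- x) :* (:1 :- y))
          refl x (x ^ (b ℕ.* p)) g h (1# + - (x ^ j)) (1# + - (x ^ p)))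
        where
        eg′ : 1# + - (x * x ^ (b ℕ.* p)) ≈ g * (1# + - (x ^ j))
        eg′ = trans (reflexive (≡.cong (λ k → 1# + - (x ^ k)) eq)) eg
      split (-+ a b eq) with multiple j a | multiple p b
      ... | g , eg | h , eh = - (x * g) , h , linear₂ 1# eh′ (- x) eg
        (solve 6 (λ x y g h J P →
          :1 :- x :+ :1 :* (h :* P) :+ (:- x) :* (g :* J)
            := (:- (x :* g)) :* J :+ h :* P :+ :1 :* (:1 :- x :* y) :+ (:- x) :* (:1 :- y))
          refl x (x ^ (a ℕ.* j)) g h (1# + - (x ^ j)) (1# + - (x ^ p)))
        where
        eh′ : 1# + - (x * x ^ (a ℕ.* j)) ≈ h * (1# + - (x ^ p))
        eh′ = trans (reflexive (≡.cong (λ k → 1# + - (x ^ k)) eq)) eh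

      combine : Comaximal (1# + - x) Φ → Split → Comaximal (1# + - (x ^ j)) Φ
      combine (w , z , e) (u , v , e′) = w * u , w * v * (1# + - x) + z ,
        linear₃ 1# e (- w) e′ (- (w * v)) (geometric-factor x p)
          (solve 8 (λ x w z u v J P g →
            w :* u :* J :+ (w :* v :* (:1 :- x) :+ z) :* g
              :+ :1 :* :1 :+ (:- w) :* (u :* J :+ v :* P) :+ (:- (w :* v)) :* ((:1 :- x) :* g)
            := :1 :+ :1 :* (w :* (:1 :- x) :+ z :* g) :+ (:- w) :* (:1 :- x) :+ (:- (w :* v)) :* P)
            refl x w z u v (1# + - (x ^ j)) (1# + - (x ^ p)) Φ)

-- Laws of fractions as cross-multiplied identities

module CrossMultiplication {c ℓ} (R : CommutativeRing c ℓ) where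
  open CommutativeRing R
  open ℤ-Solver R

  -- Transitivity holds only up to the middle denominator y; over ℚ[q] it is cancelled because there
  -- are no zero divisors.
  trans-× : ∀ a x b y c z → a * y ≈ b * x → b * z ≈ c * y →
            (a * z + - (c * x)) * y ≈ 0#
  trans-× a x b y c z ay≈bx bz≈cy = linear₂ z ay≈bx x bz≈cy
    (solve 6 (λ a x b y c z →
      (a :* z :+ :- (c :* x)) :* y :+ z :* (b :* x) :+ x :* (c :* y)
        := :0 :+ z :* (a :* y) :+ x :* (b :* z)) refl a x b y c z)

  difference≈0 : ∀ u v → u + - v ≈ 0# → u ≈ v
  difference≈0 u v eq = linear₁ 1# eq
    (solve 2 (λ u v → u :+ :1 :* :0 := v :+ :1 :* (u :+ :- v)) refl u v)

  +-cong-× : ∀ a x a′ x′ b y b′ y′ → a * x′ ≈ a′ * x → b * y′ ≈ b′ * y →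
             (a * y + b * x) * (x′ * y′) ≈ (a′ * y′ + b′ * x′) * (x * y)
  +-cong-× a x a′ x′ b y b′ y′ e₁ e₂ = linear₂ (y * y′) e₁ (x * x′) e₂
    (solve 8 (λ a x a′ x′ b y b′ y′ →
      (a :* y :+ b :* x) :* (x′ :* y′) :+ y :* y′ :* (a′ :* x) :+ x :* x′ :* (b′ :* y)
        := (a′ :* y′ :+ b′ :* x′) :* (x :* y) :+ y :* y′ :* (a :* x′) :+ x :* x′ :* (b :* y′))
      refl a x a′ x′ b y b′ y′)

  *-cong-× : ∀ a x a′ x′ b y b′ y′ → a * x′ ≈ a′ * x → b * y′ ≈ b′ * y →
             (a * b) * (x′ * y′) ≈ (a′ * b′) * (x * y)
  *-cong-× a x a′ x′ b y b′ y′ e₁ e₂ = linear₂ (b * y′) e₁ (a′ * x) e₂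
    (solve 8 (λ a x a′ x′ b y b′ y′ →
      (a :* b) :* (x′ :* y′) :+ b :* y′ :* (a′ :* x) :+ a′ :* x :* (b′ :* y)
        := (a′ :* b′) :* (x :* y) :+ b :* y′ :* (a :* x′) :+ a′ :* x :* (b :* y′))
      refl a x a′ x′ b y b′ y′)

  -‿cong-× : ∀ a x a′ x′ → a * x′ ≈ a′ * x → - a * x′ ≈ - a′ * x
  -‿cong-× a x a′ x′ e = linear₁ (- 1#) e
    (solve 4 (λ a x a′ x′ →
      (:- a) :* x′ :+ (:- :1) :* (a′ :* x) := (:- a′) :* x :+ (:- :1) :* (a :* x′))
      refl a x a′ x′)

  +-assoc-× : ∀ a x b y c z →
    ((a * y + b * x) * z + c * (x * y)) * (x * (y * z)) ≈
    (a * (y * z) + (b * z + c * y) * x) * ((x * y) * z)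
  +-assoc-× = solve 6 (λ a x b y c z →
    ((a :* y :+ b :* x) :* z :+ c :* (x :* y)) :* (x :* (y :* z)) :=
    (a :* (y :* z) :+ (b :* z :+ c :* y) :* x) :* ((x :* y) :* z)) refl

  +-comm-× : ∀ a x b y → (a * y + b * x) * (y * x) ≈ (b * x + a * y) * (x * y)
  +-comm-× = solve 4 (λ a x b y →
    (a :* y :+ b :* x) :* (y :* x) := (b :* x :+ a :* y) :* (x :* y)) refl

  +-identityˡ-× : ∀ a x → (0# * x + a * 1#) * x ≈ a * (1# * x)
  +-identityˡ-× = solve 2 (λ a x → (:0 :* x :+ a :* :1) :* x := a :* (:1 :* x)) refl

  -‿inverseʳ-× : ∀ a x → (a * x + - a * x) * 1# ≈ 0# * (x * x)
  -‿inverseʳ-× = solve 2 (λ a x → (a :* x :+ (:- a) :* x) :* :1 := :0 :* (x :* x)) refl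

  *-assoc-× : ∀ a x b y c z → ((a * b) * c) * (x * (y * z)) ≈ (a * (b * c)) * ((x * y) * z)
  *-assoc-× = solve 6 (λ a x b y c z →
    ((a :* b) :* c) :* (x :* (y :* z)) := (a :* (b :* c)) :* ((x :* y) :* z)) refl

  *-comm-× : ∀ a x b y → (a * b) * (y * x) ≈ (b * a) * (x * y)
  *-comm-× = solve 4 (λ a x b y → (a :* b) :* (y :* x) := (b :* a) :* (x :* y)) refl

  *-identityˡ-× : ∀ a x → (1# * a) * x ≈ a * (1# * x)
  *-identityˡ-× = solve 2 (λ a x → (:1 :* a) :* x := a :* (:1 :* x)) refl

  distribˡ-× : ∀ a x b y c z →
    (a * (b * z + c * y)) * ((x * y) * (x * z)) ≈
    ((a * b) * (x * z) + (a * c) * (x * y)) * (x * (y * z))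
  distribˡ-× = solve 6 (λ a x b y c z →
    (a :* (b :* z :+ c :* y)) :* ((x :* y) :* (x :* z)) :=
    ((a :* b) :* (x :* z) :+ (a :* c) :* (x :* y)) :* (x :* (y :* z))) refl

  inverseʳ-× : ∀ a x → (a * x) * 1# ≈ 1# * (x * a)
  inverseʳ-× = solve 2 (λ a x → (a :* x) :* :1 := :1 :* (x :* a)) refl

-- Transfer along a ring homomorphism

module Homomorphism {r ℓr s ℓs} (R : CommutativeRing r ℓr) (S : CommutativeRing s ℓs)
  (ι : CommutativeRing.Carrier R → CommutativeRing.Carrier S) where
  private
    module R = CommutativeRing R
    module R′ = RawSemiringDefinitions (Semiring.rawSemiring R.semiring)
  open CommutativeRing S renaming (Carrier to A)
  open RawSemiringDefinitions (Semiring.rawSemiring semiring) using (_^_)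
  open Exp semiring using (^-assocʳ)
  module Laws (ι-cong : ∀ {x y} → x R.≈ y → ι x ≈ ι y)
           (ι-+ : ∀ x y → ι (x R.+ y) ≈ ι x + ι y)
           (ι-* : ∀ x y → ι (x R.* y) ≈ ι x * ι y)
           (ι-neg : ∀ x → ι (R.- x) ≈ - ι x)
           (ι-1 : ι R.1# ≈ 1#) where

    ι-^ : ∀ x k → ι (x R′.^ k) ≈ ι x ^ k
    ι-^ x zero    = ι-1
    ι-^ x (suc k) = trans (ι-* x _) (*-congˡ (ι-^ x k))

    ι-1- : ∀ x → ι (R.1# R.+ R.- x) ≈ 1# + - ι x
    ι-1- x = trans (ι-+ R.1# (R.- x)) (+-cong ι-1 (ι-neg x))

    ι-1-^ : ∀ x k → ι (R.1# R.+ R.- (x R′.^ k)) ≈ 1# + - (ι x ^ k)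
    ι-1-^ x k = trans (ι-1- _) (+-congˡ (-‿cong (ι-^ x k)))

    unit-1-^ : ∀ x k y → ι (R.1# R.+ R.- (x R′.^ k)) * y ≈ 1# → (1# + - (ι x ^ k)) * y ≈ 1#
    unit-1-^ x k y e = trans (*-congʳ (sym (ι-1-^ x k))) e

    unit-1-^² : ∀ x k y → ι (R.1# R.+ R.- (x R′.^ (2 ℕ.* k))) * y ≈ 1# →
                (1# + - ((ι x ^ 2) ^ k)) * y ≈ 1#
    unit-1-^² x k y e =
      trans (*-congʳ (+-congˡ (-‿cong (^-assocʳ (ι x) 2 k)))) (unit-1-^ x (2 ℕ.* k) y e)

    ι-factor : ∀ x k g → R.1# R.+ R.- (x R′.^ k) R.≈ (R.1# R.+ R.- x) R.* g →
               1# + - (ι x ^ k) ≈ (1# + - ι x) * ι g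
    ι-factor x k g e = trans (sym (ι-1-^ x k))
      (trans (ι-cong e) (trans (ι-* _ g) (*-congʳ (ι-1- x))))

-- An element possessing some inverse is nonzero, so the convention for 0⁻¹ never intervenes.
inverse-of-unit : ∀ {c ℓ} (S : CommutativeRing c ℓ) → let open CommutativeRing S in
  (inv : Carrier → Carrier) → (∀ x → ¬ (x ≈ 0#) → x * inv x ≈ 1#) → ¬ (1# ≈ 0#) →
  ∀ x y → x * y ≈ 1# → x * inv x ≈ 1#
inverse-of-unit S inv inv-≉0 1≉0 x y xy≈1 =
  inv-≉0 x (λ x≈0 → 1≉0 (trans (sym xy≈1) (trans (*-congʳ x≈0) (zeroˡ y))))
  where open CommutativeRing S

open import Defs
open import Data.Nat.Base using (ℕ; _+_; _*_; _∸_; _^_; _≤_)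
open import Data.Nat.Coprimality using (Coprime; coprime-Bézout)
open import Data.Nat.Divisibility using (_∣_; divides; >⇒∤)
open import Data.Nat.DivMod using (_/_; _%_; m*n/n≡m)
open import Data.Nat.Primality using (Prime; prime[2]; ¬prime[1]; euclidsLemma; prime⇒irreducible)
open import Data.Nat.Properties using (_≟_)
open import Relation.Nullary.Decidable using (⌊_⌋)

-- The ring ℚ[q] and its field of fractions

≈ₚ-refl : ∀ {f} → f ≈ₚ f
≈ₚ-refl = coeffwise λ _ → ≡.refl

≈ₚ-sym : ∀ {f g} → f ≈ₚ g → g ≈ₚ f
≈ₚ-sym f≈g = coeffwise λ n → ≡.sym (at f≈g n)

≈ₚ-trans : ∀ {f g h} → f ≈ₚ g → g ≈ₚ h → f ≈ₚ h
≈ₚ-trans f≈g g≈h = coeffwise λ n → ≡.trans (at f≈g n) (at g≈h n)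

∷-cong : ∀ {a b f g} → a ≡ b → f ≈ₚ g → a ∷ f ≈ₚ b ∷ g
∷-cong a≡b f≈g = coeffwise λ { zero → a≡b ; (suc n) → at f≈g n }

scale : ℚ → Poly → Poly
scale a = map (a ℚ.*_)

coeff-neg : ∀ f n → coeff (-ₚ f) n ≡ ℚ.- coeff f n
coeff-neg []      n       = ≡.refl
coeff-neg (a ∷ f) zero    = ≡.refl
coeff-neg (a ∷ f) (suc n) = coeff-neg f n

+ₚ-cong : ∀ {f f′ g g′} → f ≈ₚ f′ → g ≈ₚ g′ → f +ₚ g ≈ₚ f′ +ₚ g′
+ₚ-cong {f} {f′} {g} {g′} f≈ g≈ = coeffwise λ n →
  ≡.trans (coeff-+ f g n)
    (≡.trans (≡.cong₂ ℚ._+_ (at f≈ n) (at g≈ n)) (≡.sym (coeff-+ f′ g′ n)))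

-ₚ-cong : ∀ {f g} → f ≈ₚ g → -ₚ f ≈ₚ -ₚ g
-ₚ-cong {f} {g} f≈g = coeffwise λ n →
  ≡.trans (coeff-neg f n) (≡.trans (≡.cong ℚ.-_ (at f≈g n)) (≡.sym (coeff-neg g n)))

+ₚ-assoc : ∀ f g h → (f +ₚ g) +ₚ h ≈ₚ f +ₚ (g +ₚ h)
+ₚ-assoc f g h = coeffwise λ n → begin
  coeff ((f +ₚ g) +ₚ h) n                     ≡⟨ coeff-+ (f +ₚ g) h n ⟩
  coeff (f +ₚ g) n ℚ.+ coeff h n              ≡⟨ ≡.cong (ℚ._+ coeff h n) (coeff-+ f g n) ⟩
  coeff f n ℚ.+ coeff g n ℚ.+ coeff h n       ≡⟨ ℚ.+-assoc (coeff f n) (coeff g n) (coeff h n) ⟩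
  coeff f n ℚ.+ (coeff g n ℚ.+ coeff h n)     ≡⟨ ≡.cong (coeff f n ℚ.+_) (coeff-+ g h n) ⟨
  coeff f n ℚ.+ coeff (g +ₚ h) n              ≡⟨ coeff-+ f (g +ₚ h) n ⟨
  coeff (f +ₚ (g +ₚ h)) n                     ∎
  where open ≡.≡-Reasoning

+ₚ-comm : ∀ f g → f +ₚ g ≈ₚ g +ₚ f
+ₚ-comm f g = coeffwise λ n →
  ≡.trans (coeff-+ f g n)
    (≡.trans (ℚ.+-comm (coeff f n) (coeff g n)) (≡.sym (coeff-+ g f n)))

+ₚ-identityʳ : ∀ f → f +ₚ 0ₚ ≈ₚ f
+ₚ-identityʳ f = +ₚ-comm f 0ₚ

-ₚ-inverseʳ : ∀ f → f +ₚ -ₚ f ≈ₚ 0ₚ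
-ₚ-inverseʳ f = coeffwise λ n →
  ≡.trans (coeff-+ f (-ₚ f) n)
    (≡.trans (≡.cong (coeff f n ℚ.+_) (coeff-neg f n)) (ℚ.+-inverseʳ (coeff f n)))

+ₚ-interchange : ∀ f g h k → (f +ₚ g) +ₚ (h +ₚ k) ≈ₚ (f +ₚ h) +ₚ (g +ₚ k)
+ₚ-interchange f g h k =
  ≈ₚ-trans (+ₚ-assoc f g (h +ₚ k))
    (≈ₚ-trans (+ₚ-cong (≈ₚ-refl {f})
        (≈ₚ-trans (≈ₚ-sym (+ₚ-assoc g h k))
          (≈ₚ-trans (+ₚ-cong (+ₚ-comm g h) (≈ₚ-refl {k})) (+ₚ-assoc h g k))))
      (≈ₚ-sym (+ₚ-assoc f h (g +ₚ k))))

scale-cong : ∀ {a f g} → f ≈ₚ g → scale a f ≈ₚ scale a g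
scale-cong {a} {f} {g} f≈g = coeffwise λ n →
  ≡.trans (coeff-scale a f n)
    (≡.trans (≡.cong (a ℚ.*_) (at f≈g n)) (≡.sym (coeff-scale a g n)))

scale-+ₚ : ∀ a f g → scale a (f +ₚ g) ≈ₚ scale a f +ₚ scale a g
scale-+ₚ a f g = coeffwise λ n → begin
  coeff (scale a (f +ₚ g)) n                   ≡⟨ coeff-scale a (f +ₚ g) n ⟩
  a ℚ.* coeff (f +ₚ g) n                       ≡⟨ ≡.cong (a ℚ.*_) (coeff-+ f g n) ⟩
  a ℚ.* (coeff f n ℚ.+ coeff g n)              ≡⟨ ℚ.*-distribˡ-+ a (coeff f n) (coeff g n) ⟩
  a ℚ.* coeff f n ℚ.+ a ℚ.* coeff g n          ≡⟨ ≡.cong₂ ℚ._+_ (coeff-scale a f n) (coeff-scale a g n) ⟨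
  coeff (scale a f) n ℚ.+ coeff (scale a g) n  ≡⟨ coeff-+ (scale a f) (scale a g) n ⟨
  coeff (scale a f +ₚ scale a g) n             ∎
  where open ≡.≡-Reasoning

+-scale : ∀ a b f → scale (a ℚ.+ b) f ≈ₚ scale a f +ₚ scale b f
+-scale a b f = coeffwise λ n → begin
  coeff (scale (a ℚ.+ b) f) n                  ≡⟨ coeff-scale (a ℚ.+ b) f n ⟩
  (a ℚ.+ b) ℚ.* coeff f n                      ≡⟨ ℚ.*-distribʳ-+ (coeff f n) a b ⟩
  a ℚ.* coeff f n ℚ.+ b ℚ.* coeff f n          ≡⟨ ≡.cong₂ ℚ._+_ (coeff-scale a f n) (coeff-scale b f n) ⟨
  coeff (scale a f) n ℚ.+ coeff (scale b f) n  ≡⟨ coeff-+ (scale a f) (scale b f) n ⟨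
  coeff (scale a f +ₚ scale b f) n             ∎
  where open ≡.≡-Reasoning

scale-scale : ∀ a b f → scale a (scale b f) ≈ₚ scale (a ℚ.* b) f
scale-scale a b f = coeffwise λ n → begin
  coeff (scale a (scale b f)) n   ≡⟨ coeff-scale a (scale b f) n ⟩
  a ℚ.* coeff (scale b f) n       ≡⟨ ≡.cong (a ℚ.*_) (coeff-scale b f n) ⟩
  a ℚ.* (b ℚ.* coeff f n)         ≡⟨ ℚ.*-assoc a b (coeff f n) ⟨
  a ℚ.* b ℚ.* coeff f n           ≡⟨ coeff-scale (a ℚ.* b) f n ⟨
  coeff (scale (a ℚ.* b) f) n     ∎
  where open ≡.≡-Reasoning

scale-1 : ∀ f → scale 1ℚ f ≈ₚ f
scale-1 f = coeffwise λ n → ≡.trans (coeff-scale 1ℚ f n) (ℚ.*-identityˡ (coeff f n))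

scale-X : ∀ a f → scale a (0ℚ ∷ f) ≈ₚ 0ℚ ∷ scale a f
scale-X a f = ∷-cong (ℚ.*-zeroʳ a) ≈ₚ-refl

0∷0≈0 : 0ℚ ∷ [] ≈ₚ 0ₚ
0∷0≈0 = coeffwise λ { zero → ≡.refl ; (suc _) → ≡.refl }

*ₚ-zeroʳ : ∀ f → f *ₚ 0ₚ ≈ₚ 0ₚ
*ₚ-zeroʳ []      = ≈ₚ-refl
*ₚ-zeroʳ (a ∷ f) = ≈ₚ-trans (∷-cong ≡.refl (*ₚ-zeroʳ f)) 0∷0≈0

*ₚ-congˡ : ∀ f {g g′} → g ≈ₚ g′ → f *ₚ g ≈ₚ f *ₚ g′
*ₚ-congˡ []      g≈ = ≈ₚ-refl
*ₚ-congˡ (a ∷ f) {g} {g′} g≈ =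
  +ₚ-cong (scale-cong {a} {g} {g′} g≈) (∷-cong ≡.refl (*ₚ-congˡ f g≈))

-- Multiplication recurses on its left factor; this mirror recursion on the right factor yields
-- commutativity.
*ₚ-∷ : ∀ f b g → f *ₚ (b ∷ g) ≈ₚ scale b f +ₚ (0ℚ ∷ (f *ₚ g))
*ₚ-∷ []      b g = ≈ₚ-sym 0∷0≈0
*ₚ-∷ (a ∷ f) b g = ∷-cong (≡.cong (ℚ._+ 0ℚ) (ℚ.*-comm a b))
  (≈ₚ-trans (+ₚ-cong (≈ₚ-refl {scale a g}) (*ₚ-∷ f b g))
    (≈ₚ-trans (≈ₚ-sym (+ₚ-assoc (scale a g) (scale b f) _))
      (≈ₚ-trans (+ₚ-cong (+ₚ-comm (scale a g) (scale b f)) ≈ₚ-refl)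
        (+ₚ-assoc (scale b f) (scale a g) _))))

*ₚ-comm : ∀ f g → f *ₚ g ≈ₚ g *ₚ f
*ₚ-comm []      g = ≈ₚ-sym (*ₚ-zeroʳ g)
*ₚ-comm (a ∷ f) g =
  ≈ₚ-trans (+ₚ-cong (≈ₚ-refl {scale a g}) (∷-cong ≡.refl (*ₚ-comm f g))) (≈ₚ-sym (*ₚ-∷ g a f))

*ₚ-cong : ∀ {f f′ g g′} → f ≈ₚ f′ → g ≈ₚ g′ → f *ₚ g ≈ₚ f′ *ₚ g′
*ₚ-cong {f} {f′} {g} {g′} f≈ g≈ =
  ≈ₚ-trans (*ₚ-congˡ f g≈)
    (≈ₚ-trans (*ₚ-comm f g′) (≈ₚ-trans (*ₚ-congˡ g′ f≈) (*ₚ-comm g′ f′)))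

*ₚ-distribʳ : ∀ h f g → (f +ₚ g) *ₚ h ≈ₚ f *ₚ h +ₚ g *ₚ h
*ₚ-distribʳ h []      g       = ≈ₚ-refl
*ₚ-distribʳ h (a ∷ f) []      = ≈ₚ-sym (+ₚ-identityʳ _)
*ₚ-distribʳ h (a ∷ f) (b ∷ g) =
  ≈ₚ-trans (+ₚ-cong (+-scale a b h) (∷-cong ≡.refl (*ₚ-distribʳ h f g)))
    (+ₚ-interchange (scale a h) (scale b h) (0ℚ ∷ (f *ₚ h)) (0ℚ ∷ (g *ₚ h)))

scale-*ₚ : ∀ a f g → scale a f *ₚ g ≈ₚ scale a (f *ₚ g)
scale-*ₚ a []      g = ≈ₚ-refl
scale-*ₚ a (b ∷ f) g =
  ≈ₚ-trans (+ₚ-cong (≈ₚ-sym (scale-scale a b g)) (∷-cong ≡.refl (scale-*ₚ a f g)))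
    (≈ₚ-trans (+ₚ-cong ≈ₚ-refl (≈ₚ-sym (scale-X a (f *ₚ g))))
      (≈ₚ-sym (scale-+ₚ a (scale b g) (0ℚ ∷ (f *ₚ g)))))

X*ₚ : ∀ f g → (0ℚ ∷ f) *ₚ g ≈ₚ 0ℚ ∷ (f *ₚ g)
X*ₚ f g = coeffwise (coeff-0∷* f g)

*ₚ-assoc : ∀ f g h → (f *ₚ g) *ₚ h ≈ₚ f *ₚ (g *ₚ h)
*ₚ-assoc []      g h = ≈ₚ-refl
*ₚ-assoc (a ∷ f) g h =
  ≈ₚ-trans (*ₚ-distribʳ h (scale a g) (0ℚ ∷ (f *ₚ g)))
    (+ₚ-cong (scale-*ₚ a g h)
      (≈ₚ-trans (X*ₚ (f *ₚ g) h) (∷-cong ≡.refl (*ₚ-assoc f g h))))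

const-*ₚ : ∀ a g → (a ∷ []) *ₚ g ≈ₚ scale a g
const-*ₚ a g = ≈ₚ-trans (+ₚ-cong ≈ₚ-refl 0∷0≈0) (+ₚ-identityʳ (scale a g))

*ₚ-identityˡ : ∀ f → 1ₚ *ₚ f ≈ₚ f
*ₚ-identityˡ f = ≈ₚ-trans (const-*ₚ 1ℚ f) (scale-1 f)

ℚ[q]-commutativeRing : CommutativeRing 0ℓ 0ℓ
ℚ[q]-commutativeRing = record
  { Carrier = Poly
  ; _≈_ = _≈ₚ_
  ; _+_ = _+ₚ_
  ; _*_ = _*ₚ_
  ; -_  = -ₚ_
  ; 0#  = 0ₚ
  ; 1#  = 1ₚ
  ; isCommutativeRing = record
    { isRing = record
      { +-isAbelianGroup = record
        { isGroup = record
          { isMonoid = record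
            { isSemigroup = record
              { isMagma = record
                { isEquivalence = record { refl = ≈ₚ-refl ; sym = ≈ₚ-sym ; trans = ≈ₚ-trans }
                ; ∙-cong = +ₚ-cong
                }
              ; assoc = +ₚ-assoc
              }
            ; identity = (λ f → ≈ₚ-refl) , +ₚ-identityʳ
            }
          ; inverse = (λ f → ≈ₚ-trans (+ₚ-comm (-ₚ f) f) (-ₚ-inverseʳ f)) , -ₚ-inverseʳ
          ; ⁻¹-cong = -ₚ-cong
          }
        ; comm = +ₚ-comm
        }
      ; *-cong = *ₚ-cong
      ; *-assoc = *ₚ-assoc
      ; *-identity = *ₚ-identityˡ , λ f → ≈ₚ-trans (*ₚ-comm f 1ₚ) (*ₚ-identityˡ f)
      ; distrib = (λ h f g → ≈ₚ-trans (*ₚ-comm h (f +ₚ g))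
                    (≈ₚ-trans (*ₚ-distribʳ h f g) (+ₚ-cong (*ₚ-comm f h) (*ₚ-comm g h))))
                , *ₚ-distribʳ
      }
    ; *-comm = *ₚ-comm
    }
  }

private
  module × = CrossMultiplication ℚ[q]-commutativeRing

≃-refl : ∀ {A} → A ≃ A
≃-refl = ≈ₚ-refl

≃-sym : ∀ {A B} → A ≃ B → B ≃ A
≃-sym = ≈ₚ-sym

*ₚ-cancelʳ-≉0 : ∀ f g → ¬ (g ≈ₚ 0ₚ) → f *ₚ g ≈ₚ 0ₚ → f ≈ₚ 0ₚ
*ₚ-cancelʳ-≉0 f g g≉0 fg≈0 with zero? f
... | yes f≈0 = f≈0
... | no  f≉0 = ⊥-elim (*-≉0 f g f≉0 g≉0 fg≈0)

≃-trans : ∀ {A B C} → A ≃ B → B ≃ C → A ≃ C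
≃-trans {frac a x _} {frac b y y≉0} {frac c z _} A≃B B≃C =
  ×.difference≈0 (a *ₚ z) (c *ₚ x)
    (*ₚ-cancelʳ-≉0 _ y y≉0 (×.trans-× a x b y c z A≃B B≃C))

+ᶠ-cong : ∀ {A A′ B B′} → A ≃ A′ → B ≃ B′ → A +ᶠ B ≃ A′ +ᶠ B′
+ᶠ-cong {frac a x _} {frac a′ x′ _} {frac b y _} {frac b′ y′ _} =
  ×.+-cong-× a x a′ x′ b y b′ y′

*ᶠ-cong : ∀ {A A′ B B′} → A ≃ A′ → B ≃ B′ → A *ᶠ B ≃ A′ *ᶠ B′
*ᶠ-cong {frac a x _} {frac a′ x′ _} {frac b y _} {frac b′ y′ _} =
  ×.*-cong-× a x a′ x′ b y b′ y′

-ᶠ-cong : ∀ {A A′} → A ≃ A′ → -ᶠ A ≃ -ᶠ A′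
-ᶠ-cong {frac a x _} {frac a′ x′ _} = ×.-‿cong-× a x a′ x′

+ᶠ-assoc : ∀ A B C → (A +ᶠ B) +ᶠ C ≃ A +ᶠ (B +ᶠ C)
+ᶠ-assoc (frac a x _) (frac b y _) (frac c z _) = ×.+-assoc-× a x b y c z

+ᶠ-comm : ∀ A B → A +ᶠ B ≃ B +ᶠ A
+ᶠ-comm (frac a x _) (frac b y _) = ×.+-comm-× a x b y

+ᶠ-identityˡ : ∀ A → 0ᶠ +ᶠ A ≃ A
+ᶠ-identityˡ (frac a x _) = ×.+-identityˡ-× a x

-ᶠ-inverseʳ : ∀ A → A +ᶠ -ᶠ A ≃ 0ᶠ
-ᶠ-inverseʳ (frac a x _) = ×.-‿inverseʳ-× a x

*ᶠ-assoc : ∀ A B C → (A *ᶠ B) *ᶠ C ≃ A *ᶠ (B *ᶠ C)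
*ᶠ-assoc (frac a x _) (frac b y _) (frac c z _) = ×.*-assoc-× a x b y c z

*ᶠ-comm : ∀ A B → A *ᶠ B ≃ B *ᶠ A
*ᶠ-comm (frac a x _) (frac b y _) = ×.*-comm-× a x b y

*ᶠ-identityˡ : ∀ A → 1ᶠ *ᶠ A ≃ A
*ᶠ-identityˡ (frac a x _) = ×.*-identityˡ-× a x

*ᶠ-distribˡ : ∀ A B C → A *ᶠ (B +ᶠ C) ≃ A *ᶠ B +ᶠ A *ᶠ C
*ᶠ-distribˡ (frac a x _) (frac b y _) (frac c z _) = ×.distribˡ-× a x b y c z

private
  tr : ∀ A B C → A ≃ B → B ≃ C → A ≃ C
  tr A B C = ≃-trans {A} {B} {C}

ℚ⟨q⟩-commutativeRing : CommutativeRing 0ℓ 0ℓ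
ℚ⟨q⟩-commutativeRing = record
  { Carrier = RatFun
  ; _≈_ = _≃_
  ; _+_ = _+ᶠ_
  ; _*_ = _*ᶠ_
  ; -_  = -ᶠ_
  ; 0#  = 0ᶠ
  ; 1#  = 1ᶠ
  ; isCommutativeRing = record
    { isRing = record
      { +-isAbelianGroup = record
        { isGroup = record
          { isMonoid = record
            { isSemigroup = record
              { isMagma = record
                { isEquivalence = record
                  { refl  = λ {A} → ≃-refl {A}
                  ; sym   = λ {A} {B} → ≃-sym {A} {B}
                  ; trans = λ {A} {B} {C} → ≃-trans {A} {B} {C}
                  }
                ; ∙-cong = λ {A} {A′} {B} {B′} → +ᶠ-cong {A} {A′} {B} {B′}
                }
              ; assoc = +ᶠ-assoc
              }
            ; identity = +ᶠ-identityˡ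
                       , λ A → tr (A +ᶠ 0ᶠ) (0ᶠ +ᶠ A) A (+ᶠ-comm A 0ᶠ) (+ᶠ-identityˡ A)
            }
          ; inverse = (λ A → tr (-ᶠ A +ᶠ A) (A +ᶠ -ᶠ A) 0ᶠ (+ᶠ-comm (-ᶠ A) A) (-ᶠ-inverseʳ A))
                    , -ᶠ-inverseʳ
          ; ⁻¹-cong = λ {A} {A′} → -ᶠ-cong {A} {A′}
          }
        ; comm = +ᶠ-comm
        }
      ; *-cong = λ {A} {A′} {B} {B′} → *ᶠ-cong {A} {A′} {B} {B′}
      ; *-assoc = *ᶠ-assoc
      ; *-identity = *ᶠ-identityˡ
                   , λ A → tr (A *ᶠ 1ᶠ) (1ᶠ *ᶠ A) A (*ᶠ-comm A 1ᶠ) (*ᶠ-identityˡ A)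
      ; distrib = *ᶠ-distribˡ
                , λ C A B → tr ((A +ᶠ B) *ᶠ C) (C *ᶠ (A +ᶠ B)) (A *ᶠ C +ᶠ B *ᶠ C)
                    (*ᶠ-comm (A +ᶠ B) C)
                    (tr (C *ᶠ (A +ᶠ B)) (C *ᶠ A +ᶠ C *ᶠ B) (A *ᶠ C +ᶠ B *ᶠ C)
                      (*ᶠ-distribˡ C A B)
                      (+ᶠ-cong {C *ᶠ A} {A *ᶠ C} {C *ᶠ B} {B *ᶠ C} (*ᶠ-comm C A) (*ᶠ-comm C B)))
      }
    ; *-comm = *ᶠ-comm
    }
  }

⁻¹-inverseʳ : ∀ A → ¬ (A ≃ 0ᶠ) → A *ᶠ A ⁻¹ ≃ 1ᶠ
⁻¹-inverseʳ (frac a x x≉0) A≄0 with zero? a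
... | yes a≈0 = ⊥-elim (A≄0 (≈ₚ-trans (*ₚ-cong a≈0 (≈ₚ-refl {1ₚ})) ≈ₚ-refl))
... | no  _   = ×.inverseʳ-× a x

open Comaximality ℚ[q]-commutativeRing
private module ℙ = CommutativeRing ℚ[q]-commutativeRing

-- Euclid's algorithm in ℚ[q]

const-inverse : ∀ {a} → a ≢ 0ℚ → ∃ λ b → b ℚ.* a ≡ 1ℚ
const-inverse {a} a≢0 = ℚ.1/ a , ℚ.*-inverseˡ a
  where instance _ = ℚ.≢-nonZero a≢0

const-*-const : ∀ {a b} → a ℚ.* b ≡ 1ℚ → (a ∷ []) *ₚ (b ∷ []) ≈ₚ 1ₚ
const-*-const {a} {b} ab≡1 = ≈ₚ-trans (const-*ₚ a (b ∷ [])) (∷-cong ab≡1 ≈ₚ-refl)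

X-*ₚ : ∀ f → X *ₚ f ≈ₚ 0ℚ ∷ f
X-*ₚ f = ≈ₚ-trans (X*ₚ 1ₚ f) (∷-cong ≡.refl (*ₚ-identityˡ f))

∷≈ : ∀ a f → a ∷ f ≈ₚ (a ∷ []) +ₚ X *ₚ f
∷≈ a f = ≈ₚ-trans (∷-cong (≡.sym (ℚ.+-identityʳ a)) ≈ₚ-refl)
                  (+ₚ-cong {a ∷ []} ≈ₚ-refl (≈ₚ-sym (X-*ₚ f)))

-- With h = b + Xg and b invertible, b⁻¹h - b⁻¹gX = 1.
X⊥ : ∀ {b} g → b ≢ 0ℚ → Comaximal X (b ∷ g)
X⊥ {b} g b≢0 with const-inverse b≢0
... | b̄ , b̄b≡1 = -ₚ ((b̄ ∷ []) *ₚ g) , (b̄ ∷ []) ,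
  linear₂ (b̄ ∷ []) (∷≈ b g) 1ₚ (const-*-const {b̄} {b} b̄b≡1)
    (solve 5 (λ x c c̄ g h →
      (:- (c̄ :* g)) :* x :+ c̄ :* h :+ c̄ :* (c :+ x :* g) :+ :1 :* :1
        := :1 :+ c̄ :* h :+ :1 :* (c̄ :* c))
      ℙ.refl X (b ∷ []) (b̄ ∷ []) g (b ∷ g))
  where open ℤ-Solver ℚ[q]-commutativeRing

length-+ₚ : ∀ f g → length g ≤ length f → length (f +ₚ g) ≤ length f
length-+ₚ []      []      _        = z≤n
length-+ₚ (a ∷ f) []      _        = ℕ.≤-refl
length-+ₚ (a ∷ f) (b ∷ g) (s≤s le) = s≤s (length-+ₚ f g le)

length-scale : ∀ a f → length (scale a f) ≡ length f
length-scale a []      = ≡.refl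
length-scale a (b ∷ f) = ≡.cong suc (length-scale a f)

-- Euclid's algorithm run on the constant coefficients: when b ≢ 0, subtracting
-- a multiple of b ∷ g from a ∷ f leaves X h, and X is coprime to b ∷ g.
euclid-step : ∀ a f {b} g → b ≢ 0ℚ →
  ∃ λ c → GCD (f +ₚ scale c g) (b ∷ g) → GCD (a ∷ f) (b ∷ g)
euclid-step a f {b} g b≢0 with const-inverse b≢0
... | b̄ , b̄b≡1 = ℚ.- (a ℚ.* b̄) , λ G →
  gcd-resp recombine (gcd-add (a ℚ.* b̄ ∷ []) (gcd-strip (X⊥ g b≢0) G))
  where
  open ℤ-Solver ℚ[q]-commutativeRing
  c = a ℚ.* b̄
  cb≡a : (c ∷ []) *ₚ (b ∷ []) ≈ₚ a ∷ []
  cb≡a = ≈ₚ-trans (const-*ₚ c (b ∷ []))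
    (∷-cong (≡.trans (ℚ.*-assoc a b̄ b) (≡.trans (≡.cong (a ℚ.*_) b̄b≡1) (ℚ.*-identityʳ a))) ≈ₚ-refl)
  recombine : X *ₚ (f +ₚ scale (ℚ.- c) g) +ₚ (c ∷ []) *ₚ (b ∷ g) ≈ₚ a ∷ f
  recombine = linear₄ (-ₚ X) (const-*ₚ (ℚ.- c) g) (c ∷ []) (∷≈ b g) 1ₚ cb≡a (-ₚ 1ₚ) (∷≈ a f)
    (solve 9 (λ x f c a b g h s k →
      x :* (f :+ s) :+ c :* h
        :+ (:- x) :* s :+ c :* (b :+ x :* g) :+ :1 :* a :+ (:- :1) :* (a :+ x :* f)
      := k :+ (:- x) :* ((:- c) :* g) :+ c :* h :+ :1 :* (c :* b) :+ (:- :1) :* k)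
      ℙ.refl X f (c ∷ []) (a ∷ []) (b ∷ []) g (b ∷ g) (scale (ℚ.- c) g) (a ∷ f))

-- Trailing zeros are allowed, so constant coefficients are at hand where leading ones are not. If
-- both vanish, X moves into the gcd; if one vanishes, its X is comaximal with the other polynomial;
-- otherwise the longer list is reduced by the shorter. Every step drops a coefficient, so the total
-- length serves as fuel.
polynomial-gcd : ∀ f g → GCD f g
polynomial-gcd f g = go (length f ℕ.+ length g) f g ℕ.≤-refl
  where
  go : ∀ n f g → length f ℕ.+ length g ≤ n → GCD f g
  go n       []      g       _  = gcd-zero g
  go n       (a ∷ f) []      _  = gcd-sym (gcd-zero (a ∷ f))
  go (suc n) (a ∷ f) (b ∷ g) (s≤s le) with a ℚ.≟ 0ℚ | b ℚ.≟ 0ℚ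
  ... | yes ≡.refl | yes ≡.refl =
    gcd-resp (X-*ₚ f) (gcd-sym (gcd-resp (X-*ₚ g) (gcd-sym (gcd-scale X
      (go n f g (ℕ.≤-trans (ℕ.+-monoʳ-≤ (length f) (ℕ.n≤1+n (length g))) le))))))
  ... | yes ≡.refl | no b≢0 = gcd-resp (X-*ₚ f) (gcd-strip (X⊥ g b≢0) (go n f (b ∷ g) le))
  ... | no a≢0 | yes ≡.refl = gcd-sym (gcd-resp (X-*ₚ g) (gcd-strip (X⊥ f a≢0)
    (go n g (a ∷ f) (ℕ.≤-trans (ℕ.≤-reflexive
      (≡.trans (ℕ.+-suc (length g) (length f))
        (≡.trans (≡.cong suc (ℕ.+-comm (length g) (length f))) (≡.sym (ℕ.+-suc (length f) (length g)))))) le))))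
  ... | no a≢0 | no b≢0 with ℕ.≤-total (length g) (length f)
  ... | inj₁ g≤f = let c , step = euclid-step a f g b≢0 in
    step (go n (f +ₚ scale c g) (b ∷ g)
      (ℕ.≤-trans (ℕ.+-monoˡ-≤ _ (length-+ₚ f (scale c g) (ℕ.≤-trans (ℕ.≤-reflexive (length-scale c g)) g≤f))) le))
  ... | inj₂ f≤g = let c , step = euclid-step b g f a≢0 in
    gcd-sym (step (go n (g +ₚ scale c f) (a ∷ f)
      (ℕ.≤-trans (ℕ.+-monoˡ-≤ _ (length-+ₚ g (scale c f) (ℕ.≤-trans (ℕ.≤-reflexive (length-scale c f)) f≤g)))
        (ℕ.≤-trans (ℕ.≤-reflexive
          (≡.trans (ℕ.+-suc (length g) (length f))
            (≡.trans (≡.cong suc (ℕ.+-comm (length g) (length f))) (≡.sym (ℕ.+-suc (length f) (length g)))))) le))))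

-- Integrality at [p]

fromPoly-cong : ∀ {f g} → f ≈ₚ g → fromPoly f ≃ fromPoly g
fromPoly-cong f≈g = *ₚ-cong f≈g (≈ₚ-refl {1ₚ})

fromPoly-+ : ∀ f g → fromPoly (f +ₚ g) ≃ fromPoly f +ᶠ fromPoly g
fromPoly-+ = solve 2 (λ f g → (f :+ g) :* (:1 :* :1) := (f :* :1 :+ g :* :1) :* :1) ℙ.refl
  where open ℤ-Solver ℚ[q]-commutativeRing

fromPoly-* : ∀ f g → fromPoly (f *ₚ g) ≃ fromPoly f *ᶠ fromPoly g
fromPoly-* = solve 2 (λ f g → (f :* g) :* (:1 :* :1) := (f :* g) :* :1) ℙ.refl
  where open ℤ-Solver ℚ[q]-commutativeRing

1-X^ : ℕ → Poly
1-X^ j = 1ₚ +ₚ -ₚ (X ^ₚ j)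

1-X^≉0 : ∀ j → ¬ (1-X^ (suc j) ≈ₚ 0ₚ)
1-X^≉0 j ≈0 = 1≢0 (≡.trans (≡.sym constant) (at ≈0 0))
  where
  1≢0 : 1ℚ ≢ 0ℚ
  1≢0 ()
  constant : coeff (1-X^ (suc j)) 0 ≡ 1ℚ
  constant = ≡.trans (coeff-+ 1ₚ (-ₚ (X ^ₚ suc j)) 0)
    (≡.cong (1ℚ ℚ.+_) (≡.trans (coeff-neg (X ^ₚ suc j) 0) (≡.cong ℚ.-_ (at (X-*ₚ (X ^ₚ j)) 0))))

X≉0 : ¬ (X ≈ₚ 0ₚ)
X≉0 X≈0 with at X≈0 1
... | ()

reciprocal : ∀ f → ¬ (f ≈ₚ 0ₚ) → RatFun
reciprocal f f≉0 = frac 1ₚ f f≉0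

reciprocal-inverse : ∀ f f≉0 → fromPoly f *ᶠ reciprocal f f≉0 ≃ 1ᶠ
reciprocal-inverse f f≉0 = ×.inverseʳ-× f 1ₚ

open Homomorphism ℚ[q]-commutativeRing ℚ⟨q⟩-commutativeRing fromPoly
open Laws fromPoly-cong fromPoly-+ fromPoly-* (λ f → ≃-refl {fromPoly (-ₚ f)}) (≃-refl {1ᶠ})

⁻¹-inverse : ∀ A B → A *ᶠ B ≃ 1ᶠ → A *ᶠ A ⁻¹ ≃ 1ᶠ
⁻¹-inverse = inverse-of-unit ℚ⟨q⟩-commutativeRing _⁻¹ ⁻¹-inverseʳ 1≄0
  where
  1≄0 : ¬ (1ᶠ ≃ 0ᶠ)
  1≄0 1≃0 with at 1≃0 0
  ... | ()

1-q^-inverse : ∀ j → (1ᶠ +ᶠ -ᶠ (q ^ᶠ suc j)) *ᶠ reciprocal (1-X^ (suc j)) (1-X^≉0 j) ≃ 1ᶠ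
1-q^-inverse j = unit-1-^ X (suc j) (reciprocal (1-X^ (suc j)) (1-X^≉0 j)) (reciprocal-inverse (1-X^ (suc j)) (1-X^≉0 j))

q-inverse : q *ᶠ q ⁻¹ ≃ 1ᶠ
q-inverse = ⁻¹-inverse q (reciprocal X X≉0) (reciprocal-inverse X X≉0)

1-q^-unit : ∀ i → (1ᶠ +ᶠ -ᶠ (q ^ᶠ suc i)) *ᶠ (1ᶠ +ᶠ -ᶠ (q ^ᶠ suc i)) ⁻¹ ≃ 1ᶠ
1-q^-unit i = ⁻¹-inverse (1ᶠ +ᶠ -ᶠ (q ^ᶠ suc i)) (reciprocal (1-X^ (suc i)) (1-X^≉0 i)) (1-q^-inverse i)

open QSeries ℚ⟨q⟩-commutativeRing using (module Supercongruence)
open Supercongruence q _⁻¹ ⁻¹-inverse q-inverse 1-q^-unit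
  using (w; summand; T; T-even; T-odd; ⁻¹-unique; zpow; module Modulo)

^ᶻ≡zpow : ∀ i → q ^ᶻ i ≡ zpow q i
^ᶻ≡zpow (ℤ.+ n)  = ≡.refl
^ᶻ≡zpow -[1+ n ] = ≡.refl

-- Invertibility of p and divisibility by p

fromℕ : ℕ → ℚ
fromℕ zero    = 0ℚ
fromℕ (suc n) = 1ℚ ℚ.+ fromℕ n

fromℕ-nonneg : ∀ n → 0ℚ ℚ.≤ fromℕ n
fromℕ-nonneg zero    = ℚ.≤-refl
fromℕ-nonneg (suc n) = ℚ.+-mono-≤ (ℚ.nonNegative⁻¹ 1ℚ) (fromℕ-nonneg n)

fromℕ-suc≢0 : ∀ n → fromℕ (suc n) ≢ 0ℚ
fromℕ-suc≢0 n eq = ℚ.<⇒≢ (ℚ.+-mono-<-≤ (ℚ.positive⁻¹ 1ℚ) (fromℕ-nonneg n)) (≡.sym eq)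

open RawSemiringDefinitions (Semiring.rawSemiring ℙ.semiring) using () renaming (_×_ to _·_)

·-const : ∀ n → n · 1ₚ ≈ₚ fromℕ n ∷ []
·-const zero    = ≈ₚ-sym 0∷0≈0
·-const (suc n) = +ₚ-cong {1ₚ} ≈ₚ-refl (·-const n)

·1-inverse : ∀ n → ∃ λ c → (suc n · 1ₚ) *ₚ c ≈ₚ 1ₚ
·1-inverse n with const-inverse (fromℕ-suc≢0 n)
... | b , ba≡1 = (b ∷ []) , ≈ₚ-trans (*ₚ-cong {g = b ∷ []} (·-const (suc n)) ≈ₚ-refl)
  (const-*-const {fromℕ (suc n)} {b} (≡.trans (ℚ.*-comm (fromℕ (suc n)) b) ba≡1))

-- In base q² the denominators are 1 - q^{2j}, so p has to be prime to 2j and not merely to j; the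
-- oddness of p enters here.
prime-∤-double : ∀ {p} → Prime p → p ≢ 2 → ∀ i → suc i ℕ.< p → ¬ (p ∣ 2 * suc i)
prime-∤-double p-prime p≢2 i i<p p∣ with euclidsLemma 2 (suc i) p-prime p∣
... | inj₂ p∣i = >⇒∤ i<p p∣i
... | inj₁ p∣2 with prime⇒irreducible prime[2] p∣2
...   | inj₁ ≡.refl = ¬prime[1] p-prime
...   | inj₂ p≡2    = p≢2 p≡2

prime-∤⇒coprime : ∀ {p j} → Prime p → ¬ (p ∣ j) → Coprime j p
prime-∤⇒coprime p-prime p∤j (d∣j , d∣p) with prime⇒irreducible p-prime d∣p
... | inj₁ d≡1    = d≡1
... | inj₂ ≡.refl = contradiction d∣j p∤j

-- Lowest terms and the local ring at [p]

lowestTerms : ∀ A → LowestTerms A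
lowestTerms (frac a x x≉0) = record
  { reduced = frac G.x′ G.y′ y′≉0
  ; A≃      = linear₂ G.y′ G.x≈ (-ₚ G.x′) G.y≈
      (solve 5 (λ a x a′ x′ d →
        a :* x′ :+ x′ :* (a′ :* d) :+ (:- a′) :* (x′ :* d)
          := a′ :* x :+ x′ :* a :+ (:- a′) :* x) ℙ.refl a x G.x′ G.y′ G.d)
  ; coprime = comaximal⇒coprime G.comaximal
  }
  where
  open ℤ-Solver ℚ[q]-commutativeRing
  module G = GCD (polynomial-gcd a x)
  y′≉0 : ¬ (G.y′ ≈ₚ 0ₚ)
  y′≉0 y′≈0 = x≉0 (≈ₚ-trans G.y≈ (*ₚ-cong {g = G.d} y′≈0 ≈ₚ-refl))

lowestTerms-comaximal : ∀ A → Comaximal (numerator (lowestTerms A)) (denominator (lowestTerms A))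
lowestTerms-comaximal (frac a x _) = GCD.comaximal (polynomial-gcd a x)

module _ (p : ℕ) where

  -- The local ring of ℚ[q] at [p].
  Integral : RatFun → Set
  Integral A = ∃ λ B → (A ≃ B) × Comaximal (den B) [ p ]ₚ

  φ : RatFun
  φ = fromPoly [ p ]ₚ

  integral⇒coprime : ∀ A → Integral A → Coprimeₚ (denominator (lowestTerms A)) [ p ]ₚ
  integral⇒coprime A (B , A≃B , B⊥) = comaximal⇒coprime
    (lowest-den {b = num B} (lowestTerms-comaximal A) reduced≃B B⊥)
    where
    L = LowestTerms.reduced (lowestTerms A)
    reduced≃B : L ≃ B
    reduced≃B = ≃-trans {L} {A} {B} (≃-sym {A} {L} (LowestTerms.A≃ (lowestTerms A))) A≃B

  congruence : ∀ {A B} → Integral A → Integral B →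
               (∃ λ C → Integral C × (A -ᶠ B ≃ φ *ᶠ φ *ᶠ C)) → A ≋ B mod[ p ]^ 2
  congruence {A} {B} A-int B-int (C , (C′ , C≃C′ , C′⊥) , eq) = record
    { lowestA   = lowestTerms A
    ; lowestB   = lowestTerms B
    ; lowestA-B = lowestTerms (A -ᶠ B)
    ; coprimeA  = integral⇒coprime A A-int
    ; coprimeB  = integral⇒coprime B B-int
    ; [p]ʳ∣A-B  = square-divides {b = num C′} C′⊥ reduced≃
    }
    where
    L = LowestTerms.reduced (lowestTerms (A -ᶠ B))
    reduced≃ : L ≃ φ *ᶠ φ *ᶠ C′
    reduced≃ = ≃-trans {L} {A -ᶠ B} {φ *ᶠ φ *ᶠ C′}
      (≃-sym {A -ᶠ B} {L} (LowestTerms.A≃ (lowestTerms (A -ᶠ B))))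
      (≃-trans {A -ᶠ B} {φ *ᶠ φ *ᶠ C} {φ *ᶠ φ *ᶠ C′} eq
        (*ᶠ-cong {φ *ᶠ φ} {φ *ᶠ φ} {C} {C′} (≃-refl {φ *ᶠ φ}) C≃C′))

  Integral-resp : ∀ {A B} → A ≃ B → Integral A → Integral B
  Integral-resp {A} {B} A≃B (C , A≃C , C⊥) =
    C , ≃-trans {B} {A} {C} (≃-sym {A} {B} A≃B) A≃C , C⊥

  Integral-poly : ∀ f → Integral (fromPoly f)
  Integral-poly f = fromPoly f , ≃-refl {fromPoly f} , comaximal-1

  Integral-+ : ∀ {A B} → Integral A → Integral B → Integral (A +ᶠ B)
  Integral-+ {A} {B} (A′ , A≃ , A⊥) (B′ , B≃ , B⊥) =
    A′ +ᶠ B′ , +ᶠ-cong {A} {A′} {B} {B′} A≃ B≃ , comaximal-* A⊥ B⊥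

  Integral-* : ∀ {A B} → Integral A → Integral B → Integral (A *ᶠ B)
  Integral-* {A} {B} (A′ , A≃ , A⊥) (B′ , B≃ , B⊥) =
    A′ *ᶠ B′ , *ᶠ-cong {A} {A′} {B} {B′} A≃ B≃ , comaximal-* A⊥ B⊥

  Integral-neg : ∀ {A} → Integral A → Integral (-ᶠ A)
  Integral-neg {A} (A′ , A≃ , A⊥) = -ᶠ A′ , -ᶠ-cong {A} {A′} A≃ , A⊥

  Integral-reciprocal : ∀ f f≉0 A → A *ᶠ reciprocal f f≉0 ≃ 1ᶠ → Comaximal f [ p ]ₚ → Integral (A ⁻¹)
  Integral-reciprocal f f≉0 A e f⊥ =
    reciprocal f f≉0 , ⁻¹-unique {A} {reciprocal f f≉0} e , f⊥

-- Parity and the indices of the closed form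

even-or-odd : ∀ d → ∃ λ i → d ≡ double i ⊎ d ≡ suc (double i)
even-or-odd zero = 0 , inj₁ ≡.refl
even-or-odd (suc d) with even-or-odd d
... | i , inj₁ ≡.refl = i , inj₂ ≡.refl
... | i , inj₂ ≡.refl = suc i , inj₁ ≡.refl

double-% : ∀ i s → (double i + s) % 2 ≡ s % 2
double-% zero    s = ≡.refl
double-% (suc i) s = double-% i s

suc-%-≢ : ∀ s → suc s % 2 ≢ s % 2
suc-%-≢ (suc (suc s)) = suc-%-≢ s

double-/2 : ∀ m → double m / 2 ≡ m
double-/2 m = ≡.trans (≡.cong (_/ 2) (≡.trans (double≡2* m) (ℕ.*-comm 2 m))) (m*n/n≡m m 2)

double-double-/4 : ∀ m → double (double m) / 4 ≡ m
double-double-/4 m = ≡.trans (≡.cong (_/ 4) eq) (m*n/n≡m m 4)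
  where
  eq : double (double m) ≡ m * 4
  eq = ≡.trans (double≡2* (double m)) (≡.trans (≡.cong (2 *_) (double≡2* m))
    (≡.trans (≡.sym (ℕ.*-assoc 2 2 m)) (ℕ.*-comm 4 m)))

double-+ : ∀ m k → double m + 2 * k ≡ double (m + k)
double-+ m k = ≡.trans (≡.cong (_+ 2 * k) (double≡2* m))
  (≡.trans (≡.sym (ℕ.*-distribˡ-+ 2 m k)) (≡.sym (double≡2* (m + k))))

-- The indices are free parameters, so the truncated quotients of the theorem can be exchanged for
-- i, 2i and 2(i+s) by matching on equations between natural numbers.
closedForm : ℕ → ℕ → ℕ → ℕ → ℕ → RatFun
closedForm n s i a c =
  (-ᶠ 1ᶠ) ^ᶠ s
    *ᶠ q ^ᶻ (n ⊖ (s ^ 2))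
    *ᶠ [ n choose i ]⟨ q ^ᶠ 4 ⟩ ^ᶠ 2
    *ᶠ (⟨ q ^ᶠ 2 ⨾ q ^ᶠ 2 ⟩[ a ] *ᶠ ⟨ q ^ᶠ 2 ⨾ q ^ᶠ 2 ⟩[ c ] /ᶠ ⟨ q ^ᶠ 4 ⨾ q ^ᶠ 4 ⟩[ n ] ^ᶠ 2)

module Main (n : ℕ) (p-prime : Prime (suc (double n))) (p≢2 : suc (double n) ≢ 2) where
  p : ℕ
  p = suc (double n)

  p̄ : Poly
  p̄ = proj₁ (·1-inverse (double n))

  w-integral : ∀ i → suc i ≤ double n → Integral p (w i)
  w-integral i i<p = Integral-reciprocal p D D≉0 (1ᶠ +ᶠ -ᶠ (q ^ᶠ 2) ^ᶠ suc i)
    (unit-1-^² X (suc i) (reciprocal D D≉0) (reciprocal-inverse D D≉0))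
    (1-xʲ⊥Φ X p p̄ (proj₂ (·1-inverse (double n)))
      (coprime-Bézout (prime-∤⇒coprime p-prime (prime-∤-double p-prime p≢2 i (s≤s i<p)))))
    where
    D : Poly
    D = 1-X^ (2 * suc i)
    D≉0 : ¬ (D ≈ₚ 0ₚ)
    D≉0 = 1-X^≉0 (i + 1 * suc i)

  open Modulo n (φ p) (ι-factor X p [ p ]ₚ (geometric-factor X p))
    (Integral p) (λ {A} {B} → Integral-resp p {A} {B}) (Integral-poly p 1ₚ)
    (λ {A} {B} → Integral-+ p {A} {B}) (λ {A} {B} → Integral-* p {A} {B})
    (λ {A} → Integral-neg p {A})
    (Integral-poly p X)
    (Integral-reciprocal p X X≉0 q (reciprocal-inverse X X≉0)
      (x⊥Φ X p p̄ (proj₂ (·1-inverse (double n))) ≡.refl))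
    w-integral

  congruence-T : ∀ s → s ≤ n → ∀ {V} → V ≃ T n s → truncatedSum s ≋ V mod[ p ]^ 2
  congruence-T s s≤n {V} V≃T = congruence p {truncatedSum s} {V} (Int-truncatedSum s s≤n)
    (Integral-resp p {T n s} {V} T≃V (Int-T s s≤n))
    (~-resp {truncatedSum s} {truncatedSum s} {T n s} {V} (≃-refl {truncatedSum s}) T≃V (truncatedSum~T s s≤n))
    where
    T≃V : T n s ≃ V
    T≃V = ≃-sym {V} {T n s} V≃T

  closedForm-even : ∀ s i → n ≡ double i + s → closedForm n s i (double i) (double (i + s)) ≃ T n s
  closedForm-even s i n≡ = ≡.subst (λ n → closedForm n s i (double i) (double (i + s)) ≃ T n s)
    (≡.sym n≡) (T-even i s (^ᶻ≡zpow (double i + s ⊖ s ^ 2)))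

  p-2s-1 : ∀ d s → n ≡ d + s → p ∸ 2 * s ∸ 1 ≡ double d
  p-2s-1 d s n≡ = ≡.trans (ℕ.∸-+-assoc p (2 * s) 1)
    (≡.trans (≡.cong (p ∸_) (ℕ.+-comm (2 * s) 1))
      (≡.trans (≡.cong (_∸ 2 * s) (≡.trans (≡.cong double n≡) (≡.sym (double-+ d s))))
        (ℕ.m+n∸n≡m (double d) (2 * s))))

  closedFormₚ : ℕ → RatFun
  closedFormₚ s = closedForm n s ((p ∸ 2 * s ∸ 1) / 4) ((p ∸ 2 * s ∸ 1) / 2) ((p + 2 * s ∸ 1) / 2)

  congruence-even : ∀ s i → s ≤ n → n ≡ double i + s → truncatedSum s ≋ closedFormₚ s mod[ p ]^ 2
  congruence-even s i s≤n n≡ = go i≡ a≡ c≡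
    where
    go : ∀ {i′ a c} → i′ ≡ i → a ≡ double i → c ≡ double (i + s) → truncatedSum s ≋ closedForm n s i′ a c mod[ p ]^ 2
    go ≡.refl ≡.refl ≡.refl =
      congruence-T s s≤n {closedForm n s i (double i) (double (i + s))} (closedForm-even s i n≡)
    i≡ : (p ∸ 2 * s ∸ 1) / 4 ≡ i
    i≡ = ≡.trans (≡.cong (_/ 4) (p-2s-1 (double i) s n≡)) (double-double-/4 i)
    a≡ : (p ∸ 2 * s ∸ 1) / 2 ≡ double i
    a≡ = ≡.trans (≡.cong (_/ 2) (p-2s-1 (double i) s n≡)) (double-/2 (double i))
    c≡ : (p + 2 * s ∸ 1) / 2 ≡ double (i + s)
    c≡ = ≡.trans (≡.cong (_/ 2) (double-+ n s)) (≡.trans (double-/2 (n + s))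
      (≡.trans (≡.cong (_+ s) n≡) (≡.trans (ℕ.+-assoc (double i) s s)
        (≡.trans (≡.cong (double i +_) (≡.cong (s +_) (≡.sym (ℕ.+-identityʳ s)))) (double-+ i s)))))

  congruence-odd : ∀ s i → s ≤ n → n ≡ suc (double i) + s → truncatedSum s ≋ 0ᶠ mod[ p ]^ 2
  congruence-odd s i s≤n n≡ = congruence-T s s≤n {0ᶠ} (≃-sym {T n s} {0ᶠ} T≃0)
    where
    T≃0 : T n s ≃ 0ᶠ
    T≃0 = ≡.subst (λ n → T n s ≃ 0ᶠ) (≡.sym n≡) (T-odd i s)

  -- The decision that selects the case of the theorem is an argument, so that it can be matched
  -- together with the parity of n - s; the two mixed combinations are contradictory.
  congruence-by-parity : ∀ s → s ≤ n → (∃ λ i → n ∸ s ≡ double i ⊎ n ∸ s ≡ suc (double i)) →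
    (parity : Dec (s % 2 ≡ n % 2)) → truncatedSum s ≋ (if ⌊ parity ⌋ then closedFormₚ s else 0ᶠ) mod[ p ]^ 2
  congruence-by-parity s s≤n (i , parity) = go parity
    where
    n≡ : ∀ {d} → n ∸ s ≡ d → n ≡ d + s
    n≡ eq = ≡.trans (≡.sym (ℕ.m∸n+n≡m s≤n)) (≡.cong (_+ s) eq)
    go : n ∸ s ≡ double i ⊎ n ∸ s ≡ suc (double i) →
         (parity : Dec (s % 2 ≡ n % 2)) → truncatedSum s ≋ (if ⌊ parity ⌋ then closedFormₚ s else 0ᶠ) mod[ p ]^ 2
    go (inj₁ even) (yes _)   = congruence-even s i s≤n (n≡ even)
    go (inj₁ even) (no s≢n)  =
      contradiction (≡.sym (≡.trans (≡.cong (_% 2) (n≡ even)) (double-% i s))) s≢n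
    go (inj₂ odd)  (yes s≡n) = contradiction
      (≡.trans (≡.sym (double-% i (suc s)))
        (≡.trans (≡.cong (_% 2) (≡.trans (ℕ.+-suc (double i) s) (≡.sym (n≡ odd)))) (≡.sym s≡n)))
      (suc-%-≢ s)
    go (inj₂ odd)  (no _)    = congruence-odd s i s≤n (n≡ odd)

theorem2p1 : ∀ (p s : ℕ) → Prime p → p ≢ 2 → s ≤ (p ∸ 1) / 2 →
    (∑[ k ≤ (p ∸ 1) / 2 ]
        ([ 2 * k choose k ]⟨ q ^ᶠ 2 ⟩ ^ᶠ 2
          *ᶠ [ 2 * k choose k + s ]⟨ q ^ᶠ 2 ⟩
          *ᶠ (q ^ᶠ (2 * k)
              /ᶠ (⟨ -ᶠ q ^ᶠ 2 ⨾ q ^ᶠ 2 ⟩[ k ] ^ᶠ 2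
                  *ᶠ ⟨ -ᶠ q ⨾ q ⟩[ 2 * k ] ^ᶠ 2))))
    ≋
    (if ⌊ s % 2 ≟ ((p ∸ 1) / 2) % 2 ⌋
     then (-ᶠ 1ᶠ) ^ᶠ s
          *ᶠ q ^ᶻ (((p ∸ 1) / 2) ⊖ (s ^ 2))
          *ᶠ [ (p ∸ 1) / 2 choose (p ∸ 2 * s ∸ 1) / 4 ]⟨ q ^ᶠ 4 ⟩ ^ᶠ 2
          *ᶠ (⟨ q ^ᶠ 2 ⨾ q ^ᶠ 2 ⟩[ (p ∸ 2 * s ∸ 1) / 2 ]
              *ᶠ ⟨ q ^ᶠ 2 ⨾ q ^ᶠ 2 ⟩[ (p + 2 * s ∸ 1) / 2 ]
              /ᶠ ⟨ q ^ᶠ 4 ⨾ q ^ᶠ 4 ⟩[ (p ∸ 1) / 2 ] ^ᶠ 2)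
     else 0ᶠ)
    mod[ p ]^ 2
theorem2p1 p s p-prime p≢2 = by-parity (even-or-odd p)
  where
  -- Abstracts (p - 1)/2 to a variable, which allows it to be replaced by the n with p = 2n + 1.
  Goal : ℕ → Set
  Goal N = s ≤ N →
    ∑≤ N (summand s) ≋
    (if ⌊ s % 2 ≟ N % 2 ⌋
     then closedForm N s ((p ∸ 2 * s ∸ 1) / 4) ((p ∸ 2 * s ∸ 1) / 2) ((p + 2 * s ∸ 1) / 2)
     else 0ᶠ)
    mod[ p ]^ 2

  odd-case : ∀ n → p ≡ suc (double n) → Goal n
  odd-case n ≡.refl s≤n =
    Main.congruence-by-parity n p-prime p≢2 s s≤n (even-or-odd (n ∸ s)) (s % 2 ≟ n % 2)

  half : ∀ n → p ≡ suc (double n) → n ≡ (p ∸ 1) / 2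
  half n ≡.refl = ≡.sym (double-/2 n)

  not-even : ∀ n → p ≢ double n
  not-even n p≡ with prime⇒irreducible p-prime
    (divides n (≡.trans p≡ (≡.trans (double≡2* n) (ℕ.*-comm 2 n))))
  ... | inj₂ 2≡p = p≢2 (≡.sym 2≡p)

  by-parity : (∃ λ n → p ≡ double n ⊎ p ≡ suc (double n)) → Goal ((p ∸ 1) / 2)
  by-parity (n , inj₁ p≡) = contradiction p≡ (not-even n)
  by-parity (n , inj₂ p≡) = ≡.subst Goal (half n p≡) (odd-case n p≡)
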